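{- Let $\mathbf{X}$ be a computable Polish space. Then $\operatorname{ConstructMeasure}_{\mathbf{X}} \equiv_{\mathrm{W}} \mathrm{C}_{\mathbf{X}}$.
   Context: A represented space $\mathbf{X}=(X,\delta_{\mathbf{X}})$ is a set $X$ with a partial surjection $\delta_{\mathbf{X}}:\subseteq\mathbb{N}^{\mathbb{N}}\to X$. A realizer of a (partial, multivalued) $f:\subseteq\mathbf{X}\rightrightarrows\mathbf{Y}$, written $F\vdash f$, is a partial $F$ on $\mathbb{N}^{\mathbb{N}}$ with $\delta_{\mathbf{Y}}(F(p))\in f(\delta_{\mathbf{X}}(p))$ whenever $\delta_{\mathbf{X}}(p)\in\operatorname{dom}(f)$; $f$ is computable (continuous) if it has a computable (continuous) realizer. $\mathcal{C}(\mathbf{X},\mathbf{Y})$ is the represented space of continuous functions: $0^n1p$ names $f$ if the $n$-th oracle machine with oracle $p$ computes a realizer of $f$. $\mathbb{S}=\{\bot,\top\}$: $0^{\mathbb{N}}$ names $\bot$, every other sequence names $\top$. $\mathcal{O}(\mathbf{X})$ (open sets) identifies $U=f^{ -1}(\{\top\})$ with $f\in\mathcal{C}(\mathbf{X},\mathbb{S})$; $\mathcal{A}(\mathbf{X})$ (closed sets) represents a closed set by $\mathcal{O}(\mathbf{X})$-names of its complement. $f\leq_{\mathrm{W}}g$ (Weihrauch reducibility): there are computable $K,H:\subseteq\mathbb{N}^{\mathbb{N}}\to\mathbb{N}^{\mathbb{N}}$ such that $K\langle\operatorname{id},GH\rangle\vdash f$ for all $G\vdash g$; $\equiv_{\mathrm{W}}$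 is the induced equivalence. Closed choice $\mathrm{C}_{\mathbf{X}}:\subseteq\mathcal{A}(\mathbf{X})\rightrightarrows\mathbf{X}$ maps a non-empty closed set to an arbitrary point in it. $\mathbb{R}_<$: a real $x$ is named by a non-decreasing sequence of rationals with supremum $x$. $\mathcal{M}(\mathbf{X})$ is the subspace of $\mathcal{C}(\mathcal{O}(\mathbf{X}),\mathbb{R}_<)$ of those $\mu$ that are restrictions to open sets of finite Borel measures on $X$. $\operatorname{supp}(\mu)$ is the closed set such that an open $U$ intersects it iff $\mu(U)>0$. $\operatorname{ConstructMeasure}_{\mathbf{X}}:\subseteq\mathcal{A}(\mathbf{X})\rightrightarrows\mathcal{M}(\mathbf{X})$ maps a non-empty closed set $A$ to any non-zero measure $\mu$ with $\operatorname{supp}(\mu)\subseteq A$. A computable metric space is $(M,d,(a_n))$ with $(a_n)$ dense in the metric space $(M,d)$ and $\{(t,u,v,w)\mid\nu_{\mathbb{Q}}(t)<d(a_u,a_v)<\nu_{\mathbb{Q}}(w)\}$ recursively enumerable ($\nu_{\mathbb{Q}}$ a standard numbering of $\mathbb{Q}$); $p$ is a Cauchy name of $x$ iff $d(a_{p(i)},a_{p(k)})\leq2^{ -i}$ for $i<k$ and $x=\lim_i a_{p(i)}$. A computable Polish space is the represented space arising from a complete computable metric space. -}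

module Defs where

open import Axiom.ExcludedMiddle using (ExcludedMiddle)
open import Data.Bool.Base using (Bool; true; false)
open import Data.Empty using (⊥-elim)
open import Data.Integer.Base as ℤ using (+_; -[1+_])
open import Data.Nat.Base as ℕ using (ℕ; zero; suc; s≤s; z≤n)
import Data.Nat.Properties as ℕ
open import Data.Product.Base
  using (Σ; Σ-syntax; ∃; ∃-syntax; ∃₂; _×_; _,_; proj₁; proj₂)
open import Data.Rational.Base as ℚ using (ℚ; 0ℚ; 1ℚ; ½; mkℚ; *<*)
import Data.Rational.Properties as ℚ
import Data.Rational.Unnormalised.Base as ℚᵘ
import Data.Rational.Unnormalised.Properties as ℚᵘ
open import Data.Sum.Base using (inj₁; inj₂)
open import Function.Base using (_∘_; id; const)
open import Function.Bundles using (Func; _⇔_; mk⇔; Equivalence)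
open import Level using (Level; _⊔_; 0ℓ) renaming (suc to lsuc)
open import Relation.Binary.Bundles using (Setoid)
open import Relation.Binary.Definitions using (tri<; tri≈; tri>)
open import Relation.Binary.PropositionalEquality
  using (_≡_; _≢_; _≗_; refl; sym; trans; cong; cong₂; subst; subst₂; module ≡-Reasoning)
  renaming (setoid to ≡-setoid)
open import Relation.Nullary using (¬_; Dec; yes; no)
open import Relation.Unary using (Pred; _∈_; _⊆_; _≐_; _∩_; ∁; ⋃; Empty; Satisfiable)

private
  variable
    c ℓ r c′ ℓ′ r′ c″ ℓ″ r″ c‴ ℓ‴ r‴ γ γ′ : Level

triangle : ℕ → ℕ
triangle zero    = 0
triangle (suc n) = suc n ℕ.+ triangle n

opaque
  ⟪_,_⟫ : ℕ → ℕ → ℕ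
  ⟪ a , b ⟫ = triangle (a ℕ.+ b) ℕ.+ b

next : ℕ × ℕ → ℕ × ℕ
next (zero  , b) = suc b , zero
next (suc a , b) = a , suc b

unpair : ℕ → ℕ × ℕ
unpair zero    = 0 , 0
unpair (suc n) = next (unpair n)

π₁ π₂ : ℕ → ℕ
π₁ = proj₁ ∘ unpair
π₂ = proj₂ ∘ unpair

opaque
  unfolding ⟪_,_⟫

  unpair-pair : ∀ a b → unpair ⟪ a , b ⟫ ≡ (a , b)
  unpair-pair a b = go (a ℕ.+ b) a b refl
    where
    go : ∀ s a b → a ℕ.+ b ≡ s → unpair (triangle s ℕ.+ b) ≡ (a , b)
    go zero    zero zero _ = refl
    go (suc s) a zero eq with trans (sym (ℕ.+-identityʳ a)) eq
    ... | refl = begin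
      unpair (triangle (suc s) ℕ.+ 0)      ≡⟨ cong unpair (ℕ.+-identityʳ (triangle (suc s))) ⟩
      next (unpair (s ℕ.+ triangle s))     ≡⟨ cong (next ∘ unpair) (ℕ.+-comm s _) ⟩
      next (unpair (triangle s ℕ.+ s))     ≡⟨ cong next (go s 0 s refl) ⟩
      (suc s , 0)                          ∎
      where open ≡-Reasoning
    go s a (suc b) eq = begin
      unpair (triangle s ℕ.+ suc b)        ≡⟨ cong unpair (ℕ.+-suc (triangle s) b) ⟩
      next (unpair (triangle s ℕ.+ b))     ≡⟨ cong next (go s (suc a) b (trans (sym (ℕ.+-suc a b)) eq)) ⟩
      (a , suc b)                          ∎
      where open ≡-Reasoning

π₁-pair : ∀ a b → π₁ ⟪ a , b ⟫ ≡ a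
π₁-pair a b = cong proj₁ (unpair-pair a b)

π₂-pair : ∀ a b → π₂ ⟪ a , b ⟫ ≡ b
π₂-pair a b = cong proj₂ (unpair-pair a b)

opaque
  unfolding ⟪_,_⟫

  pair-next : ∀ x → ⟪ proj₁ (next x) , proj₂ (next x) ⟫ ≡ suc ⟪ proj₁ x , proj₂ x ⟫
  pair-next (zero , b) = trans (ℕ.+-identityʳ _)
    (cong suc (trans (cong₂ ℕ._+_ (ℕ.+-identityʳ b) (cong triangle (ℕ.+-identityʳ b))) (ℕ.+-comm b _)))
  pair-next (suc a , b) = trans (ℕ.+-suc _ b)
    (cong (λ s → suc (triangle s ℕ.+ b)) (ℕ.+-suc a b))

  pair-unpair : ∀ n → ⟪ π₁ n , π₂ n ⟫ ≡ n
  pair-unpair zero    = refl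
  pair-unpair (suc n) = trans (pair-next (unpair n)) (cong suc (pair-unpair n))

  n≤triangle : ∀ n → n ℕ.≤ triangle n
  n≤triangle zero    = z≤n
  n≤triangle (suc n) = ℕ.m≤m+n (suc n) (triangle n)

  m≤pair : ∀ m n → m ℕ.≤ ⟪ m , n ⟫
  m≤pair m n = ℕ.≤-trans (ℕ.m≤m+n m n) (ℕ.≤-trans (n≤triangle (m ℕ.+ n)) (ℕ.m≤m+n _ n))

  n≤pair : ∀ m n → n ℕ.≤ ⟪ m , n ⟫
  n≤pair m n = ℕ.m≤n+m n _

  n<pair : ∀ t n → n ℕ.< ⟪ suc t , n ⟫
  n<pair t n = s≤s (ℕ.m≤n+m n _)

Baire : Set
Baire = ℕ → ℕ

Agree : ℕ → Baire → Baire → Set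
Agree n p q = ∀ i → i ℕ.< n → p i ≡ q i

-- ⟨ p , q ⟩ interleaves: p at even positions, q at odd ones.
⟨_,_⟩ : Baire → Baire → Baire
⟨ p , q ⟩ zero    = p 0
⟨ p , q ⟩ (suc n) = ⟨ q , p ∘ suc ⟩ n

0^_▹1_ : ℕ → Baire → Baire
(0^ zero  ▹1 p) zero    = 1
(0^ zero  ▹1 p) (suc k) = p k
(0^ suc n ▹1 p) zero    = 0
(0^ suc n ▹1 p) (suc k) = (0^ n ▹1 p) k

Prefix : ℕ → Baire → ℕ
Prefix zero    p = 0
Prefix (suc m) p = ⟪ p m , Prefix m p ⟫

⟨⟩-cong : ∀ {p p′ q q′} → p ≗ p′ → q ≗ q′ → ⟨ p , q ⟩ ≗ ⟨ p′ , q′ ⟩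
⟨⟩-cong e f zero    = e 0
⟨⟩-cong e f (suc n) = ⟨⟩-cong f (e ∘ suc) n

double : ℕ → ℕ
double zero    = 0
double (suc n) = suc (suc (double n))

⟨⟩-even : ∀ p q n → ⟨ p , q ⟩ (double n) ≡ p n
⟨⟩-even p q zero    = refl
⟨⟩-even p q (suc n) = ⟨⟩-even (p ∘ suc) (q ∘ suc) n

⟨⟩-odd : ∀ p q n → ⟨ p , q ⟩ (suc (double n)) ≡ q n
⟨⟩-odd p q n = ⟨⟩-even q (p ∘ suc) n

▹1-injective : ∀ m n {p q} → 0^ m ▹1 p ≗ 0^ n ▹1 q → m ≡ n × p ≗ q
▹1-injective zero    zero    e = refl , e ∘ suc
▹1-injective zero    (suc n) e with () ← e 0
▹1-injective (suc m) zero    e with () ← e 0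
▹1-injective (suc m) (suc n) e with ▹1-injective m n (e ∘ suc)
... | refl , f = refl , f

Prefix-cong : ∀ m {p q} → Agree m p q → Prefix m p ≡ Prefix m q
Prefix-cong zero    a = refl
Prefix-cong (suc m) a =
  cong₂ ⟪_,_⟫ (a m ℕ.≤-refl) (Prefix-cong m λ i lt → a i (ℕ.m<n⇒m<1+n lt))

Prefix-agree : ∀ m {p q} → Prefix m p ≡ Prefix m q → Agree m p q
Prefix-agree (suc m) {p} {q} e i i<1+m with ℕ.m<1+n⇒m<n∨m≡n i<1+m
... | inj₁ i<m  = Prefix-agree m tail i i<m
  where
  tail = trans (sym (π₂-pair (p m) _)) (trans (cong π₂ e) (π₂-pair (q m) _))
... | inj₂ refl = trans (sym (π₁-pair (p m) _)) (trans (cong π₁ e) (π₁-pair (q m) _))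

-- A partial function :⊆ ℕ^ℕ → ℕ^ℕ.  Without function extensionality, respecting
-- pointwise equality has to be required.
record PartialFunction : Set₁ where
  field
    dom        : Pred Baire 0ℓ
    dom-resp   : ∀ {p q} → p ≗ q → p ∈ dom → q ∈ dom
    apply      : ∀ p → p ∈ dom → Baire
    apply-cong : ∀ {p q} (d : p ∈ dom) (e : q ∈ dom) → p ≗ q → apply p d ≗ apply q e

open PartialFunction

infixr 9 _∘ᵖ_

_∘ᵖ_ : PartialFunction → PartialFunction → PartialFunction
G ∘ᵖ F = record
  { dom        = λ p → Σ[ d ∈ p ∈ dom F ] apply F p d ∈ dom G
  ; dom-resp   = λ pq (d , e) →
      let d′ = dom-resp F pq d in d′ , dom-resp G (apply-cong F d d′ pq) e
  ; apply      = λ p (d , e) → apply G (apply F p d) e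
  ; apply-cong = λ (d , e) (d′ , e′) pq → apply-cong G e e′ (apply-cong F d d′ pq)
  }

⟨id,_⟩ : PartialFunction → PartialFunction
⟨id, F ⟩ = record
  { dom        = dom F
  ; dom-resp   = dom-resp F
  ; apply      = λ p d → ⟨ p , apply F p d ⟩
  ; apply-cong = λ d e pq → ⟨⟩-cong pq (apply-cong F d e pq)
  }

ContinuousPartial : PartialFunction → Set
ContinuousPartial F = ∀ p (d : p ∈ dom F) n → ∃[ m ] (∀ q (e : q ∈ dom F) →
  Agree m p q → Agree n (apply F p d) (apply F q e))

-- Oracle machines are presented as programs for the partial recursive functions relative to an
-- oracle.

data Code : Set where
  zeroᶜ succᶜ fstᶜ sndᶜ oracleᶜ : Code
  pairᶜ compᶜ precᶜ             : Code → Code → Code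
  minᶜ                          : Code → Code

infix 4 _⊢_[_]⇓_

-- o ⊢ c [ n ]⇓ v : with oracle o, program c on input n halts with output v.
data _⊢_[_]⇓_ (o : Baire) : Code → ℕ → ℕ → Set

data Rec (o : Baire) (f g : Code) (a : ℕ) : ℕ → ℕ → Set where
  base : ∀ {v} → o ⊢ f [ a ]⇓ v → Rec o f g a 0 v
  step : ∀ {n u v} → Rec o f g a n u → o ⊢ g [ ⟪ a , ⟪ n , u ⟫ ⟫ ]⇓ v → Rec o f g a (suc n) v

data _⊢_[_]⇓_ o where
  zeroᶜ   : ∀ {n} → o ⊢ zeroᶜ [ n ]⇓ 0
  succᶜ   : ∀ {n} → o ⊢ succᶜ [ n ]⇓ suc n
  fstᶜ    : ∀ {n} → o ⊢ fstᶜ [ n ]⇓ π₁ n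
  sndᶜ    : ∀ {n} → o ⊢ sndᶜ [ n ]⇓ π₂ n
  oracleᶜ : ∀ {n} → o ⊢ oracleᶜ [ n ]⇓ o n
  pairᶜ   : ∀ {f g n u v} → o ⊢ f [ n ]⇓ u → o ⊢ g [ n ]⇓ v → o ⊢ pairᶜ f g [ n ]⇓ ⟪ u , v ⟫
  compᶜ   : ∀ {f g n u v} → o ⊢ g [ n ]⇓ u → o ⊢ f [ u ]⇓ v → o ⊢ compᶜ f g [ n ]⇓ v
  precᶜ   : ∀ {f g n v} → Rec o f g (π₁ n) (π₂ n) v → o ⊢ precᶜ f g [ n ]⇓ v
  minᶜ    : ∀ {f n v} (w : ℕ → ℕ) → (∀ m → m ℕ.< v → o ⊢ f [ ⟪ n , m ⟫ ]⇓ suc (w m)) →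
            o ⊢ f [ ⟪ n , v ⟫ ]⇓ 0 → o ⊢ minᶜ f [ n ]⇓ v

⇓-cong : ∀ {o o′ f n v} → o ≗ o′ → o ⊢ f [ n ]⇓ v → o′ ⊢ f [ n ]⇓ v
Rec-cong : ∀ {o o′ f g a n v} → o ≗ o′ → Rec o f g a n v → Rec o′ f g a n v
⇓-cong e zeroᶜ        = zeroᶜ
⇓-cong e succᶜ        = succᶜ
⇓-cong e fstᶜ         = fstᶜ
⇓-cong e sndᶜ         = sndᶜ
⇓-cong {o′ = o′} e (oracleᶜ {n}) = subst (o′ ⊢ oracleᶜ [ n ]⇓_) (sym (e n)) oracleᶜ
⇓-cong e (pairᶜ x y)  = pairᶜ (⇓-cong e x) (⇓-cong e y)
⇓-cong e (compᶜ x y)  = compᶜ (⇓-cong e x) (⇓-cong e y)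
⇓-cong e (precᶜ x)    = precᶜ (Rec-cong e x)
⇓-cong e (minᶜ w b x) = minᶜ w (λ m lt → ⇓-cong e (b m lt)) (⇓-cong e x)
Rec-cong e (base x)   = base (⇓-cong e x)
Rec-cong e (step x y) = step (Rec-cong e x) (⇓-cong e y)

⇓-functional : ∀ {o f n u v} → o ⊢ f [ n ]⇓ u → o ⊢ f [ n ]⇓ v → u ≡ v
Rec-functional : ∀ {o f g a n u v} → Rec o f g a n u → Rec o f g a n v → u ≡ v
⇓-functional zeroᶜ       zeroᶜ         = refl
⇓-functional succᶜ       succᶜ         = refl
⇓-functional fstᶜ        fstᶜ          = refl
⇓-functional sndᶜ        sndᶜ          = refl
⇓-functional oracleᶜ     oracleᶜ       = refl
⇓-functional (pairᶜ x y) (pairᶜ x′ y′) = cong₂ ⟪_,_⟫ (⇓-functional x x′) (⇓-functional y y′)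
⇓-functional (compᶜ x y) (compᶜ x′ y′) with refl ← ⇓-functional x x′ = ⇓-functional y y′
⇓-functional (precᶜ x)   (precᶜ x′)    = Rec-functional x x′
⇓-functional {u = u} {v} (minᶜ w b x) (minᶜ w′ b′ x′) with ℕ.<-cmp u v
... | tri≈ _ u≡v _ = u≡v
... | tri< u<v _ _ with () ← ⇓-functional x (b′ u u<v)
... | tri> _ _ v<u with () ← ⇓-functional (b v v<u) x′
Rec-functional (base x)   (base x′)    = ⇓-functional x x′
Rec-functional (step x y) (step x′ y′) with refl ← Rec-functional x x′ = ⇓-functional y y′

⌜_⌝ : Code → ℕ
⌜ zeroᶜ ⌝     = ⟪ 0 , 0 ⟫
⌜ succᶜ ⌝     = ⟪ 1 , 0 ⟫
⌜ fstᶜ ⌝      = ⟪ 2 , 0 ⟫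
⌜ sndᶜ ⌝      = ⟪ 3 , 0 ⟫
⌜ oracleᶜ ⌝   = ⟪ 4 , 0 ⟫
⌜ pairᶜ f g ⌝ = ⟪ 5 , ⟪ ⌜ f ⌝ , ⌜ g ⌝ ⟫ ⟫
⌜ compᶜ f g ⌝ = ⟪ 6 , ⟪ ⌜ f ⌝ , ⌜ g ⌝ ⟫ ⟫
⌜ precᶜ f g ⌝ = ⟪ 7 , ⟪ ⌜ f ⌝ , ⌜ g ⌝ ⟫ ⟫
⌜ minᶜ f ⌝    = ⟪ 8 , ⌜ f ⌝ ⟫

node : (tag : ℕ) (arg left right : Code) → Code
node 1 h f g = succᶜ
node 2 h f g = fstᶜ
node 3 h f g = sndᶜ
node 4 h f g = oracleᶜ
node 5 h f g = pairᶜ f g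
node 6 h f g = compᶜ f g
node 7 h f g = precᶜ f g
node 8 h f g = minᶜ h
node _ h f g = zeroᶜ

-- The first argument bounds the recursion depth.
decode : ℕ → ℕ → Code
decode zero    n = zeroᶜ
decode (suc k) n =
  node (π₁ n) (decode k (π₂ n)) (decode k (π₁ (π₂ n))) (decode k (π₂ (π₂ n)))

-- The n-th oracle machine.  Depth n suffices, as ⟪ suc t , x ⟫ exceeds x.
machine : ℕ → Code
machine n = decode n n

decode-pair : ∀ k t x → decode (suc k) ⟪ t , x ⟫ ≡
              node t (decode k x) (decode k (π₁ x)) (decode k (π₂ x))
decode-pair k t x rewrite unpair-pair t x = refl

pair≰0 : ∀ t x → ¬ ⟪ suc t , x ⟫ ℕ.≤ 0
pair≰0 t x le with () ← ℕ.≤-trans (n<pair t x) le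

decode-⌜⌝ : ∀ k c → ⌜ c ⌝ ℕ.≤ k → decode k ⌜ c ⌝ ≡ c

decode-binary : ∀ k t f g → ⟪ suc t , ⟪ ⌜ f ⌝ , ⌜ g ⌝ ⟫ ⟫ ℕ.≤ k →
  decode k ⟪ suc t , ⟪ ⌜ f ⌝ , ⌜ g ⌝ ⟫ ⟫ ≡
  node (suc t) (decode (ℕ.pred k) ⟪ ⌜ f ⌝ , ⌜ g ⌝ ⟫) f g
decode-binary zero    t f g le = ⊥-elim (pair≰0 t _ le)
decode-binary (suc k) t f g le = begin
  decode (suc k) ⟪ suc t , fg ⟫
    ≡⟨ decode-pair k (suc t) fg ⟩
  node (suc t) h (decode k (π₁ fg)) (decode k (π₂ fg))
    ≡⟨ cong₂ (λ x y → node (suc t) h (decode k x) (decode k y)) (π₁-pair ⌜ f ⌝ _) (π₂-pair _ ⌜ g ⌝) ⟩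
  node (suc t) h (decode k ⌜ f ⌝) (decode k ⌜ g ⌝)
    ≡⟨ cong₂ (node (suc t) h) (decode-⌜⌝ k f (ℕ.≤-trans (m≤pair _ _) fg≤k))
                              (decode-⌜⌝ k g (ℕ.≤-trans (n≤pair _ _) fg≤k)) ⟩
  node (suc t) h f g ∎
  where
  open ≡-Reasoning
  fg = ⟪ ⌜ f ⌝ , ⌜ g ⌝ ⟫
  h = decode k fg
  fg≤k = ℕ.s≤s⁻¹ (ℕ.≤-trans (n<pair t fg) le)

decode-⌜⌝ zero    zeroᶜ       le = refl
decode-⌜⌝ (suc k) zeroᶜ       le = decode-pair k 0 0
decode-⌜⌝ zero    succᶜ       le = ⊥-elim (pair≰0 _ _ le)
decode-⌜⌝ (suc k) succᶜ       le = decode-pair k 1 0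
decode-⌜⌝ zero    fstᶜ        le = ⊥-elim (pair≰0 _ _ le)
decode-⌜⌝ (suc k) fstᶜ        le = decode-pair k 2 0
decode-⌜⌝ zero    sndᶜ        le = ⊥-elim (pair≰0 _ _ le)
decode-⌜⌝ (suc k) sndᶜ        le = decode-pair k 3 0
decode-⌜⌝ zero    oracleᶜ     le = ⊥-elim (pair≰0 _ _ le)
decode-⌜⌝ (suc k) oracleᶜ     le = decode-pair k 4 0
decode-⌜⌝ k       (pairᶜ f g) le = decode-binary k 4 f g le
decode-⌜⌝ k       (compᶜ f g) le = decode-binary k 5 f g le
decode-⌜⌝ k       (precᶜ f g) le = decode-binary k 6 f g le
decode-⌜⌝ zero    (minᶜ f)    le = ⊥-elim (pair≰0 _ _ le)
decode-⌜⌝ (suc k) (minᶜ f)    le = trans (decode-pair k 8 ⌜ f ⌝)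
  (cong minᶜ (decode-⌜⌝ k f (ℕ.s≤s⁻¹ (ℕ.≤-trans (n<pair 7 ⌜ f ⌝) le))))

machine-⌜⌝ : ∀ c → machine ⌜ c ⌝ ≡ c
machine-⌜⌝ c = decode-⌜⌝ ⌜ c ⌝ c ℕ.≤-refl

Computable : PartialFunction → Set
Computable F = ∃[ c ] (∀ p (d : p ∈ dom F) k → p ⊢ c [ k ]⇓ apply F p d k)

-- Machine n with oracle q computes F; it accesses q and the input p through ⟨ q , p ⟩.
ComputesWithOracle : ℕ → Baire → PartialFunction → Set
ComputesWithOracle n q F =
  ∀ p (d : p ∈ dom F) k → ⟨ q , p ⟩ ⊢ machine n [ k ]⇓ apply F p d k

computes-⌜⌝ : ∀ c {q} F → (∀ p (d : p ∈ dom F) k → ⟨ q , p ⟩ ⊢ c [ k ]⇓ apply F p d k) →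
              ComputesWithOracle ⌜ c ⌝ q F
computes-⌜⌝ c {q} F t p d k =
  subst (⟨ q , p ⟩ ⊢_[ k ]⇓ apply F p d k) (sym (machine-⌜⌝ c)) (t p d k)

RecursivelyEnumerable : (ℕ → ℕ → ℕ → ℕ → Set) → Set
RecursivelyEnumerable A = ∃[ c ] (∀ t u v w →
  A t u v w ⇔ (∃[ y ] const 0 ⊢ c [ ⟪ t , ⟪ u , ⟪ v , w ⟫ ⟫ ⟫ ]⇓ y))

-- A continuous partial function is computed relative to an oracle tabulating which finite prefixes of
-- the input determine which values of the output; Table below carries this out with the programs here.

Total : Baire → Code → (ℕ → ℕ) → Set
Total o c φ = ∀ n → o ⊢ c [ n ]⇓ φ n

Total-≗ : ∀ {o c φ ψ} → φ ≗ ψ → Total o c φ → Total o c ψ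
Total-≗ {o} {c} e t n = subst (o ⊢ c [ n ]⇓_) (e n) (t n)

idᶜ : Code
idᶜ = pairᶜ fstᶜ sndᶜ

idᵗ : ∀ {o} → Total o idᶜ id
idᵗ = Total-≗ pair-unpair λ n → pairᶜ fstᶜ sndᶜ

iterᶜ : Code → Code → Code
iterᶜ f g = compᶜ (precᶜ f g) (pairᶜ zeroᶜ idᶜ)

iterᵗ : ∀ {o f g z s φ} → o ⊢ f [ 0 ]⇓ z → Total o g s →
        φ 0 ≡ z → (∀ n → φ (suc n) ≡ s ⟪ 0 , ⟪ n , φ n ⟫ ⟫) → Total o (iterᶜ f g) φ
iterᵗ {o} {f} {g} {z} {s} {φ} tf tg e₀ e₁ n = compᶜ (pairᶜ zeroᶜ (idᵗ n)) (precᶜ rec)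
  where
  go : ∀ n → Rec o f g 0 n (φ n)
  go zero    = base (subst (o ⊢ f [ 0 ]⇓_) (sym e₀) tf)
  go (suc n) = step (go n) (subst (o ⊢ g [ _ ]⇓_) (sym (e₁ n)) (tg _))
  rec : Rec o f g (π₁ ⟪ 0 , n ⟫) (π₂ ⟪ 0 , n ⟫) (φ n)
  rec rewrite unpair-pair 0 n = go n

counter previous : Code
counter  = compᶜ fstᶜ sndᶜ
previous = compᶜ sndᶜ sndᶜ

π₂₁ : ∀ a n u → π₁ (π₂ ⟪ a , ⟪ n , u ⟫ ⟫) ≡ n
π₂₁ a n u = trans (cong π₁ (π₂-pair a _)) (π₁-pair n u)

π₂₂ : ∀ a n u → π₂ (π₂ ⟪ a , ⟪ n , u ⟫ ⟫) ≡ u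
π₂₂ a n u = trans (cong π₂ (π₂-pair a _)) (π₂-pair n u)

doubleᶜ : Code
doubleᶜ = iterᶜ zeroᶜ (compᶜ succᶜ (compᶜ succᶜ previous))

doubleᵗ : ∀ {o} → Total o doubleᶜ double
doubleᵗ = iterᵗ zeroᶜ (λ n → compᶜ (compᶜ (compᶜ sndᶜ sndᶜ) succᶜ) succᶜ) refl
  (λ n → cong (suc ∘ suc) (sym (π₂₂ 0 n _)))

vanishes : ℕ → ℕ
vanishes zero    = 1
vanishes (suc _) = 0

vanishesᶜ : Code
vanishesᶜ = iterᶜ (compᶜ succᶜ zeroᶜ) zeroᶜ

vanishesᵗ : ∀ {o} → Total o vanishesᶜ vanishes
vanishesᵗ = iterᵗ (compᶜ zeroᶜ succᶜ) (λ n → zeroᶜ) refl (λ n → refl)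

predᶜ : Code
predᶜ = iterᶜ zeroᶜ counter

predᵗ : ∀ {o} → Total o predᶜ ℕ.pred
predᵗ = iterᵗ zeroᶜ (λ n → compᶜ sndᶜ fstᶜ) refl (λ n → sym (π₂₁ 0 n _))

evenᶜ oddᶜ : Code
evenᶜ = compᶜ oracleᶜ doubleᶜ
oddᶜ  = compᶜ oracleᶜ (compᶜ succᶜ doubleᶜ)

evenᵗ : ∀ {q p} → Total ⟨ q , p ⟩ evenᶜ q
evenᵗ {q} {p} = Total-≗ (⟨⟩-even q p) λ n → compᶜ (doubleᵗ n) oracleᶜ

oddᵗ : ∀ {q p} → Total ⟨ q , p ⟩ oddᶜ p
oddᵗ {q} {p} = Total-≗ (⟨⟩-odd q p) λ n → compᶜ (compᶜ (doubleᵗ n) succᶜ) oracleᶜ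

prefixᶜ : Code
prefixᶜ = iterᶜ zeroᶜ (pairᶜ (compᶜ oddᶜ counter) previous)

prefixᵗ : ∀ {q p} → Total ⟨ q , p ⟩ prefixᶜ (λ m → Prefix m p)
prefixᵗ {q} {p} = iterᵗ zeroᶜ
  (λ n → pairᶜ (compᶜ (compᶜ sndᶜ fstᶜ) (oddᵗ _)) (compᶜ sndᶜ sndᶜ)) refl
  (λ n → cong₂ ⟪_,_⟫ (cong p (sym (π₂₁ 0 n _))) (sym (π₂₂ 0 n _)))

entryᶜ : Code
entryᶜ = compᶜ evenᶜ (pairᶜ fstᶜ (pairᶜ sndᶜ (compᶜ prefixᶜ sndᶜ)))

entry : Baire → Baire → ℕ → ℕ → ℕ
entry q p k m = q ⟪ k , ⟪ m , Prefix m p ⟫ ⟫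

entryᵗ : ∀ {q p} k m → ⟨ q , p ⟩ ⊢ entryᶜ [ ⟪ k , m ⟫ ]⇓ entry q p k m
entryᵗ {q} {p} k m = subst (⟨ q , p ⟩ ⊢ entryᶜ [ ⟪ k , m ⟫ ]⇓_)
  (cong₂ (entry q p) (π₁-pair k m) (π₂-pair k m))
  (compᶜ (pairᶜ fstᶜ (pairᶜ sndᶜ (compᶜ sndᶜ (prefixᵗ _)))) (evenᵗ _))

lookupᶜ : Code
lookupᶜ = compᶜ predᶜ (compᶜ entryᶜ (pairᶜ idᶜ (minᶜ (compᶜ vanishesᶜ entryᶜ))))

leastNonzero : (φ : ℕ → ℕ) → ∀ n → φ n ≢ 0 → ∃[ m ] φ m ≢ 0 × (∀ i → i ℕ.< m → φ i ≡ 0)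
leastNonzero φ zero φn≢0 = 0 , φn≢0 , λ i ()
leastNonzero φ (suc n) φn≢0 with φ 0 ℕ.≟ 0
... | no φ0≢0 = 0 , φ0≢0 , λ i ()
... | yes φ0≡0 with leastNonzero (φ ∘ suc) n φn≢0
...   | m , φm≢0 , below = suc m , φm≢0 , λ where
          zero    _         → φ0≡0
          (suc i) (s≤s i<m) → below i i<m

lookup⇓ : ∀ {q p} k v → (∃[ m ] entry q p k m ≢ 0) →
          (∀ m → entry q p k m ≢ 0 → entry q p k m ≡ suc v) → ⟨ q , p ⟩ ⊢ lookupᶜ [ k ]⇓ v
lookup⇓ {q} {p} k v (n , ≢0) only with leastNonzero (entry q p k) n ≢0
... | m , e≢0 , below = subst (⟨ q , p ⟩ ⊢ lookupᶜ [ k ]⇓_) (cong ℕ.pred (only m e≢0))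
  (compᶜ (compᶜ (pairᶜ (idᵗ k) (minᶜ (λ _ → 0) before at)) (entryᵗ k m)) (predᵗ _))
  where
  o = ⟨ q , p ⟩
  test = compᶜ vanishesᶜ entryᶜ
  before : ∀ i → i ℕ.< m → o ⊢ test [ ⟪ k , i ⟫ ]⇓ 1
  before i i<m = subst (o ⊢ test [ _ ]⇓_) (cong vanishes (below i i<m))
    (compᶜ (entryᵗ k i) (vanishesᵗ _))
  at : o ⊢ test [ ⟪ k , m ⟫ ]⇓ 0
  at = subst (o ⊢ test [ _ ]⇓_) (cong vanishes (only m e≢0)) (compᶜ (entryᵗ k m) (vanishesᵗ _))

module Table (lem : ExcludedMiddle 0ℓ) (F : PartialFunction) (cont : ContinuousPartial F) where
  private
    Determined : ℕ → ℕ → ℕ → Set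
    Determined k m s = ∃[ p ] Σ[ d ∈ p ∈ dom F ] Prefix m p ≡ s ×
      (∀ q (e : q ∈ dom F) → Prefix m q ≡ s → apply F q e k ≡ apply F p d k)

    value : ∀ k m s → Dec (Determined k m s) → ℕ
    value k m s (yes (p , d , _)) = suc (apply F p d k)
    value k m s (no _)            = 0

    value-≢0 : ∀ k m p (D : Dec (Determined k m (Prefix m p))) (d : p ∈ dom F) →
               value k m _ D ≢ 0 → value k m _ D ≡ suc (apply F p d k)
    value-≢0 k m p (yes (_ , _ , _ , h)) d _  = cong suc (sym (h _ d refl))
    value-≢0 k m p (no _)                d ≢0 = ⊥-elim (≢0 refl)

    value-yes : ∀ k m s (D : Dec (Determined k m s)) → Determined k m s → value k m s D ≢ 0
    value-yes k m s (yes _)  _ ()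
    value-yes k m s (no ¬D)  D _ = ¬D D

    tableAt : ℕ × ℕ → ℕ → ℕ
    tableAt (k , m) s = value k m s lem

  table : Baire
  table n = tableAt (π₁ n , π₁ (π₂ n)) (π₂ (π₂ n))

  private
    table-pair : ∀ k m s → table ⟪ k , ⟪ m , s ⟫ ⟫ ≡ tableAt (k , m) s
    table-pair k m s = cong₂ tableAt
      (cong₂ _,_ (π₁-pair k ⟪ m , s ⟫) (π₂₁ k m s)) (π₂₂ k m s)

    defined : ∀ p (d : p ∈ dom F) k → ∃[ m ] entry table p k m ≢ 0
    defined p d k with cont p d (suc k)
    ... | m , h = m , λ eq → value-yes k m (Prefix m p) lem (p , d , refl , same)
                        (trans (sym (table-pair k m (Prefix m p))) eq)
      where
      same : ∀ q (e : q ∈ dom F) → Prefix m q ≡ Prefix m p → apply F q e k ≡ apply F p d k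
      same q e eq = sym (h q e (Prefix-agree m (sym eq)) k ℕ.≤-refl)

    correct : ∀ p (d : p ∈ dom F) k m → entry table p k m ≢ 0 → entry table p k m ≡ suc (apply F p d k)
    correct p d k m ≢0 = trans eq (value-≢0 k m p lem d (≢0 ∘ trans eq))
      where eq = table-pair k m (Prefix m p)

  computable : ∃₂ λ n q → ComputesWithOracle n q F
  computable = ⌜ lookupᶜ ⌝ , table ,
    computes-⌜⌝ lookupᶜ F λ p d k → lookup⇓ k _ (defined p d k) (correct p d k)

-- A real is a nonempty, bounded, downward closed set of rationals without greatest element.  This is
-- a real number only classically (locatedness is not required).

record ℝ : Set₁ where
  field
    cut       : Pred ℚ 0ℓ
    inhabited : ∃[ q ] q ∈ cut
    bounded   : ∃[ q ] ¬ q ∈ cut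
    lower     : ∀ {q r} → q ℚ.≤ r → r ∈ cut → q ∈ cut
    rounded   : ∀ {q} → q ∈ cut → ∃[ r ] q ℚ.< r × r ∈ cut

open ℝ

infix 4 _≤ℝ_ _<ℝ_ _≈ℝ_
infixl 6 _+ℝ_

_≤ℝ_ _<ℝ_ _≈ℝ_ : ℝ → ℝ → Set
x ≤ℝ y = cut x ⊆ cut y
x <ℝ y = ∃[ q ] q ∈ cut y × ¬ q ∈ cut x
x ≈ℝ y = x ≤ℝ y × y ≤ℝ x

private
  q<q+1 : ∀ q → q ℚ.< q ℚ.+ 1ℚ
  q<q+1 q = subst (ℚ._< q ℚ.+ 1ℚ) (ℚ.+-identityʳ q) (ℚ.+-monoʳ-< q (ℚ.positive⁻¹ 1ℚ))

  q-1<q : ∀ q → q ℚ.- 1ℚ ℚ.< q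
  q-1<q q = subst (q ℚ.- 1ℚ ℚ.<_) (ℚ.+-identityʳ q) (ℚ.+-monoʳ-< q (ℚ.negative⁻¹ (ℚ.- 1ℚ)))

  cut-< : ∀ x {q r} → q ∈ cut x → ¬ r ∈ cut x → q ℚ.< r
  cut-< x q∈x r∉x = ℚ.≰⇒> λ r≤q → r∉x (lower x r≤q q∈x)

fromℚ : ℚ → ℝ
fromℚ q = record
  { cut       = ℚ._< q
  ; inhabited = q ℚ.- 1ℚ , q-1<q q
  ; bounded   = q , ℚ.<-irrefl refl
  ; lower     = ℚ.≤-<-trans
  ; rounded   = λ r<q → let s , r<s , s<q = ℚ.<-dense r<q in s , r<s , s<q
  }

0ℝ : ℝ
0ℝ = fromℚ 0ℚ

sum∉ : ∀ x y {q r} → ¬ q ∈ cut x → ¬ r ∈ cut y →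
       ¬ (∃₂ λ s t → s ∈ cut x × t ∈ cut y × q ℚ.+ r ℚ.≤ s ℚ.+ t)
sum∉ x y q∉x r∉y (s , t , s∈x , t∈y , le) =
  ℚ.<-irrefl refl (ℚ.<-≤-trans (ℚ.+-mono-< (cut-< x s∈x q∉x) (cut-< y t∈y r∉y)) le)

_+ℝ_ : ℝ → ℝ → ℝ
x +ℝ y = record
  { cut       = λ q → ∃₂ λ s t → s ∈ cut x × t ∈ cut y × q ℚ.≤ s ℚ.+ t
  ; inhabited = let s , s∈x = inhabited x ; t , t∈y = inhabited y in
                s ℚ.+ t , s , t , s∈x , t∈y , ℚ.≤-refl
  ; bounded   = let q , q∉x = bounded x ; r , r∉y = bounded y in q ℚ.+ r , sum∉ x y q∉x r∉y
  ; lower     = λ q≤r (s , t , s∈x , t∈y , r≤s+t) → s , t , s∈x , t∈y , ℚ.≤-trans q≤r r≤s+t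
  ; rounded   = λ (s , t , s∈x , t∈y , q≤s+t) → let s′ , s<s′ , s′∈x = rounded x s∈x in
                s′ ℚ.+ t , ℚ.≤-<-trans q≤s+t (ℚ.+-monoˡ-< t s<s′) , s′ , t , s′∈x , t∈y , ℚ.≤-refl
  }

ℝ-setoid : Setoid (lsuc 0ℓ) 0ℓ
ℝ-setoid = record
  { Carrier       = ℝ
  ; _≈_           = _≈ℝ_
  ; isEquivalence = record
    { refl  = id , id
    ; sym   = λ (f , g) → g , f
    ; trans = λ (f , g) (h , k) → h ∘ f , g ∘ k
    }
  }

partialSum : (ℕ → ℝ) → ℕ → ℝ
partialSum s zero    = 0ℝ
partialSum s (suc n) = partialSum s n +ℝ s n

IsSupremum : (ℕ → ℝ) → ℝ → Set₁
IsSupremum s x = (∀ n → s n ≤ℝ x) × (∀ y → (∀ n → s n ≤ℝ y) → x ≤ℝ y)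

-- For non-negative s.
SumsTo : (ℕ → ℝ) → ℝ → Set₁
SumsTo s x = IsSupremum (partialSum s) x

<ℝ-≤ℝ-resp : ∀ {x y z w} → x ≤ℝ y → y <ℝ z → z ≤ℝ w → x <ℝ w
<ℝ-≤ℝ-resp x≤y (q , q∈z , q∉y) z≤w = q , z≤w q∈z , q∉y ∘ x≤y

+ℝ-<-fromℚ : ∀ {x y z a b} → z ≤ℝ x +ℝ y → x <ℝ fromℚ a → y <ℝ fromℚ b → z <ℝ fromℚ (a ℚ.+ b)
+ℝ-<-fromℚ {x} {y} z≤ (q , q<a , q∉x) (r , r<b , r∉y) =
  q ℚ.+ r , ℚ.+-mono-< q<a r<b , sum∉ x y q∉x r∉y ∘ z≤

<ℝ-fromℚ⇒≤ℝ : ∀ {x a} → x <ℝ fromℚ a → x ≤ℝ fromℚ a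
<ℝ-fromℚ⇒≤ℝ {x} (q , q<a , q∉x) r∈x = ℚ.<-trans (cut-< x r∈x q∉x) q<a

fromℚ-mono : ∀ {a b} → a ℚ.≤ b → fromℚ a ≤ℝ fromℚ b
fromℚ-mono a≤b q<a = ℚ.<-≤-trans q<a a≤b

≤ℝ-0 : ∀ {x} → (∀ ε → 0ℚ ℚ.< ε → x <ℝ fromℚ ε) → x ≤ℝ 0ℝ
≤ℝ-0 {x} small {q} q∈x with q ℚ.<? 0ℚ
... | yes q<0 = q<0
... | no q≮0 with rounded x q∈x
...   | r , q<r , r∈x = ⊥-elim (ℚ.<-irrefl refl
          (<ℝ-fromℚ⇒≤ℝ {x} (small r (ℚ.≤-<-trans (ℚ.≮⇒≥ q≮0) q<r)) r∈x))

2⁻_ : ℕ → ℚ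
2⁻ zero  = 1ℚ
2⁻ suc n = ½ ℚ.* 2⁻ n

2⁻-positive : ∀ n → ℚ.Positive (2⁻ n)
2⁻-positive zero    = _
2⁻-positive (suc n) = ℚ.pos*pos⇒pos ½ (2⁻ n) {{2⁻-positive n}}

2⁻-halves : ∀ n → 2⁻ suc n ℚ.+ 2⁻ suc n ≡ 2⁻ n
2⁻-halves n = trans (sym (ℚ.*-distribʳ-+ (2⁻ n) ½ ½)) (ℚ.*-identityˡ (2⁻ n))

2⁻-suc< : ∀ n → 2⁻ suc n ℚ.< 2⁻ n
2⁻-suc< n = subst (2⁻ suc n ℚ.<_) (2⁻-halves n)
  (subst (ℚ._< 2⁻ suc n ℚ.+ 2⁻ suc n) (ℚ.+-identityʳ _)
    (ℚ.+-monoʳ-< (2⁻ suc n) (ℚ.positive⁻¹ (2⁻ suc n) {{2⁻-positive (suc n)}})))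

2⁻-antimono : ∀ {m n} → m ℕ.≤ n → 2⁻ n ℚ.≤ 2⁻ m
2⁻-antimono m≤n = go (ℕ.≤⇒≤′ m≤n)
  where
  go : ∀ {m n} → m ℕ.≤′ n → 2⁻ n ℚ.≤ 2⁻ m
  go ℕ.≤′-refl         = ℚ.≤-refl
  go (ℕ.≤′-step {n} p) = ℚ.≤-trans (ℚ.<⇒≤ (2⁻-suc< n)) (go p)

2⁻-archimedean : ∀ ε → 0ℚ ℚ.< ε → ∃[ n ] 2⁻ n ℚ.< ε
2⁻-archimedean ε@(mkℚ (+ suc a) b _) _ =
  suc b , ℚ.<-≤-trans (2⁻-suc< b) (ℚ.≤-trans (2⁻≤ b) unit≤)
  where
  unit : ℕ → ℚ
  unit n = ℚ.fromℚᵘ (ℚᵘ.mkℚᵘ (+ 1) n)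

  half : ∀ n → ½ ℚ.* unit n ℚ.≤ unit (suc n)
  half n = ℚ.toℚᵘ-cancel-≤ (begin
    ℚ.toℚᵘ (½ ℚ.* unit n)                   ≃⟨ ℚ.toℚᵘ-homo-* ½ (unit n) ⟩
    ℚᵘ.½ ℚᵘ.* ℚ.toℚᵘ (unit n)               ≃⟨ ℚᵘ.*-congˡ {ℚᵘ.½} (ℚ.toℚᵘ-fromℚᵘ (ℚᵘ.mkℚᵘ (+ 1) n)) ⟩
    ℚᵘ.½ ℚᵘ.* ℚᵘ.mkℚᵘ (+ 1) n               ≤⟨ ℚᵘ.*≤* (ℤ.+≤+ bound) ⟩
    ℚᵘ.mkℚᵘ (+ 1) (suc n)                   ≃⟨ ℚᵘ.≃-sym (ℚ.toℚᵘ-fromℚᵘ _) ⟩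
    ℚ.toℚᵘ (unit (suc n))                   ∎)
    where
    open ℚᵘ.≤-Reasoning
    bound : 1 ℕ.* suc (suc n) ℕ.≤ 1 ℕ.* (2 ℕ.* suc n)
    bound = ℕ.*-monoʳ-≤ 1 (s≤s (ℕ.≤-trans (ℕ.m≤m+n (suc n) 0) (ℕ.m≤n+m _ n)))

  2⁻≤ : ∀ n → 2⁻ n ℚ.≤ unit n
  2⁻≤ zero    = ℚ.≤-refl
  2⁻≤ (suc n) = ℚ.≤-trans (ℚ.*-monoˡ-≤-nonNeg ½ (2⁻≤ n)) (half n)

  unit≤ : unit b ℚ.≤ ε
  unit≤ = ℚ.toℚᵘ-cancel-≤ (begin
    ℚ.toℚᵘ (unit b)                         ≃⟨ ℚ.toℚᵘ-fromℚᵘ _ ⟩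
    ℚᵘ.mkℚᵘ (+ 1) b                         ≤⟨ ℚᵘ.*≤* (ℤ.+≤+ (ℕ.*-monoˡ-≤ (suc b) {1} {suc a} (s≤s z≤n))) ⟩
    ℚ.toℚᵘ ε                                ∎)
    where open ℚᵘ.≤-Reasoning
2⁻-archimedean (mkℚ (+ zero) b _) (*<* (ℤ.+<+ ()))
2⁻-archimedean (mkℚ -[1+ a ] b _) (*<* ())

-- The standard numbering of ℚ: ⟪ a , ⟪ b , k ⟫ ⟫ stands for (a - b) / (k + 1).
νℚ : ℕ → ℚ
νℚ n = (π₁ n ℤ.⊖ π₁ (π₂ n)) ℚ./ suc (π₂ (π₂ n))

νℚ-surjective : ∀ q → ∃[ n ] νℚ n ≡ q
νℚ-surjective q@(mkℚ z k _) = index z , trans (eq z) (ℚ.↥p/↧p≡p q)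
  where
  index : ℤ.ℤ → ℕ
  index (+ a)    = ⟪ a , ⟪ 0 , k ⟫ ⟫
  index -[1+ a ] = ⟪ 0 , ⟪ suc a , k ⟫ ⟫

  value : ∀ a b → νℚ ⟪ a , ⟪ b , k ⟫ ⟫ ≡ (a ℤ.⊖ b) ℚ./ suc k
  value a b = trans
    (cong₂ (λ a y → (a ℤ.⊖ π₁ y) ℚ./ suc (π₂ y)) (π₁-pair a _) (π₂-pair a _))
    (cong₂ (λ b k → (a ℤ.⊖ b) ℚ./ suc k) (π₁-pair b k) (π₂-pair b k))

  eq : ∀ z → νℚ (index z) ≡ z ℚ./ suc k
  eq (+ a)    = value a 0
  eq -[1+ a ] = value 0 (suc a)

record RepresentedSpace c ℓ r : Set (lsuc (c ⊔ ℓ ⊔ r)) where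
  infix 4 _⊩_
  field
    setoid : Setoid c ℓ
  open Setoid setoid public using (Carrier; _≈_)
  field
    _⊩_           : Baire → Carrier → Set r
    ⊩-resp        : ∀ {p q x y} → p ≗ q → x ≈ y → p ⊩ x → q ⊩ y
    single-valued : ∀ {p x y} → p ⊩ x → p ⊩ y → x ≈ y
    surjective    : ∀ x → ∃[ p ] p ⊩ x

open RepresentedSpace using () renaming (Carrier to ∣_∣)

-- Partial multivalued functions; x is in the domain iff some y is related to it.
record Multifunction (X : RepresentedSpace c ℓ r) (Y : RepresentedSpace c′ ℓ′ r′) γ :
                     Set (c ⊔ ℓ ⊔ c′ ⊔ ℓ′ ⊔ lsuc γ) where
  private
    module X = RepresentedSpace X
    module Y = RepresentedSpace Y
  field
    graph : X.Carrier → Y.Carrier → Set γ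
    resp  : ∀ {x x′ y y′} → x X.≈ x′ → y Y.≈ y′ → graph x y → graph x′ y′

  domain : Pred X.Carrier (c′ ⊔ γ)
  domain x = ∃[ y ] graph x y

module _ {X : RepresentedSpace c ℓ r} {Y : RepresentedSpace c′ ℓ′ r′} where
  private
    module X = RepresentedSpace X
    module Y = RepresentedSpace Y

  infix 4 _Realizes_

  _Realizes_ : PartialFunction → Multifunction X Y γ → Set _
  F Realizes f = ∀ p x → p X.⊩ x → x ∈ domain →
    Σ[ d ∈ p ∈ dom F ] ∃[ y ] apply F p d Y.⊩ y × graph x y
    where open Multifunction f

  ⌊_⌋ : Func X.setoid Y.setoid → Multifunction X Y ℓ′
  ⌊ f ⌋ = record
    { graph = λ x y → f.to x Y.≈ y
    ; resp  = λ x≈x′ y≈y′ fx≈y → S.trans (S.sym (f.cong x≈x′)) (S.trans fx≈y y≈y′)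
    }
    where
    module f = Func f
    module S = Setoid Y.setoid

  Continuous : Func X.setoid Y.setoid → Set _
  Continuous f = ∃[ F ] ContinuousPartial F × F Realizes ⌊ f ⌋

infix 4 _≤W_ _≡W_

_≤W_ : {X : RepresentedSpace c ℓ r} {Y : RepresentedSpace c′ ℓ′ r′}
       {Z : RepresentedSpace c″ ℓ″ r″} {W : RepresentedSpace c‴ ℓ‴ r‴} →
       Multifunction X Y γ → Multifunction Z W γ′ → Set _
f ≤W g = ∃₂ λ K H → Computable K × Computable H ×
  (∀ G → G Realizes g → (K ∘ᵖ ⟨id, G ∘ᵖ H ⟩) Realizes f)

_≡W_ : {X : RepresentedSpace c ℓ r} {Y : RepresentedSpace c′ ℓ′ r′}
       {Z : RepresentedSpace c″ ℓ″ r″} {W : RepresentedSpace c‴ ℓ‴ r‴} →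
       Multifunction X Y γ → Multifunction Z W γ′ → Set _
f ≡W g = f ≤W g × g ≤W f

Subspace : (X : RepresentedSpace c ℓ r) → Pred ∣ X ∣ γ → RepresentedSpace (c ⊔ γ) ℓ r
Subspace X P = record
  { setoid        = record
    { Carrier       = Σ Carrier P
    ; _≈_           = λ x y → proj₁ x ≈ proj₁ y
    ; isEquivalence = record { refl = S.refl ; sym = S.sym ; trans = S.trans }
    }
  ; _⊩_           = λ p x → p ⊩ proj₁ x
  ; ⊩-resp        = ⊩-resp
  ; single-valued = single-valued
  ; surjective    = surjective ∘ proj₁
  }
  where
  open RepresentedSpace X
  module S = Setoid setoid

data _⊩𝕊_ (p : Baire) : Bool → Set where
  ⊩⊥ : p ≗ const 0 → p ⊩𝕊 false
  ⊩⊤ : ¬ p ≗ const 0 → p ⊩𝕊 true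

-- Sierpiński space, with false for ⊥ and true for ⊤.
𝕊 : RepresentedSpace 0ℓ 0ℓ 0ℓ
𝕊 = record
  { setoid        = ≡-setoid Bool
  ; _⊩_           = _⊩𝕊_
  ; ⊩-resp        = resp
  ; single-valued = single
  ; surjective    = λ where
      false → const 0 , ⊩⊥ (λ _ → refl)
      true  → const 1 , ⊩⊤ (λ e → ℕ.1+n≢0 (e 0))
  }
  where
  resp : ∀ {p q x y} → p ≗ q → x ≡ y → p ⊩𝕊 x → q ⊩𝕊 y
  resp e refl (⊩⊥ z) = ⊩⊥ λ n → trans (sym (e n)) (z n)
  resp e refl (⊩⊤ z) = ⊩⊤ λ q≗0 → z λ n → trans (e n) (q≗0 n)

  single : ∀ {p x y} → p ⊩𝕊 x → p ⊩𝕊 y → x ≡ y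
  single (⊩⊥ _) (⊩⊥ _) = refl
  single (⊩⊥ z) (⊩⊤ n) = ⊥-elim (n z)
  single (⊩⊤ n) (⊩⊥ z) = ⊥-elim (n z)
  single (⊩⊤ _) (⊩⊤ _) = refl

record ComputableMetricSpace c ℓ : Set (lsuc (c ⊔ ℓ ⊔ lsuc 0ℓ)) where
  field
    setoid : Setoid c ℓ
  open Setoid setoid public using (Carrier; _≈_)
  field
    d          : Carrier → Carrier → ℝ
    d-cong     : ∀ {x x′ y y′} → x ≈ x′ → y ≈ y′ → d x y ≈ℝ d x′ y′
    d-nonneg   : ∀ x y → 0ℝ ≤ℝ d x y
    d-zero     : ∀ {x y} → d x y ≈ℝ 0ℝ ⇔ x ≈ y
    d-sym      : ∀ x y → d x y ≈ℝ d y x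
    d-triangle : ∀ x y z → d x z ≤ℝ d x y +ℝ d y z

  _⟶_ : (ℕ → Carrier) → Carrier → Set
  s ⟶ x = ∀ ε → 0ℚ ℚ.< ε → ∃[ N ] (∀ n → N ℕ.≤ n → d (s n) x <ℝ fromℚ ε)

  Cauchy : (ℕ → Carrier) → Set
  Cauchy s = ∀ ε → 0ℚ ℚ.< ε →
    ∃[ N ] (∀ m n → N ℕ.≤ m → N ℕ.≤ n → d (s m) (s n) <ℝ fromℚ ε)

  Complete : Set c
  Complete = ∀ s → Cauchy s → ∃[ x ] s ⟶ x

  field
    a            : ℕ → Carrier
    a-dense      : ∀ x ε → 0ℚ ℚ.< ε → ∃[ n ] d x (a n) <ℝ fromℚ ε
    d-enumerable : RecursivelyEnumerable λ t u v w →
                   fromℚ (νℚ t) <ℝ d (a u) (a v) × d (a u) (a v) <ℝ fromℚ (νℚ w)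

  CauchyName : Baire → Carrier → Set
  CauchyName p x = (∀ i k → i ℕ.< k → d (a (p i)) (a (p k)) ≤ℝ fromℚ (2⁻ i)) × (a ∘ p) ⟶ x

module _ (M : ComputableMetricSpace c ℓ) where
  open ComputableMetricSpace M
  private
    module S = Setoid setoid

    limit-unique : ∀ {s x y} → s ⟶ x → s ⟶ y → x ≈ y
    limit-unique {s} {x} {y} s⟶x s⟶y = Equivalence.to d-zero (≤ℝ-0 {d x y} small , d-nonneg x y)
      where
      small : ∀ ε → 0ℚ ℚ.< ε → d x y <ℝ fromℚ ε
      small ε 0<ε = subst (λ e → d x y <ℝ fromℚ e) half+half
        (+ℝ-<-fromℚ {d x sn} {d sn y} {d x y} (d-triangle x sn y)
          (<ℝ-≤ℝ-resp {d x sn} {d sn x} {fromℚ ½ε} {fromℚ ½ε} (proj₁ (d-sym x sn)) (nx n (ℕ.m≤m+n Nx Ny)) id)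
          (ny n (ℕ.m≤n+m Ny Nx)))
        where
        ½ε = ½ ℚ.* ε
        half+half : ½ε ℚ.+ ½ε ≡ ε
        half+half = trans (sym (ℚ.*-distribʳ-+ ε ½ ½)) (ℚ.*-identityˡ ε)
        0<½ε : 0ℚ ℚ.< ½ε
        0<½ε = ℚ.positive⁻¹ ½ε {{ℚ.pos*pos⇒pos ½ ε {{ℚ.positive 0<ε}}}}
        Nx = proj₁ (s⟶x ½ε 0<½ε)
        nx = proj₂ (s⟶x ½ε 0<½ε)
        Ny = proj₁ (s⟶y ½ε 0<½ε)
        ny = proj₂ (s⟶y ½ε 0<½ε)
        n = Nx ℕ.+ Ny
        sn = s n

    ⟶-resp : ∀ {s t x y} → (∀ n → s n ≡ t n) → x ≈ y → s ⟶ x → t ⟶ y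
    ⟶-resp {s} {t} {x} {y} e x≈y l ε 0<ε with l ε 0<ε
    ... | N , h = N , λ n N≤n →
      <ℝ-≤ℝ-resp {d (t n) y} {d (s n) x} {fromℚ ε} {fromℚ ε}
        (proj₂ (d-cong (S.reflexive (e n)) x≈y)) (h n N≤n) id

    approximation : ∀ x → ∃[ p ] CauchyName p x
    approximation x = p , fast , converges
      where
      p : Baire
      p i = proj₁ (a-dense x (2⁻ suc i) (ℚ.positive⁻¹ _ {{2⁻-positive (suc i)}}))

      near : ∀ i → d x (a (p i)) <ℝ fromℚ (2⁻ suc i)
      near i = proj₂ (a-dense x (2⁻ suc i) (ℚ.positive⁻¹ _ {{2⁻-positive (suc i)}}))

      near′ : ∀ i → d (a (p i)) x <ℝ fromℚ (2⁻ suc i)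
      near′ i = <ℝ-≤ℝ-resp {d (a (p i)) x} {d x (a (p i))} {fromℚ (2⁻ suc i)} {fromℚ (2⁻ suc i)}
        (proj₁ (d-sym _ _)) (near i) id

      fast : ∀ i k → i ℕ.< k → d (a (p i)) (a (p k)) ≤ℝ fromℚ (2⁻ i)
      fast i k i<k = fromℚ-mono bound ∘ <ℝ-fromℚ⇒≤ℝ {d (a (p i)) (a (p k))}
        (+ℝ-<-fromℚ {d (a (p i)) x} {d x (a (p k))} {d (a (p i)) (a (p k))} (d-triangle _ x _) (near′ i) (near k))
        where
        bound : 2⁻ suc i ℚ.+ 2⁻ suc k ℚ.≤ 2⁻ i
        bound = subst (2⁻ suc i ℚ.+ 2⁻ suc k ℚ.≤_) (2⁻-halves i)
          (ℚ.+-monoʳ-≤ (2⁻ suc i) (2⁻-antimono (s≤s (ℕ.<⇒≤ i<k))))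

      converges : (a ∘ p) ⟶ x
      converges ε 0<ε with 2⁻-archimedean ε 0<ε
      ... | N , 2⁻N<ε = N , λ n N≤n →
        <ℝ-≤ℝ-resp {d (a (p n)) x} {d (a (p n)) x} {fromℚ (2⁻ suc n)} {fromℚ ε} id (near′ n)
          (fromℚ-mono (ℚ.≤-trans (2⁻-antimono (ℕ.m≤n⇒m≤1+n N≤n)) (ℚ.<⇒≤ 2⁻N<ε)))

  metricSpace : RepresentedSpace c ℓ 0ℓ
  metricSpace = record
    { setoid        = setoid
    ; _⊩_           = CauchyName
    ; ⊩-resp        = λ e x≈y (fast , l) →
        (λ i k i<k → fast i k i<k ∘
          proj₂ (d-cong (S.reflexive (cong a (e i))) (S.reflexive (cong a (e k))))) ,
        ⟶-resp (λ n → cong a (e n)) x≈y l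
    ; single-valued = λ (_ , l) (_ , l′) → limit-unique l l′
    ; surjective    = approximation
    }

record ComputablePolishSpace c ℓ : Set (lsuc (c ⊔ ℓ ⊔ lsuc 0ℓ)) where
  field
    metric   : ComputableMetricSpace c ℓ
    complete : ComputableMetricSpace.Complete metric

  space : RepresentedSpace c ℓ 0ℓ
  space = metricSpace metric

-- The ambient mathematics is classical.  In the constructions below excluded middle serves to make
-- the representations of ℝ< and of the function spaces surjective.

module Classical (lem : ∀ {ℓ} → ExcludedMiddle ℓ) where

  ℝ< : RepresentedSpace (lsuc 0ℓ) 0ℓ (lsuc 0ℓ)
  ℝ< = record
    { setoid        = ℝ-setoid
    ; _⊩_           = Names
    ; ⊩-resp        = λ {p} {q} {x} {y} e (x≤y , y≤x) (mono , upper , least) →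
        (λ {i} {j} i≤j → subst₂ (λ m n → νℚ m ℚ.≤ νℚ n) (e i) (e j) (mono i≤j)) ,
        (λ n → subst (λ m → fromℚ (νℚ m) ≤ℝ y) (e n) (x≤y ∘ upper n)) ,
        (λ z h → least z (λ n → subst (λ m → fromℚ (νℚ m) ≤ℝ z) (sym (e n)) (h n)) ∘ y≤x)
    ; single-valued = λ {_} {x} {y} (_ , upper , least) (_ , upper′ , least′) →
        least y upper′ , least′ x upper
    ; surjective    = name
    }
    where
    Names : Baire → ℝ → Set₁
    Names p x = (∀ {i j} → i ℕ.≤ j → νℚ (p i) ℚ.≤ νℚ (p j)) × IsSupremum (fromℚ ∘ νℚ ∘ p) x

    name : ∀ x → ∃[ p ] Names p x
    name x = proj₁ ∘ p , mono , upper , least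
      where
      improve : (n m : ℕ) → νℚ m ∈ cut x → Dec (νℚ n ∈ cut x × νℚ m ℚ.≤ νℚ n) → ∃[ k ] νℚ k ∈ cut x
      improve n m _  (yes (n∈ , _)) = n , n∈
      improve n m m∈ (no _)         = m , m∈

      p : ℕ → ∃[ k ] νℚ k ∈ cut x
      p zero    = let q , q∈x = inhabited x ; k , eq = νℚ-surjective q in
                  k , subst (_∈ cut x) (sym eq) q∈x
      p (suc n) = improve n (proj₁ (p n)) (proj₂ (p n)) lem

      grows : ∀ n m m∈ D → νℚ m ℚ.≤ νℚ (proj₁ (improve n m m∈ D))
      grows n m m∈ (yes (_ , m≤n)) = m≤n
      grows n m m∈ (no _)          = ℚ.≤-refl

      dominates : ∀ n m m∈ D → νℚ n ∈ cut x → νℚ n ℚ.≤ νℚ (proj₁ (improve n m m∈ D))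
      dominates n m m∈ (yes _) n∈ = ℚ.≤-refl
      dominates n m m∈ (no ¬h) n∈ with ℚ.≤-total (νℚ n) (νℚ m)
      ... | inj₁ n≤m = n≤m
      ... | inj₂ m≤n = ⊥-elim (¬h (n∈ , m≤n))

      mono : ∀ {i j} → i ℕ.≤ j → νℚ (proj₁ (p i)) ℚ.≤ νℚ (proj₁ (p j))
      mono i≤j = go (ℕ.≤⇒≤′ i≤j)
        where
        go : ∀ {i j} → i ℕ.≤′ j → νℚ (proj₁ (p i)) ℚ.≤ νℚ (proj₁ (p j))
        go ℕ.≤′-refl         = ℚ.≤-refl
        go (ℕ.≤′-step {j} q) = ℚ.≤-trans (go q) (grows j _ (proj₂ (p j)) lem)

      upper : ∀ n → fromℚ (νℚ (proj₁ (p n))) ≤ℝ x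
      upper n q<pn = lower x (ℚ.<⇒≤ q<pn) (proj₂ (p n))

      least : ∀ y → (∀ n → fromℚ (νℚ (proj₁ (p n))) ≤ℝ y) → x ≤ℝ y
      least y h q∈x with rounded x q∈x
      ... | r , q<r , r∈x with νℚ-surjective r
      ...   | n , refl = h (suc n) (ℚ.<-≤-trans q<r (dominates n _ (proj₂ (p n)) lem r∈x))

  module _ (X : RepresentedSpace c ℓ r) (Y : RepresentedSpace c′ ℓ′ r′) where
    private
      module X = RepresentedSpace X
      module Y = RepresentedSpace Y
      module YS = Setoid Y.setoid

    record ContinuousMap : Set (lsuc 0ℓ ⊔ c ⊔ ℓ ⊔ r ⊔ c′ ⊔ ℓ′ ⊔ r′) where
      field
        map        : Func X.setoid Y.setoid
        continuous : Continuous {X = X} {Y = Y} map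
      open Func map public using (to)

    open ContinuousMap

    private
      Names : Baire → Func X.setoid Y.setoid → Set (lsuc 0ℓ ⊔ c ⊔ r ⊔ c′ ⊔ ℓ′ ⊔ r′)
      Names p f = ∃₂ λ n q → p ≗ 0^ n ▹1 q ×
        (∃[ F ] ComputesWithOracle n q F × F Realizes ⌊_⌋ {X = X} {Y = Y} f)

    𝒞 : RepresentedSpace (lsuc 0ℓ ⊔ c ⊔ ℓ ⊔ r ⊔ c′ ⊔ ℓ′ ⊔ r′) (c ⊔ ℓ′) (lsuc 0ℓ ⊔ c ⊔ r ⊔ c′ ⊔ ℓ′ ⊔ r′)
    𝒞 = record
      { setoid        = record
        { Carrier       = ContinuousMap
        ; _≈_           = λ f g → ∀ x → to f x Y.≈ to g x
        ; isEquivalence = record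
          { refl  = λ _ → YS.refl
          ; sym   = λ e x → YS.sym (e x)
          ; trans = λ e e′ x → YS.trans (e x) (e′ x)
          }
        }
      ; _⊩_           = λ p f → Names p (map f)
      ; ⊩-resp        = λ e f≈g (n , q , eq , F , comp , real) →
          n , q , (λ k → trans (sym (e k)) (eq k)) , F , comp ,
          λ p x p⊩x (y , fx≈y) →
            let d , z , Fp⊩z , fx≈z = real p x p⊩x (_ , YS.refl)
            in  d , z , Fp⊩z , YS.trans (YS.sym (f≈g x)) fx≈z
      ; single-valued = λ {p} {f} {g} → single {p} {f} {g}
      ; surjective    = λ f → let F , cont , real = continuous f
                                  n , q , comp = Table.computable lem F cont
                              in  0^ n ▹1 q , n , q , (λ _ → refl) , F , comp , real
      }
      where
      single : ∀ {p f g} → Names p (map f) → Names p (map g) → ∀ x → to f x Y.≈ to g x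
      single (n , q , e , F , comp , real) (n′ , q′ , e′ , F′ , comp′ , real′) x
        with ▹1-injective n n′ (λ k → trans (sym (e k)) (e′ k))
      ... | refl , q≗q′ =
        let p , p⊩x = X.surjective x
            d , y , Fp⊩y , fx≈y = real p x p⊩x (_ , YS.refl)
            d′ , y′ , F′p⊩y′ , gx≈y′ = real′ p x p⊩x (_ , YS.refl)
            Fp≗F′p = λ k → ⇓-functional
              (⇓-cong (⟨⟩-cong q≗q′ (λ _ → refl)) (comp p d k)) (comp′ p d′ k)
        in  YS.trans fx≈y (YS.trans
              (Y.single-valued (Y.⊩-resp Fp≗F′p YS.refl Fp⊩y) F′p⊩y′) (YS.sym gx≈y′))

  module _ (X : RepresentedSpace c ℓ r) where
    private
      module X = RepresentedSpace X

    𝒪 : RepresentedSpace _ _ _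
    𝒪 = 𝒞 X 𝕊

    Open : Set _
    Open = ∣ 𝒪 ∣

    -- A closed set is given by its open complement.
    record Closed : Set (lsuc 0ℓ ⊔ c ⊔ ℓ ⊔ r) where
      field
        complement : Open

    open Closed

    𝒜 : RepresentedSpace _ _ _
    𝒜 = record
      { setoid        = record
        { Carrier       = Closed
        ; _≈_           = λ A B → complement A ≈ complement B
        ; isEquivalence = record
          { refl  = λ {A} → S.refl {complement A}
          ; sym   = λ {A} {B} → S.sym {complement A} {complement B}
          ; trans = λ {A} {B} {C} → S.trans {complement A} {complement B} {complement C}
          }
        }
      ; _⊩_           = λ p A → p ⊩ complement A
      ; ⊩-resp        = λ {p} {q} {A} {B} → ⊩-resp {p} {q} {complement A} {complement B}
      ; single-valued = λ {p} {A} {B} → single-valued {p} {complement A} {complement B}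
      ; surjective    = surjective ∘ complement
      }
      where
      open RepresentedSpace 𝒪
      module S = Setoid setoid

    ⟦_⟧ᵒ : Open → Pred X.Carrier 0ℓ
    ⟦ U ⟧ᵒ x = ContinuousMap.to U x ≡ true

    ⟦_⟧ᶜ : Closed → Pred X.Carrier 0ℓ
    ⟦ A ⟧ᶜ = ∁ ⟦ complement A ⟧ᵒ

    -- The σ-algebra generated by the open sets.
    data Borel : Pred X.Carrier 0ℓ → Set (lsuc 0ℓ ⊔ c ⊔ ℓ ⊔ r) where
      openᵇ : ∀ U → Borel ⟦ U ⟧ᵒ
      ∁ᵇ    : ∀ {B} → Borel B → Borel (∁ B)
      ⋃ᵇ    : ∀ {B : ℕ → Pred X.Carrier 0ℓ} → (∀ i → Borel (B i)) → Borel (⋃ ℕ B)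
      respᵇ : ∀ {B B′} → B ≐ B′ → Borel B → Borel B′

    record FiniteBorelMeasure : Set (lsuc 0ℓ ⊔ c ⊔ ℓ ⊔ r) where
      field
        measure  : ∀ {B} → Borel B → ℝ
        m-cong   : ∀ {B B′} (b : Borel B) (b′ : Borel B′) → B ≐ B′ → measure b ≈ℝ measure b′
        nonneg   : ∀ {B} (b : Borel B) → 0ℝ ≤ℝ measure b
        empty    : ∀ {B} (b : Borel B) → Empty B → measure b ≈ℝ 0ℝ
        additive : ∀ {B : ℕ → Pred X.Carrier 0ℓ} (b : ∀ i → Borel (B i)) →
                   (∀ {i j} → i ≢ j → Empty (B i ∩ B j)) →
                   SumsTo (λ i → measure (b i)) (measure (⋃ᵇ b))

    -- μ is the restriction of a finite Borel measure to the open sets.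
    IsMeasure : Pred ∣ 𝒞 𝒪 ℝ< ∣ _
    IsMeasure μ = Σ[ ν ∈ FiniteBorelMeasure ]
      ∀ U → ContinuousMap.to μ U ≈ℝ FiniteBorelMeasure.measure ν (openᵇ U)

    ℳ : RepresentedSpace _ _ _
    ℳ = Subspace (𝒞 𝒪 ℝ<) IsMeasure

    ⟦_⟧ᵐ : ∣ ℳ ∣ → Open → ℝ
    ⟦ μ , _ ⟧ᵐ = ContinuousMap.to μ

    NonZero : Pred ∣ ℳ ∣ _
    NonZero μ = ¬ (∀ U → ⟦ μ ⟧ᵐ U ≈ℝ 0ℝ)

    IsSupport : ∣ ℳ ∣ → Closed → Set _
    IsSupport μ S = ∀ U → Satisfiable (⟦ U ⟧ᵒ ∩ ⟦ S ⟧ᶜ) ⇔ 0ℝ <ℝ ⟦ μ ⟧ᵐ U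

    ClosedChoice : Multifunction 𝒜 X 0ℓ
    ClosedChoice = record
      { graph = λ A x → x ∈ ⟦ A ⟧ᶜ
      ; resp  = λ {A} {A′} {x} {x′} A≈A′ x≈x′ x∈A x′∈U →
          x∈A (trans (A≈A′ x) (trans (Func.cong (ContinuousMap.map (complement A′)) x≈x′) x′∈U))
      }

    ConstructMeasure : Multifunction 𝒜 ℳ _
    ConstructMeasure = record
      { graph = λ A μ → Satisfiable ⟦ A ⟧ᶜ × NonZero μ ×
          (∃[ S ] IsSupport μ S × ⟦ S ⟧ᶜ ⊆ ⟦ A ⟧ᶜ)
      ; resp  = λ {_} {_} {μ} {μ′} A≈A′ μ≈μ′ ((x , x∈A) , μ≢0 , S , supp , S⊆A) →
          (x , x∈A ∘ trans (A≈A′ x)) ,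
          (λ μ′≡0 → μ≢0 λ U → R.trans {⟦ μ ⟧ᵐ U} {⟦ μ′ ⟧ᵐ U} {0ℝ} (μ≈μ′ U) (μ′≡0 U)) ,
          S ,
          (λ U → mk⇔ (λ h → let q , q∈ , q∉ = Equivalence.to (supp U) h in q , proj₁ (μ≈μ′ U) q∈ , q∉)
                     (λ (q , q∈ , q∉) → Equivalence.from (supp U) (q , proj₂ (μ≈μ′ U) q∈ , q∉))) ,
          λ {y} y∈S → S⊆A y∈S ∘ trans (A≈A′ y)
      }
      where module R = Setoid ℝ-setoid

{-# OPTIONS --safe #-}

-- A name x of a point of A yields the Dirac measure at x: given a name of an open set U, which contains the
-- number of a machine, this machine is simulated on x, and 1 is output as soon as it accepts.
--
-- Conversely, given μ, one searches for centres a (w 0), a (w 1), … such that the ball of radius 2⁻ (k + 2)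
-- around a (w k) has positive measure and d(a (w k), a (w (k + 1))) < 2⁻ (k + 1).  Both conditions are
-- semidecidable.  An open set has positive measure iff it meets supp μ; hence a point of supp μ in one ball
-- provides a next centre, and the limit of the centres is a limit of points of supp μ ⊆ A.

module Submission where

open import Axiom.ExcludedMiddle using (ExcludedMiddle)
open import Data.Bool.Base using (Bool; true; false)
open import Data.Empty using (⊥-elim)
open import Data.Fin as Fin using (Fin; #_)
open import Data.Integer.Base as ℤ using (+_)
import Data.Integer.Properties as ℤ
open import Data.Integer.Solver using (module +-*-Solver)
open import Data.List.Base using (List; []; _∷_)
open import Data.Nat.Base as ℕ using (ℕ; zero; suc; _+_; _∸_; _≤_; _<_; _⊔_; pred; s≤s; s≤s⁻¹)
import Data.Nat.Properties as ℕ
open import Data.Product.Base using (Σ-syntax; ∃; ∃-syntax; ∃₂; _×_; _,_; proj₁; proj₂)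
open import Data.Rational.Base as ℚ using (ℚ; 0ℚ; 1ℚ; ½)
import Data.Rational.Properties as ℚ
import Data.Rational.Unnormalised.Base as ℚᵘ
import Data.Rational.Unnormalised.Properties as ℚᵘ
open import Data.Sum.Base using (inj₁; inj₂)
open import Data.Unit.Base using (⊤; tt)
open import Data.Vec.Base using (Vec; []; _∷_; lookup)
open import Function.Base using (_∘_; id; const; case_of_)
open import Function.Bundles using (Func; mk⇔; Equivalence)
open import Level using (Level)
open import Relation.Binary.Bundles using (Setoid)
open import Relation.Binary.PropositionalEquality
  using (_≡_; _≢_; _≗_; refl; sym; trans; cong; cong₂; subst; subst₂; module ≡-Reasoning)
import Relation.Binary.Reasoning.Setoid as ≈-Reasoning
open import Relation.Nullary using (¬_; Dec; yes; no; does)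
open import Relation.Nullary.Decidable using (dec-true; dec-false; decidable-stable; does-⇔)
open import Relation.Unary using (Pred; _∈_; _⊆_; _∩_; Empty; Satisfiable)

open import Defs

open import Algebra.Properties.AbelianGroup ℚ.+-0-abelianGroup using (xyx⁻¹≈y; ∙-cancelʳ; //-rightDividesˡ)

-- Names of open sets and of measures consist of a machine number and an oracle, so both reductions
-- must run arbitrary machines inside one fixed program; this is what the universal machine is for.
-- It is total in a bound on the number of steps, and unbounded search is confined to the two uses
-- of `minᶜ` in `tagᶜ` and `searchᶜ`. The search for centres needs no backtracking: a ball has
-- positive measure iff it meets the support, so every finite sequence of centres found so far can
-- be extended. The support points behind successive balls may be unrelated; only their distances to
-- the centres count. The radii: if z lies in the k-th ball and a v is within 2⁻ (k + 3) of z, then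
-- a v is closer than 2⁻ (k + 2) + 2⁻ (k + 3) < 2⁻ (k + 1) to the k-th centre. Bounds of this size
-- add up to 2⁻ i from the i-th centre on, which is the rate of a Cauchy name.

private
  variable
    l n : ℕ
    c ℓ ℓ′ : Level

-- Total programs and their compilation

-- Programs that are primitive recursive in the oracle.  Unlike those in Code they are total, so equations
-- between them can be proved by computation.  The step of recᵉ binds the previous value, then the index.
data Expr : ℕ → Set where
  var            : Fin n → Expr n
  lit            : ℕ → Expr n
  sucᵉ           : Expr n → Expr n
  pairᵉ          : Expr n → Expr n → Expr n
  fstᵉ sndᵉ      : Expr n → Expr n
  oracleᵉ        : Expr n → Expr n
  caseᵉ          : Expr n → Expr n → Expr (suc n) → Expr n
  recᵉ           : Expr n → Expr n → Expr (suc (suc n)) → Expr n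
  callᵉ          : Expr l → Vec (Expr n) l → Expr n
  weakenᵉ        : Expr n → Expr (suc n)

caseℕ : ℕ → ℕ → (ℕ → ℕ) → ℕ
caseℕ zero    z s = z
caseℕ (suc n) z s = s n

recℕ : ℕ → ℕ → (ℕ → ℕ → ℕ) → ℕ
recℕ zero    z s = z
recℕ (suc n) z s = s (recℕ n z s) n

-- `callᵉ` and `weakenᵉ` merely change the environment; having them as constructors avoids
-- substitution on syntax.
⟦_⟧ : Expr n → Baire → Vec ℕ n → ℕ
⟦_⟧* : Vec (Expr n) l → Baire → Vec ℕ n → Vec ℕ l
⟦ var i ⟧ o ρ       = lookup ρ i
⟦ lit x ⟧ o ρ       = x
⟦ sucᵉ e ⟧ o ρ      = suc (⟦ e ⟧ o ρ)
⟦ pairᵉ e f ⟧ o ρ   = ⟪ ⟦ e ⟧ o ρ , ⟦ f ⟧ o ρ ⟫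
⟦ fstᵉ e ⟧ o ρ      = π₁ (⟦ e ⟧ o ρ)
⟦ sndᵉ e ⟧ o ρ      = π₂ (⟦ e ⟧ o ρ)
⟦ oracleᵉ e ⟧ o ρ   = o (⟦ e ⟧ o ρ)
⟦ caseᵉ e z s ⟧ o ρ = caseℕ (⟦ e ⟧ o ρ) (⟦ z ⟧ o ρ) (λ n → ⟦ s ⟧ o (n ∷ ρ))
⟦ recᵉ e z s ⟧ o ρ  = recℕ (⟦ e ⟧ o ρ) (⟦ z ⟧ o ρ) (λ v n → ⟦ s ⟧ o (v ∷ n ∷ ρ))
⟦ callᵉ f es ⟧ o ρ  = ⟦ f ⟧ o (⟦ es ⟧* o ρ)
⟦ weakenᵉ e ⟧ o (_ ∷ ρ) = ⟦ e ⟧ o ρ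
⟦ [] ⟧* o ρ         = []
⟦ e ∷ es ⟧* o ρ     = ⟦ e ⟧ o ρ ∷ ⟦ es ⟧* o ρ

encode : Vec ℕ n → ℕ
encode []      = 0
encode (x ∷ ρ) = ⟪ x , encode ρ ⟫

constᶜ : ℕ → Code
constᶜ zero    = zeroᶜ
constᶜ (suc x) = compᶜ succᶜ (constᶜ x)

varᶜ : Fin n → Code
varᶜ Fin.zero    = fstᶜ
varᶜ (Fin.suc i) = compᶜ (varᶜ i) sndᶜ

-- An environment is a nested pair. The step of `precᶜ` receives ⟪ environment , ⟪ index , previous
-- value ⟫ ⟫, which is rearranged into an extended environment. A case distinction is a recursion
-- whose step discards the previous value.
compile : Expr n → Code
compile* : Vec (Expr n) l → Code
compile (var i)       = varᶜ i
compile (lit x)       = constᶜ x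
compile (sucᵉ e)      = compᶜ succᶜ (compile e)
compile (pairᵉ e f)   = pairᶜ (compile e) (compile f)
compile (fstᵉ e)      = compᶜ fstᶜ (compile e)
compile (sndᵉ e)      = compᶜ sndᶜ (compile e)
compile (oracleᵉ e)   = compᶜ oracleᶜ (compile e)
compile (caseᵉ e z s) = compᶜ (precᶜ (compile z) (compᶜ (compile s) (pairᶜ counter fstᶜ)))
                              (pairᶜ idᶜ (compile e))
compile (recᵉ e z s)  = compᶜ (precᶜ (compile z) (compᶜ (compile s) (pairᶜ previous (pairᶜ counter fstᶜ))))
                              (pairᶜ idᶜ (compile e))
compile (callᵉ f es)  = compᶜ (compile f) (compile* es)
compile (weakenᵉ e)   = compᶜ (compile e) sndᶜ
compile* []           = zeroᶜ
compile* (e ∷ es)     = pairᶜ (compile e) (compile* es)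

module _ {o : Baire} where

  private
    fst⇓ : ∀ {a b} → o ⊢ fstᶜ [ ⟪ a , b ⟫ ]⇓ a
    fst⇓ {a} {b} = subst (o ⊢ fstᶜ [ ⟪ a , b ⟫ ]⇓_) (π₁-pair a b) fstᶜ

    snd⇓ : ∀ {a b} → o ⊢ sndᶜ [ ⟪ a , b ⟫ ]⇓ b
    snd⇓ {a} {b} = subst (o ⊢ sndᶜ [ ⟪ a , b ⟫ ]⇓_) (π₂-pair a b) sndᶜ

    const⇓ : ∀ x {n} → o ⊢ constᶜ x [ n ]⇓ x
    const⇓ zero    = zeroᶜ
    const⇓ (suc x) = compᶜ (const⇓ x) succᶜ

    var⇓ : (i : Fin n) (ρ : Vec ℕ n) → o ⊢ varᶜ i [ encode ρ ]⇓ lookup ρ i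
    var⇓ Fin.zero    (x ∷ ρ) = fst⇓
    var⇓ (Fin.suc i) (x ∷ ρ) = compᶜ snd⇓ (var⇓ i ρ)

  prec⇓ : ∀ {f g a n v} → Rec o f g a n v → o ⊢ precᶜ f g [ ⟪ a , n ⟫ ]⇓ v
  prec⇓ {f} {g} {a} {n} {v} r =
    precᶜ (subst (λ (a , n) → Rec o f g a n v) (sym (unpair-pair a n)) r)

  compile⇓ : (e : Expr n) (ρ : Vec ℕ n) → o ⊢ compile e [ encode ρ ]⇓ ⟦ e ⟧ o ρ
  compile*⇓ : (es : Vec (Expr n) l) (ρ : Vec ℕ n) → o ⊢ compile* es [ encode ρ ]⇓ encode (⟦ es ⟧* o ρ)
  compile⇓ (var i) ρ     = var⇓ i ρ
  compile⇓ (lit x) ρ     = const⇓ x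
  compile⇓ (sucᵉ e) ρ    = compᶜ (compile⇓ e ρ) succᶜ
  compile⇓ (pairᵉ e f) ρ = pairᶜ (compile⇓ e ρ) (compile⇓ f ρ)
  compile⇓ (fstᵉ e) ρ    = compᶜ (compile⇓ e ρ) fstᶜ
  compile⇓ (sndᵉ e) ρ    = compᶜ (compile⇓ e ρ) sndᶜ
  compile⇓ (oracleᵉ e) ρ = compᶜ (compile⇓ e ρ) oracleᶜ
  compile⇓ (caseᵉ e z s) ρ = compᶜ (pairᶜ (idᵗ _) (compile⇓ e ρ)) (prec⇓ (go (⟦ e ⟧ o ρ)))
    where
    go : ∀ n → Rec o _ _ (encode ρ) n (caseℕ n (⟦ z ⟧ o ρ) (λ n → ⟦ s ⟧ o (n ∷ ρ)))
    go zero    = base (compile⇓ z ρ)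
    go (suc n) = step (go n) (compᶜ (pairᶜ (compᶜ snd⇓ fst⇓) fst⇓) (compile⇓ s (n ∷ ρ)))
  compile⇓ (recᵉ e z s) ρ = compᶜ (pairᶜ (idᵗ _) (compile⇓ e ρ)) (prec⇓ (go (⟦ e ⟧ o ρ)))
    where
    go : ∀ n → Rec o _ _ (encode ρ) n (recℕ n (⟦ z ⟧ o ρ) (λ v n → ⟦ s ⟧ o (v ∷ n ∷ ρ)))
    go zero    = base (compile⇓ z ρ)
    go (suc n) = step (go n)
      (compᶜ (pairᶜ (compᶜ snd⇓ snd⇓) (pairᶜ (compᶜ snd⇓ fst⇓) fst⇓)) (compile⇓ s (_ ∷ n ∷ ρ)))
  compile⇓ (callᵉ f es) ρ      = compᶜ (compile*⇓ es ρ) (compile⇓ f _)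
  compile⇓ (weakenᵉ e) (_ ∷ ρ) = compᶜ snd⇓ (compile⇓ e ρ)
  compile*⇓ [] ρ       = zeroᶜ
  compile*⇓ (e ∷ es) ρ = pairᶜ (compile⇓ e ρ) (compile*⇓ es ρ)

  -- The given zero m only bounds the search. The value v found is the least zero and may differ
  -- from m, so nothing but φ v ≡ 0 is retained.
  min⇓ : ∀ {f n} (φ : ℕ → ℕ) → (∀ m → o ⊢ f [ ⟪ n , m ⟫ ]⇓ φ m) → ∀ {m} → φ m ≡ 0 →
         ∃[ v ] o ⊢ minᶜ f [ n ]⇓ v × φ v ≡ 0
  min⇓ {f} {n} φ f⇓ {m} φm≡0
    with leastNonzero (vanishes ∘ φ) m (λ eq → ℕ.1+n≢0 (trans (cong vanishes (sym φm≡0)) eq))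
  ... | v , ≢0 , below = v , minᶜ (λ i → pred (φ i)) before at , φv≡0
    where
    vanishes≢0 : ∀ x → vanishes x ≢ 0 → x ≡ 0
    vanishes≢0 zero    _ = refl
    vanishes≢0 (suc x) h = ⊥-elim (h refl)

    vanishes≡0 : ∀ x → vanishes x ≡ 0 → x ≡ suc (pred x)
    vanishes≡0 (suc x) _ = refl

    φv≡0 = vanishes≢0 _ ≢0
    at = subst (o ⊢ f [ _ ]⇓_) φv≡0 (f⇓ v)
    before : ∀ i → i < v → o ⊢ f [ ⟪ n , i ⟫ ]⇓ suc (pred (φ i))
    before i i<v = subst (o ⊢ f [ _ ]⇓_) (vanishes≡0 _ (below i i<v)) (f⇓ i)

v₀ : Expr (1 + n)
v₀ = var (# 0)
v₁ : Expr (2 + n)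
v₁ = var (# 1)
v₂ : Expr (3 + n)
v₂ = var (# 2)
v₃ : Expr (4 + n)
v₃ = var (# 3)
v₄ : Expr (5 + n)
v₄ = var (# 4)
v₅ : Expr (6 + n)
v₅ = var (# 5)
v₆ : Expr (7 + n)
v₆ = var (# 6)

v₇ : Expr (8 + n)
v₇ = var (# 7)

predᵉ : Expr n → Expr n
predᵉ e = caseᵉ e (lit 0) v₀

ifzeroᵉ : Expr n → Expr n → Expr n → Expr n
ifzeroᵉ e z s = caseᵉ e z (weakenᵉ s)

switchᵉ : Expr n → List (Expr n) → Expr n → Expr n
switchᵉ e []       d = d
switchᵉ e (b ∷ bs) d = ifzeroᵉ e b (switchᵉ (predᵉ e) bs d)

-- A universal machine

module _ where
  private
    components≤ : ∀ {k} t x → ⟪ suc t , x ⟫ ≤ suc k → x ≤ k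
    components≤ t x le = s≤s⁻¹ (ℕ.≤-trans (n<pair t x) le)

    π₁≤ : ∀ x → π₁ x ≤ x
    π₁≤ x = subst (π₁ x ≤_) (pair-unpair x) (m≤pair _ _)

    π₂≤ : ∀ x → π₂ x ≤ x
    π₂≤ x = subst (π₂ x ≤_) (pair-unpair x) (n≤pair (π₁ x) _)

    node-cong : ∀ t {h h′ f f′ g g′} → h ≡ h′ → f ≡ f′ → g ≡ g′ → node t h f g ≡ node t h′ f′ g′
    node-cong t refl refl refl = refl

  -- `machine n` decodes its components with a depth inherited from n, whereas a simulator treats
  -- them as machines of their own, with their own depth. Tag 0 gives `zeroᶜ` whatever the
  -- components are; all other tags make the code exceed its components, so the induction goes
  -- through.
  decode-stable : ∀ k l n → n ≤ k → n ≤ l → decode k n ≡ decode l n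
  decode-stable zero    zero    n    _   _   = refl
  decode-stable zero    (suc l) zero _   _   = refl
  decode-stable (suc k) zero    zero _   _   = refl
  decode-stable (suc k) (suc l) n    n≤k n≤l = go (π₁ n) (π₂ n) (pair-unpair n)
    where
    go : ∀ t x → ⟪ t , x ⟫ ≡ n →
         node t (decode k x) (decode k (π₁ x)) (decode k (π₂ x)) ≡
         node t (decode l x) (decode l (π₁ x)) (decode l (π₂ x))
    go zero    x _    = refl
    go (suc t) x refl = node-cong (suc t) (decode-stable k l x x≤k x≤l)
      (decode-stable k l (π₁ x) (ℕ.≤-trans (π₁≤ x) x≤k) (ℕ.≤-trans (π₁≤ x) x≤l))
      (decode-stable k l (π₂ x) (ℕ.≤-trans (π₂≤ x) x≤k) (ℕ.≤-trans (π₂≤ x) x≤l))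
      where
      x≤k = components≤ t x n≤k
      x≤l = components≤ t x n≤l

  nodeAt : ℕ → ℕ → Code
  nodeAt t x = node t (machine x) (machine (π₁ x)) (machine (π₂ x))

  machine-node : ∀ m → machine m ≡ nodeAt (π₁ m) (π₂ m)
  machine-node m = trans (decode-stable m (suc m) m ℕ.≤-refl (ℕ.n≤1+n m))
    (node-cong (π₁ m) (stable (π₂≤ m)) (stable (ℕ.≤-trans (π₁≤ _) (π₂≤ m)))
      (stable (ℕ.≤-trans (π₂≤ _) (π₂≤ m))))
    where
    stable : ∀ {x} → x ≤ m → decode m x ≡ machine x
    stable {x} x≤m = decode-stable m x x x≤m ℕ.≤-refl

-- Pending work as explicit data: with a stack of frames, evaluation becomes iteration of one
-- non-recursive step, which a total program can carry out. In `precᶠ`, i iterations are complete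
-- and `rest` remain.
data Frame : Set where
  pairˡ : (g n : ℕ) → Frame
  pairʳ : (u : ℕ) → Frame
  compᶠ : (f : ℕ) → Frame
  precᶠ : (g a i rest : ℕ) → Frame
  minᶠ  : (f n i : ℕ) → Frame

data State : Set where
  eval   : (m n : ℕ) → List Frame → State
  return : (v : ℕ) → List Frame → State

dispatch : Baire → (tag x n : ℕ) → List Frame → State
dispatch o 1 x n K = return (suc n) K
dispatch o 2 x n K = return (π₁ n) K
dispatch o 3 x n K = return (π₂ n) K
dispatch o 4 x n K = return (o n) K
dispatch o 5 x n K = eval (π₁ x) n (pairˡ (π₂ x) n ∷ K)
dispatch o 6 x n K = eval (π₂ x) n (compᶠ (π₁ x) ∷ K)
dispatch o 7 x n K = eval (π₁ x) (π₁ n) (precᶠ (π₂ x) (π₁ n) 0 (π₂ n) ∷ K)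
dispatch o 8 x n K = eval x ⟪ n , 0 ⟫ (minᶠ x n 0 ∷ K)
dispatch o _ x n K = return 0 K

next-state : Baire → State → State
next-state o (eval m n K)                        = dispatch o (π₁ m) (π₂ m) n K
next-state o (return v [])                       = return v []
next-state o (return u (pairˡ g n ∷ K))          = eval g n (pairʳ u ∷ K)
next-state o (return v (pairʳ u ∷ K))            = return ⟪ u , v ⟫ K
next-state o (return u (compᶠ f ∷ K))            = eval f u K
next-state o (return u (precᶠ g a i zero ∷ K))   = return u K
next-state o (return u (precᶠ g a i (suc r) ∷ K)) =
  eval g ⟪ a , ⟪ i , u ⟫ ⟫ (precᶠ g a (suc i) r ∷ K)
next-state o (return zero (minᶠ f n i ∷ K))      = return i K
next-state o (return (suc u) (minᶠ f n i ∷ K))   = eval f ⟪ n , suc i ⟫ (minᶠ f n (suc i) ∷ K)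

run : Baire → ℕ → State → State
run o zero    S = S
run o (suc s) S = next-state o (run o s S)

module _ {o : Baire} where

  private
    infix 4 _↝_
    _↝_ : State → State → Set
    S ↝ T = ∃[ s ] run o s S ≡ T

    ↝-refl : ∀ {S} → S ↝ S
    ↝-refl = 0 , refl

    ↝-trans : ∀ {S T U} → S ↝ T → T ↝ U → S ↝ U
    ↝-trans {S} (s , refl) (t , eq) = t + s , trans (go t) eq
      where
      go : ∀ t → run o (t + s) S ≡ run o t (run o s S)
      go zero    = refl
      go (suc t) = cong (next-state o) (go t)

    ↝-step : ∀ {S T U} → next-state o S ≡ T → T ↝ U → S ↝ U
    ↝-step eq = ↝-trans (1 , eq)

    -- The code is given up to an equation so that `machine-node` acts on the equation and the
    -- derivation stays available for structural recursion.
    eval↝ : ∀ {c n v} m → o ⊢ c [ n ]⇓ v → c ≡ machine m → ∀ {K} → eval m n K ↝ return v K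

    dispatch↝ : ∀ {c n v} t x → o ⊢ c [ n ]⇓ v → c ≡ nodeAt t x → ∀ {K} → dispatch o t x n K ↝ return v K

    -- A derivation of n iterations contains one of n - 1 iterations, while the frame counts down
    -- from the total; hence the generalisation over the r iterations still to come.
    rec↝ : ∀ {c c′ a n v} f g → Rec o c c′ a n v → c ≡ machine f → c′ ≡ machine g → ∀ r {K} →
           eval f a (precᶠ g a 0 (n + r) ∷ K) ↝ return v (precᶠ g a n r ∷ K)

    eval↝ m d eq = ↝-step refl (dispatch↝ (π₁ m) (π₂ m) d (trans eq (machine-node m)))

    dispatch↝ 0 x zeroᶜ   refl = ↝-refl
    dispatch↝ 1 x succᶜ   refl = ↝-refl
    dispatch↝ 2 x fstᶜ    refl = ↝-refl
    dispatch↝ 3 x sndᶜ    refl = ↝-refl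
    dispatch↝ 4 x oracleᶜ refl = ↝-refl
    dispatch↝ 5 x (pairᶜ d e) refl =
      ↝-trans (eval↝ (π₁ x) d refl) (↝-step refl (↝-trans (eval↝ (π₂ x) e refl) (1 , refl)))
    dispatch↝ 6 x (compᶜ d e) refl =
      ↝-trans (eval↝ (π₂ x) d refl) (↝-step refl (eval↝ (π₁ x) e refl))
    dispatch↝ 7 x (precᶜ {n = n} d) refl {K} = ↝-trans
      (subst (λ k → eval (π₁ x) (π₁ n) (precᶠ (π₂ x) (π₁ n) 0 k ∷ K) ↝
                    return _ (precᶠ (π₂ x) (π₁ n) (π₂ n) 0 ∷ K)) (ℕ.+-identityʳ _)
        (rec↝ (π₁ x) (π₂ x) d refl refl 0))
      (1 , refl)
    dispatch↝ 8 x (minᶜ {n = n} {v} w below d) refl {K} =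
      ↝-trans (go v ℕ.≤-refl) (↝-trans (eval↝ x d refl) (1 , refl))
      where
      go : ∀ i → i ≤ v → eval x ⟪ n , 0 ⟫ (minᶠ x n 0 ∷ K) ↝ eval x ⟪ n , i ⟫ (minᶠ x n i ∷ K)
      go zero    _   = ↝-refl
      go (suc i) i<v = ↝-trans (go i (ℕ.<⇒≤ i<v)) (↝-trans (eval↝ x (below i i<v) refl) (1 , refl))
    dispatch↝ (suc (suc (suc (suc (suc (suc (suc (suc (suc _))))))))) x zeroᶜ refl = ↝-refl

    rec↝ f g (base d) refl refl r = eval↝ f d refl
    rec↝ {a = a} f g (step {n} {u} d e) refl refl r {K} = ↝-trans
      (subst (λ k → eval f a (precᶠ g a 0 k ∷ K) ↝ return u (precᶠ g a n (suc r) ∷ K)) (ℕ.+-suc n r)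
        (rec↝ f g d refl refl (suc r)))
      (↝-step refl (eval↝ g e refl))

  run-complete : ∀ {m n v} → o ⊢ machine m [ n ]⇓ v → ∃[ s ] run o s (eval m n []) ≡ return v []
  run-complete {m} d = eval↝ m d refl

  private
    -- Resumes u K w: handing u to the stack K leads to the final value w.
    data Resumes : ℕ → List Frame → ℕ → Set where
      []    : ∀ {w} → Resumes w [] w
      pairˡ : ∀ {g n u v K w} → o ⊢ machine g [ n ]⇓ v → Resumes ⟪ u , v ⟫ K w →
              Resumes u (pairˡ g n ∷ K) w
      pairʳ : ∀ {u v K w} → Resumes ⟪ u , v ⟫ K w → Resumes v (pairʳ u ∷ K) w
      compᶠ : ∀ {f u v K w} → o ⊢ machine f [ u ]⇓ v → Resumes v K w → Resumes u (compᶠ f ∷ K) w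
      prec⁰ : ∀ {g a i u K w} → Resumes u K w → Resumes u (precᶠ g a i 0 ∷ K) w
      precˢ : ∀ {g a i r u v K w} → o ⊢ machine g [ ⟪ a , ⟪ i , u ⟫ ⟫ ]⇓ v →
              Resumes v (precᶠ g a (suc i) r ∷ K) w → Resumes u (precᶠ g a i (suc r) ∷ K) w
      min⁰  : ∀ {f n i K w} → Resumes i K w → Resumes 0 (minᶠ f n i ∷ K) w
      minˢ  : ∀ {f n i u v K w} → o ⊢ machine f [ ⟪ n , suc i ⟫ ]⇓ v →
              Resumes v (minᶠ f n (suc i) ∷ K) w → Resumes (suc u) (minᶠ f n i ∷ K) w

    Evaluates : Code → ℕ → List Frame → ℕ → Set
    Evaluates c n K w = ∃[ v ] o ⊢ c [ n ]⇓ v × Resumes v K w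

    Yields : State → ℕ → Set
    Yields (eval m n K) w = Evaluates (machine m) n K w
    Yields (return v K) w = Resumes v K w

    prec-evaluates : ∀ {f g a i u r K w} → Rec o f (machine g) a i u → Resumes u (precᶠ g a i r ∷ K) w →
                     ∃[ v ] Rec o f (machine g) a (i + r) v × Resumes v K w
    prec-evaluates {f} {g} {a} {i} {u} d (prec⁰ h) =
      u , subst (λ k → Rec o f (machine g) a k u) (sym (ℕ.+-identityʳ i)) d , h
    prec-evaluates {f} {g} {a} {i} d (precˢ {r = r} e h) with prec-evaluates (step d e) h
    ... | v , d′ , h′ = v , subst (λ k → Rec o f (machine g) a k v) (sym (ℕ.+-suc i r)) d′ , h′

    -- `minᶜ` wants the predecessors of all earlier values as a single function. It is accumulated
    -- in φ, which is updated at i each time the search moves on; the initial φ is arbitrary, there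
    -- being no index below 0.
    min-evaluates : ∀ {f n i u K w} (φ : ℕ → ℕ) → (∀ j → j < i → o ⊢ machine f [ ⟪ n , j ⟫ ]⇓ suc (φ j)) →
                    o ⊢ machine f [ ⟪ n , i ⟫ ]⇓ u → Resumes u (minᶠ f n i ∷ K) w →
                    Evaluates (minᶜ (machine f)) n K w
    min-evaluates φ below d (min⁰ h) = _ , minᶜ φ below d , h
    min-evaluates {f} {n} {i} φ below d (minˢ {u = u} e h) = min-evaluates φ′ below′ e h
      where
      extend : ∀ j → Dec (j ≡ i) → ℕ
      extend j (yes _) = u
      extend j (no _)  = φ j

      φ′ : ℕ → ℕ
      φ′ j = extend j (j ℕ.≟ i)

      below′ : ∀ j → j < suc i → o ⊢ machine f [ ⟪ n , j ⟫ ]⇓ suc (φ′ j)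
      below′ j j<1+i with j ℕ.≟ i
      ... | yes refl = d
      ... | no j≢i   = below j (ℕ.≤∧≢⇒< (s≤s⁻¹ j<1+i) j≢i)

    dispatch-yields : ∀ t x {n K w} → Yields (dispatch o t x n K) w → Evaluates (nodeAt t x) n K w
    dispatch-yields 0 x h = _ , zeroᶜ , h
    dispatch-yields 1 x h = _ , succᶜ , h
    dispatch-yields 2 x h = _ , fstᶜ , h
    dispatch-yields 3 x h = _ , sndᶜ , h
    dispatch-yields 4 x h = _ , oracleᶜ , h
    dispatch-yields 5 x (u , d , pairˡ e h) = _ , pairᶜ d e , h
    dispatch-yields 6 x (u , d , compᶠ e h) = _ , compᶜ d e , h
    dispatch-yields 7 x (u , d , h) with prec-evaluates (base d) h
    ... | v , d′ , h′ = v , precᶜ d′ , h′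
    dispatch-yields 8 x (u , d , h) = min-evaluates id (λ _ ()) d h
    dispatch-yields (suc (suc (suc (suc (suc (suc (suc (suc (suc _))))))))) x h = _ , zeroᶜ , h

    -- Soundness runs backwards: the final state of a halting run trivially yields its value, and a
    -- state yields whatever its successor does.
    next-yields : ∀ S {w} → Yields (next-state o S) w → Yields S w
    next-yields (eval m n K) {w} h =
      subst (λ c → Evaluates c n K w) (sym (machine-node m)) (dispatch-yields (π₁ m) (π₂ m) h)
    next-yields (return v []) h                         = h
    next-yields (return u (pairˡ g n ∷ K)) (v , d , pairʳ h) = pairˡ d h
    next-yields (return v (pairʳ u ∷ K)) h              = pairʳ h
    next-yields (return u (compᶠ f ∷ K)) (v , d , h)    = compᶠ d h
    next-yields (return u (precᶠ g a i zero ∷ K)) h     = prec⁰ h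
    next-yields (return u (precᶠ g a i (suc r) ∷ K)) (v , d , h) = precˢ d h
    next-yields (return zero (minᶠ f n i ∷ K)) h        = min⁰ h
    next-yields (return (suc u) (minᶠ f n i ∷ K)) (v , d , h) = minˢ d h

    run-yields : ∀ s S {w} → Yields (run o s S) w → Yields S w
    run-yields zero    S h = h
    run-yields (suc s) S h = run-yields s S (next-yields (run o s S) h)

  run-sound : ∀ {m n v} s → run o s (eval m n []) ≡ return v [] → o ⊢ machine m [ n ]⇓ v
  run-sound {m} {n} {v} s eq with run-yields s (eval m n []) (subst (λ S → Yields S v) (sym eq) [])
  ... | _ , d , [] = d

private
  pushᵉ : (tag x y z w K : Expr n) → Expr n
  pushᵉ tag x y z w K = sucᵉ (pairᵉ tag (pairᵉ x (pairᵉ y (pairᵉ z (pairᵉ w K)))))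

  evalᵉ : (m x K : Expr n) → Expr n
  evalᵉ m x K = pairᵉ (sucᵉ m) (pairᵉ x K)

  returnᵉ : (v K : Expr n) → Expr n
  returnᵉ v K = pairᵉ (lit 0) (pairᵉ v K)

  -- All frames share one layout, padded with zeros, so that a single lemma takes them apart. The
  -- successor separates non-empty stacks from the code 0 of the empty one.
  push : (tag x y z w K : ℕ) → ℕ
  push tag x y z w K = suc ⟪ tag , ⟪ x , ⟪ y , ⟪ z , ⟪ w , K ⟫ ⟫ ⟫ ⟫ ⟫

  stack : List Frame → ℕ
  stack []                    = 0
  stack (pairˡ g n ∷ K)       = push 0 g n 0 0 (stack K)
  stack (pairʳ u ∷ K)         = push 1 u 0 0 0 (stack K)
  stack (compᶠ f ∷ K)         = push 2 f 0 0 0 (stack K)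
  stack (precᶠ g a i r ∷ K)   = push 3 g a i r (stack K)
  stack (minᶠ f n i ∷ K)      = push 4 f n i 0 (stack K)

  state : State → ℕ
  state (eval m n K)  = ⟪ suc m , ⟪ n , stack K ⟫ ⟫
  state (return v K)  = ⟪ 0 , ⟪ v , stack K ⟫ ⟫

  dispatchᵉ : Expr 2 → Expr 5
  dispatchᵉ orc = switchᵉ v₀
    ( returnᵉ (lit 0) v₃
    ∷ returnᵉ (sucᵉ v₂) v₃
    ∷ returnᵉ (fstᵉ v₂) v₃
    ∷ returnᵉ (sndᵉ v₂) v₃
    ∷ returnᵉ (callᵉ orc (v₂ ∷ v₄ ∷ [])) v₃
    ∷ evalᵉ (fstᵉ v₁) v₂ (pushᵉ (lit 0) (sndᵉ v₁) v₂ (lit 0) (lit 0) v₃)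
    ∷ evalᵉ (sndᵉ v₁) v₂ (pushᵉ (lit 2) (fstᵉ v₁) (lit 0) (lit 0) (lit 0) v₃)
    ∷ evalᵉ (fstᵉ v₁) (fstᵉ v₂) (pushᵉ (lit 3) (sndᵉ v₁) (fstᵉ v₂) (lit 0) (sndᵉ v₂) v₃)
    ∷ evalᵉ v₁ (pairᵉ v₂ (lit 0)) (pushᵉ (lit 4) v₁ v₂ (lit 0) (lit 0) v₃)
    ∷ [])
    (returnᵉ (lit 0) v₃)

  -- The environment is tag ∷ x ∷ y ∷ z ∷ w ∷ K ∷ v: the fields of the top frame, the remaining stack,
  -- and the value returned to it.
  resumeᵉ : Expr 7
  resumeᵉ = switchᵉ v₀
    ( evalᵉ v₁ v₂ (pushᵉ (lit 1) v₆ (lit 0) (lit 0) (lit 0) v₅)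
    ∷ returnᵉ (pairᵉ v₁ v₆) v₅
    ∷ evalᵉ v₁ v₆ v₅
    ∷ ifzeroᵉ v₄ (returnᵉ v₆ v₅)
        (evalᵉ v₁ (pairᵉ v₂ (pairᵉ v₃ v₆)) (pushᵉ (lit 3) v₁ v₂ (sucᵉ v₃) (predᵉ v₄) v₅))
    ∷ [])
    (ifzeroᵉ v₆ (returnᵉ v₃ v₅)
      (evalᵉ v₁ (pairᵉ v₂ (sucᵉ v₃)) (pushᵉ (lit 4) v₁ v₂ (sucᵉ v₃) (lit 0) v₅)))

  popᵉ : Expr 2
  popᵉ = caseᵉ v₁ (returnᵉ v₀ (lit 0)) (callᵉ resumeᵉ
    ( fstᵉ v₀
    ∷ fstᵉ (sndᵉ v₀)
    ∷ fstᵉ (sndᵉ (sndᵉ v₀))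
    ∷ fstᵉ (sndᵉ (sndᵉ (sndᵉ v₀)))
    ∷ fstᵉ (sndᵉ (sndᵉ (sndᵉ (sndᵉ v₀))))
    ∷ sndᵉ (sndᵉ (sndᵉ (sndᵉ (sndᵉ v₀))))
    ∷ v₁
    ∷ []))

  nextᵉ : Expr 2 → Expr 2
  nextᵉ orc = caseᵉ (fstᵉ v₀)
    (callᵉ popᵉ (fstᵉ (sndᵉ v₀) ∷ sndᵉ (sndᵉ v₀) ∷ []))
    (callᵉ (dispatchᵉ orc) (fstᵉ v₀ ∷ sndᵉ v₀ ∷ fstᵉ (sndᵉ v₁) ∷ sndᵉ (sndᵉ v₁) ∷ v₂ ∷ []))

  resultᵉ : Expr 1
  resultᵉ = ifzeroᵉ (fstᵉ v₀) (ifzeroᵉ (sndᵉ (sndᵉ v₀)) (sucᵉ (fstᵉ (sndᵉ v₀))) (lit 0)) (lit 0)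

-- Arguments: a number of steps, a machine, its input, and a parameter x.  The machine runs with oracle
-- λ i → orc(i, x); the result is 0 if it has not halted and suc v if it has halted with output v.
opaque
  runᵉ : Expr 2 → Expr 4
  runᵉ orc = callᵉ resultᵉ
    (recᵉ v₀ (pairᵉ (sucᵉ v₁) (pairᵉ v₂ (lit 0))) (callᵉ (nextᵉ orc) (v₀ ∷ v₅ ∷ [])) ∷ [])

module _ (o : Baire) (orc : Expr 2) (x : ℕ) where
  private
    o′ : Baire
    o′ i = ⟦ orc ⟧ o (i ∷ x ∷ [])

    dispatch-state : ∀ t y n K →
      ⟦ dispatchᵉ orc ⟧ o (t ∷ y ∷ n ∷ stack K ∷ x ∷ []) ≡ state (dispatch o′ t y n K)
    dispatch-state 0 y n K = refl
    dispatch-state 1 y n K = refl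
    dispatch-state 2 y n K = refl
    dispatch-state 3 y n K = refl
    dispatch-state 4 y n K = refl
    dispatch-state 5 y n K = refl
    dispatch-state 6 y n K = refl
    dispatch-state 7 y n K = refl
    dispatch-state 8 y n K = refl
    dispatch-state (suc (suc (suc (suc (suc (suc (suc (suc (suc _))))))))) y n K = refl

    pop-push : ∀ tag y z w r K v → ⟦ popᵉ ⟧ o (v ∷ push tag y z w r K ∷ []) ≡
               ⟦ resumeᵉ ⟧ o (tag ∷ y ∷ z ∷ w ∷ r ∷ K ∷ v ∷ [])
    pop-push tag y z w r K v
      rewrite unpair-pair tag ⟪ y , ⟪ z , ⟪ w , ⟪ r , K ⟫ ⟫ ⟫ ⟫
            | unpair-pair y ⟪ z , ⟪ w , ⟪ r , K ⟫ ⟫ ⟫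
            | unpair-pair z ⟪ w , ⟪ r , K ⟫ ⟫
            | unpair-pair w ⟪ r , K ⟫
            | unpair-pair r K = refl

    pop-state : ∀ v K → ⟦ popᵉ ⟧ o (v ∷ stack K ∷ []) ≡ state (next-state o′ (return v K))
    pop-state v []                          = refl
    pop-state v (pairˡ g n ∷ K)             = pop-push 0 g n 0 0 (stack K) v
    pop-state v (pairʳ u ∷ K)               = pop-push 1 u 0 0 0 (stack K) v
    pop-state v (compᶠ f ∷ K)               = pop-push 2 f 0 0 0 (stack K) v
    pop-state v (precᶠ g a i zero ∷ K)      = pop-push 3 g a i 0 (stack K) v
    pop-state v (precᶠ g a i (suc r) ∷ K)   = pop-push 3 g a i (suc r) (stack K) v
    pop-state zero    (minᶠ f n i ∷ K)      = pop-push 4 f n i 0 (stack K) 0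
    pop-state (suc v) (minᶠ f n i ∷ K)      = pop-push 4 f n i 0 (stack K) (suc v)

    next-pair : ∀ m y K → ⟦ nextᵉ orc ⟧ o (⟪ m , ⟪ y , K ⟫ ⟫ ∷ x ∷ []) ≡
      caseℕ m (⟦ popᵉ ⟧ o (y ∷ K ∷ []))
        (λ m → ⟦ dispatchᵉ orc ⟧ o (π₁ m ∷ π₂ m ∷ y ∷ K ∷ x ∷ []))
    next-pair m y K rewrite unpair-pair m ⟪ y , K ⟫ | unpair-pair y K = refl

    next-state-correct : ∀ S → ⟦ nextᵉ orc ⟧ o (state S ∷ x ∷ []) ≡ state (next-state o′ S)
    next-state-correct (eval m n K) = trans (next-pair (suc m) n _) (dispatch-state (π₁ m) (π₂ m) n K)
    next-state-correct (return v K) = trans (next-pair 0 v _) (pop-state v K)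

    result : State → ℕ
    result (return v []) = suc v
    result _             = 0

    result-pair : ∀ m y K → ⟦ resultᵉ ⟧ o (⟪ m , ⟪ y , K ⟫ ⟫ ∷ []) ≡
                  caseℕ m (caseℕ K (suc y) (λ _ → 0)) (λ _ → 0)
    result-pair m y K rewrite unpair-pair m ⟪ y , K ⟫ | unpair-pair y K = refl

    result-correct : ∀ S → ⟦ resultᵉ ⟧ o (state S ∷ []) ≡ result S
    result-correct (eval m n K)                  = result-pair (suc m) n _
    result-correct (return v [])                 = result-pair 0 v 0
    result-correct (return v (pairˡ _ _ ∷ _))     = result-pair 0 v _
    result-correct (return v (pairʳ _ ∷ _))       = result-pair 0 v _
    result-correct (return v (compᶠ _ ∷ _))       = result-pair 0 v _
    result-correct (return v (precᶠ _ _ _ _ ∷ _)) = result-pair 0 v _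
    result-correct (return v (minᶠ _ _ _ ∷ _))    = result-pair 0 v _

    result-suc : ∀ S {v} → result S ≡ suc v → S ≡ return v []
    result-suc (return v []) refl = refl

    opaque
      unfolding runᵉ

      run-correct : ∀ s m n → ⟦ runᵉ orc ⟧ o (s ∷ m ∷ n ∷ x ∷ []) ≡ result (run o′ s (eval m n []))
      run-correct s m n = trans (cong (λ S → ⟦ resultᵉ ⟧ o (S ∷ [])) (go s)) (result-correct (run o′ s _))
        where
        go : ∀ s → recℕ s (state (eval m n [])) (λ S _ → ⟦ nextᵉ orc ⟧ o (S ∷ x ∷ [])) ≡
                   state (run o′ s (eval m n []))
        go zero    = refl
        go (suc s) = trans (cong (λ S → ⟦ nextᵉ orc ⟧ o (S ∷ x ∷ [])) (go s))
                           (next-state-correct (run o′ s _))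

  runᵉ-complete : ∀ m n {v} → o′ ⊢ machine m [ n ]⇓ v → ∃[ s ] ⟦ runᵉ orc ⟧ o (s ∷ m ∷ n ∷ x ∷ []) ≡ suc v
  runᵉ-complete m n d with run-complete {m = m} d
  ... | s , eq = s , trans (run-correct s m n) (cong result eq)

  runᵉ-sound : ∀ m n {v} s → ⟦ runᵉ orc ⟧ o (s ∷ m ∷ n ∷ x ∷ []) ≡ suc v → o′ ⊢ machine m [ n ]⇓ v
  runᵉ-sound m n s eq = run-sound s (result-suc (run o′ s _) (trans (sym (run-correct s m n)) eq))

-- Interleaved and tagged sequences

addᵉ : Expr n → Expr n → Expr n
addᵉ e f = recᵉ e f (sucᵉ v₀)

add-correct : ∀ m n → recℕ m n (λ v _ → suc v) ≡ m + n
add-correct zero    n = refl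
add-correct (suc m) n = cong suc (add-correct m n)

doubleᵉ : Expr n → Expr n
doubleᵉ e = recᵉ e (lit 0) (sucᵉ (sucᵉ v₀))

double-correct : ∀ n → recℕ n 0 (λ v _ → suc (suc v)) ≡ double n
double-correct zero    = refl
double-correct (suc n) = cong (suc ∘ suc) (double-correct n)

parity half : ℕ → ℕ
parity n = recℕ n 0 (λ v _ → caseℕ v 1 (λ _ → 0))
half n = recℕ n 0 (λ v m → caseℕ (parity m) v (λ _ → suc v))

parityᵉ halfᵉ : Expr n → Expr n
parityᵉ e = recᵉ e (lit 0) (ifzeroᵉ v₀ (lit 1) (lit 0))
halfᵉ e = recᵉ e (lit 0) (ifzeroᵉ (parityᵉ v₁) v₀ (sucᵉ v₀))

-- Dropping the first entry of ⟨ p , q ⟩ exchanges the roles of the two sequences, so the induction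
-- hypothesis is used with q first, and the parity flips.
interleave : ∀ p q n → ⟨ p , q ⟩ n ≡ caseℕ (parity n) (p (half n)) (λ _ → q (half n))
interleave p q zero    = refl
interleave p q (suc n) with parity n | interleave q (p ∘ suc) n
... | zero  | eq = eq
... | suc _ | eq = eq

-- Here and below, the arguments of an Expr 2 that stands for a sequence are an index and a parameter.
interleaveᵉ : Expr 2 → Expr 2 → Expr 2
interleaveᵉ p q = ifzeroᵉ (parityᵉ v₀) (callᵉ p (halfᵉ v₀ ∷ v₁ ∷ [])) (callᵉ q (halfᵉ v₀ ∷ v₁ ∷ []))

interleaveᵉ-correct : ∀ o e f x → (λ i → ⟦ interleaveᵉ e f ⟧ o (i ∷ x ∷ [])) ≗
  ⟨ (λ i → ⟦ e ⟧ o (i ∷ x ∷ [])) , (λ i → ⟦ f ⟧ o (i ∷ x ∷ [])) ⟩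
interleaveᵉ-correct o e f x n = sym (interleave _ _ n)

nameᵉ : ℕ → Expr 2 → Expr 2
nameᵉ zero    e = caseᵉ v₀ (lit 1) (callᵉ e (v₀ ∷ v₂ ∷ []))
nameᵉ (suc n) e = caseᵉ v₀ (lit 0) (callᵉ (nameᵉ n e) (v₀ ∷ v₂ ∷ []))

nameᵉ-correct : ∀ {o} n e x → (λ i → ⟦ nameᵉ n e ⟧ o (i ∷ x ∷ [])) ≗ 0^ n ▹1 (λ i → ⟦ e ⟧ o (i ∷ x ∷ []))
nameᵉ-correct zero    e x zero    = refl
nameᵉ-correct zero    e x (suc i) = refl
nameᵉ-correct (suc n) e x zero    = refl
nameᵉ-correct (suc n) e x (suc i) = nameᵉ-correct n e x i

▹1-zeros : ∀ {n i p} → i < n → (0^ n ▹1 p) i ≡ 0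
▹1-zeros {suc n} {zero}  _       = refl
▹1-zeros {suc n} {suc i} (s≤s h) = ▹1-zeros h

▹1-one : ∀ n {p} → (0^ n ▹1 p) n ≡ 1
▹1-one zero    = refl
▹1-one (suc n) = ▹1-one n

▹1-tail : ∀ n {p} i → (0^ n ▹1 p) (n + suc i) ≡ p i
▹1-tail zero    i = refl
▹1-tail (suc n) i = ▹1-tail n i

evenᵉ oddᵉ : Expr n → Expr n
evenᵉ e = oracleᵉ (doubleᵉ e)
oddᵉ e = oracleᵉ (sucᵉ (doubleᵉ e))

evenᵉ-correct : ∀ p q n → ⟨ p , q ⟩ (recℕ n 0 (λ v _ → suc (suc v))) ≡ p n
evenᵉ-correct p q n = trans (cong ⟨ p , q ⟩ (double-correct n)) (⟨⟩-even p q n)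

oddᵉ-correct : ∀ p q n → ⟨ p , q ⟩ (suc (recℕ n 0 (λ v _ → suc (suc v)))) ≡ q n
oddᵉ-correct p q n = trans (cong (⟨ p , q ⟩ ∘ suc) (double-correct n)) (⟨⟩-odd p q n)

-- For an oracle ⟨ q , 0^ n ▹1 r ⟩, the following programs find n and, given n, the entries of r.
tagᶜ : Code
tagᶜ = minᶜ (compᶜ vanishesᶜ (compᶜ oddᶜ sndᶜ))

tailᵉ : Expr 2
tailᵉ = oddᵉ (addᵉ v₁ (sucᵉ v₀))

tag⇓ : ∀ {q p n r x} → p ≗ 0^ n ▹1 r → ⟨ q , p ⟩ ⊢ tagᶜ [ x ]⇓ n
tag⇓ {q} {p} {n} {r} {x} e = minᶜ (const 0) (λ m m<n → test m (trans (e m) (▹1-zeros m<n)))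
                                 (test n (trans (e n) (▹1-one n)))
  where
  test : ∀ m {v} → p m ≡ v → ⟨ q , p ⟩ ⊢ compᶜ vanishesᶜ (compᶜ oddᶜ sndᶜ) [ ⟪ x , m ⟫ ]⇓ vanishes v
  test m refl = compᶜ
    (compᶜ (subst (⟨ q , p ⟩ ⊢ sndᶜ [ ⟪ x , m ⟫ ]⇓_) (π₂-pair x m) sndᶜ) (oddᵗ m)) (vanishesᵗ _)

tail-correct : ∀ {q p n r} → p ≗ 0^ n ▹1 r → ∀ i → ⟦ tailᵉ ⟧ ⟨ q , p ⟩ (i ∷ n ∷ []) ≡ r i
tail-correct {q} {p} {n} {r} e i = begin
  ⟦ tailᵉ ⟧ ⟨ q , p ⟩ (i ∷ n ∷ [])     ≡⟨ oddᵉ-correct q p (recℕ n (suc i) (λ v _ → suc v)) ⟩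
  p (recℕ n (suc i) (λ v _ → suc v))  ≡⟨ cong p (add-correct n (suc i)) ⟩
  p (n + suc i)                       ≡⟨ e _ ⟩
  (0^ n ▹1 r) (n + suc i)             ≡⟨ ▹1-tail n i ⟩
  r i                                 ∎
  where open ≡-Reasoning

-- Partial functions computed by programs

Agree-mono : ∀ {m n p q} → m ≤ n → Agree n p q → Agree m p q
Agree-mono m≤n a i i<m = a i (ℕ.<-≤-trans i<m m≤n)

bounded-choice : ∀ {P : ℕ → ℕ → Set} → (∀ {i m n} → m ≤ n → P i m → P i n) →
                 ∀ v → (∀ i → i < v → ∃ (P i)) → ∃[ m ] (∀ i → i < v → P i m)
bounded-choice mono zero    h = 0 , λ _ ()
bounded-choice {P} mono (suc v) h
  with bounded-choice {P} mono v (λ i i<v → h i (ℕ.m<n⇒m<1+n i<v)) | h v ℕ.≤-refl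
... | m , f | n , pv = m ⊔ n , go
  where
  go : ∀ i → i < suc v → P i (m ⊔ n)
  go i i<1+v with ℕ.m<1+n⇒m<n∨m≡n i<1+v
  ... | inj₁ i<v  = mono (ℕ.m≤m⊔n m n) (f i i<v)
  ... | inj₂ refl = mono (ℕ.m≤n⊔m m n) pv

-- A derivation is finite and consults the oracle finitely often. This gives continuity of every
-- function defined by a program, so no realizer below that comes from a program needs its own
-- modulus.
⇓-modulus : ∀ {o c n v} → o ⊢ c [ n ]⇓ v → ∃[ m ] (∀ {o′} → Agree m o o′ → o′ ⊢ c [ n ]⇓ v)
Rec-modulus : ∀ {o f g a n v} → Rec o f g a n v → ∃[ m ] (∀ {o′} → Agree m o o′ → Rec o′ f g a n v)
⇓-modulus zeroᶜ = 0 , λ _ → zeroᶜ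
⇓-modulus succᶜ = 0 , λ _ → succᶜ
⇓-modulus fstᶜ  = 0 , λ _ → fstᶜ
⇓-modulus sndᶜ  = 0 , λ _ → sndᶜ
⇓-modulus (oracleᶜ {n}) = suc n , λ {o′} a → subst (o′ ⊢ oracleᶜ [ n ]⇓_) (sym (a n ℕ.≤-refl)) oracleᶜ
⇓-modulus (pairᶜ d e) = let m , f = ⇓-modulus d ; n , g = ⇓-modulus e in
  m ⊔ n , λ a → pairᶜ (f (Agree-mono (ℕ.m≤m⊔n m n) a)) (g (Agree-mono (ℕ.m≤n⊔m m n) a))
⇓-modulus (compᶜ d e) = let m , f = ⇓-modulus d ; n , g = ⇓-modulus e in
  m ⊔ n , λ a → compᶜ (f (Agree-mono (ℕ.m≤m⊔n m n) a)) (g (Agree-mono (ℕ.m≤n⊔m m n) a))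
⇓-modulus (precᶜ d) = let m , f = Rec-modulus d in m , λ a → precᶜ (f a)
⇓-modulus {o} (minᶜ {f} {n} {v} w below d) =
  let k , h = ⇓-modulus d
      m , g = bounded-choice {λ i m → ∀ {o′} → Agree m o o′ → o′ ⊢ f [ ⟪ n , i ⟫ ]⇓ suc (w i)}
                (λ m≤n g a → g (Agree-mono m≤n a)) v (λ i i<v → ⇓-modulus (below i i<v))
  in  m ⊔ k , λ a → minᶜ w (λ i i<v → g i i<v (Agree-mono (ℕ.m≤m⊔n m k) a))
                           (h (Agree-mono (ℕ.m≤n⊔m m k) a))
Rec-modulus (base d) = let m , f = ⇓-modulus d in m , λ a → base (f a)
Rec-modulus (step d e) = let m , f = Rec-modulus d ; n , g = ⇓-modulus e in
  m ⊔ n , λ a → step (f (Agree-mono (ℕ.m≤m⊔n m n) a)) (g (Agree-mono (ℕ.m≤n⊔m m n) a))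

-- The output sequence is part of the proof of membership in the domain, so `apply` only projects.
program : Code → PartialFunction
program c = record
  { dom        = λ p → ∃ (Total p c)
  ; dom-resp   = λ pq (φ , t) → φ , λ k → ⇓-cong pq (t k)
  ; apply      = λ p → proj₁
  ; apply-cong = λ (φ , t) (ψ , u) pq k → ⇓-functional (⇓-cong pq (t k)) (u k)
  }

program-computable : ∀ c → Computable (program c)
program-computable c = c , λ p (_ , t) → t

programWithOracle : Code → Baire → PartialFunction
programWithOracle c q = record
  { dom        = λ p → ∃ (Total ⟨ q , p ⟩ c)
  ; dom-resp   = λ pq (φ , t) → φ , λ k → ⇓-cong (⟨⟩-cong (λ _ → refl) pq) (t k)
  ; apply      = λ p → proj₁
  ; apply-cong = λ (φ , t) (ψ , u) pq k → ⇓-functional (⇓-cong (⟨⟩-cong (λ _ → refl) pq) (t k)) (u k)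
  }

programWithOracle-computes : ∀ c q → ComputesWithOracle ⌜ c ⌝ q (programWithOracle c q)
programWithOracle-computes c q = computes-⌜⌝ c (programWithOracle c q) λ p (_ , t) → t

⟨⟩-agree : ∀ {n p p′ q q′} → Agree n p p′ → Agree n q q′ → Agree n ⟨ p , q ⟩ ⟨ p′ , q′ ⟩
⟨⟩-agree a b zero    0<n             = a 0 0<n
⟨⟩-agree {suc n} a b (suc i) (s≤s i<n) =
  ⟨⟩-agree (λ j j<n → b j (ℕ.m<n⇒m<1+n j<n)) (λ j j<n → a (suc j) (s≤s j<n)) i i<n

programWithOracle-continuous : ∀ c q → ContinuousPartial (programWithOracle c q)
programWithOracle-continuous c q p (φ , t) n =
  let m , f = bounded-choice {λ i m → ∀ {o} → Agree m ⟨ q , p ⟩ o → o ⊢ c [ i ]⇓ φ i}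
                (λ m≤n g a → g (Agree-mono m≤n a)) n (λ i _ → ⇓-modulus (t i))
  in  m , λ p′ (ψ , u) a i i<n → ⇓-functional (f i i<n (⟨⟩-agree (λ _ _ → refl) a)) (u i)

-- Comparing reals with rationals

+ℝ-≤-<-fromℚ : ∀ {x y z a b} → z ≤ℝ x +ℝ y → x ≤ℝ fromℚ a → y <ℝ fromℚ b → z <ℝ fromℚ (a ℚ.+ b)
+ℝ-≤-<-fromℚ {x} {y} {a = a} z≤ x≤a (r , r<b , r∉y) =
  a ℚ.+ r , ℚ.+-monoʳ-< a r<b , sum∉ x y (λ a∈x → ℚ.<-irrefl refl (x≤a a∈x)) r∉y ∘ z≤

<ℝ-fromℚ⇒∉ : ∀ x {a} → x <ℝ fromℚ a → ¬ ℝ.cut x a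
<ℝ-fromℚ⇒∉ x (s , s<a , s∉x) a∈x = s∉x (ℝ.lower x (ℚ.<⇒≤ s<a) a∈x)

≤ℝ-fromℚ-< : ∀ {x a b} → x ≤ℝ fromℚ a → a ℚ.< b → x <ℝ fromℚ b
≤ℝ-fromℚ-< {a = a} x≤a a<b = a , a<b , λ a∈x → ℚ.<-irrefl refl (x≤a a∈x)

<ℝ-fromℚ-mono : ∀ {x a b} → x <ℝ fromℚ a → a ℚ.≤ b → x <ℝ fromℚ b
<ℝ-fromℚ-mono (s , s<a , s∉x) a≤b = s , ℚ.<-≤-trans s<a a≤b , s∉x

fromℚ-≤-+ℝ : ∀ {a b x y} → fromℚ a ≤ℝ x → fromℚ b ≤ℝ y → fromℚ (a ℚ.+ b) ≤ℝ x +ℝ y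
fromℚ-≤-+ℝ {a} {b} a≤x b≤y {q} q<a+b =
  q ℚ.- s , s , a≤x q-s<a , b≤y s<b , ℚ.≤-reflexive (sym (//-rightDividesˡ s q))
  where
  -- Any s with q - a < s < b splits q as (q - s) + s with the summands below a and b.
  dense = ℚ.<-dense (subst (q ℚ.- a ℚ.<_) (xyx⁻¹≈y a b) (ℚ.+-monoˡ-< (ℚ.- a) q<a+b))
  s = proj₁ dense
  s<b = proj₂ (proj₂ dense)

  q<s+a : q ℚ.< s ℚ.+ a
  q<s+a = subst (ℚ._< s ℚ.+ a) (//-rightDividesˡ a q) (ℚ.+-monoˡ-< a (proj₁ (proj₂ dense)))

  q-s<a : q ℚ.- s ℚ.< a
  q-s<a = subst (q ℚ.- s ℚ.<_) (xyx⁻¹≈y s a) (ℚ.+-monoˡ-< (ℚ.- s) q<s+a)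

+ℝ-≤-fromℚ : ∀ {x y a b} → x ≤ℝ fromℚ a → y ≤ℝ fromℚ b → x +ℝ y ≤ℝ fromℚ (a ℚ.+ b)
+ℝ-≤-fromℚ x≤a y≤b (s , t , s∈x , t∈y , q≤s+t) = ℚ.≤-<-trans q≤s+t (ℚ.+-mono-< (x≤a s∈x) (y≤b t∈y))

0<2⁻ : ∀ n → 0ℚ ℚ.< 2⁻ n
0<2⁻ n = ℚ.positive⁻¹ _ {{2⁻-positive n}}

0<-difference : ∀ {a b} → a ℚ.< b → 0ℚ ℚ.< b ℚ.- a
0<-difference {a} {b} a<b = subst (ℚ._< b ℚ.- a) (ℚ.+-inverseʳ a) (ℚ.+-monoˡ-< (ℚ.- a) a<b)

+-difference : ∀ a b → a ℚ.+ (b ℚ.- a) ≡ b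
+-difference a b = trans (ℚ.+-comm a _) (//-rightDividesˡ a b)

-- Arithmetic on names of rationals

toℚᵘ-νℚ : ∀ a b k → ℚ.toℚᵘ (νℚ ⟪ a , ⟪ b , k ⟫ ⟫) ℚᵘ.≃ ℚᵘ.mkℚᵘ (a ℤ.⊖ b) k
toℚᵘ-νℚ a b k rewrite unpair-pair a ⟪ b , k ⟫ | unpair-pair b k = ℚ.toℚᵘ-fromℚᵘ (ℚᵘ.mkℚᵘ (a ℤ.⊖ b) k)

-- suc (2^-1 n) is the n-th power of two.
2^-1 : ℕ → ℕ
2^-1 zero    = 0
2^-1 (suc n) = suc (2^-1 n + 2^-1 n)

2^-1-+ : ∀ m n → suc (2^-1 (m + n)) ≡ suc (2^-1 m) ℕ.* suc (2^-1 n)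
2^-1-+ zero    n = sym (ℕ.+-identityʳ _)
2^-1-+ (suc m) n = begin
  suc (suc (x + x))                   ≡⟨ cong suc (ℕ.+-suc x x) ⟨
  suc x + suc x                       ≡⟨ cong₂ _+_ (2^-1-+ m n) (2^-1-+ m n) ⟩
  suc y ℕ.* z + suc y ℕ.* z           ≡⟨ ℕ.*-distribʳ-+ z (suc y) (suc y) ⟨
  (suc y + suc y) ℕ.* z               ≡⟨ cong (λ w → suc w ℕ.* z) (ℕ.+-suc y y) ⟩
  suc (suc (y + y)) ℕ.* z             ∎
  where
  open ≡-Reasoning
  x = 2^-1 (m + n)
  y = 2^-1 m
  z = suc (2^-1 n)

toℚᵘ-2⁻ : ∀ n → ℚ.toℚᵘ (2⁻ n) ℚᵘ.≃ ℚᵘ.mkℚᵘ (+ 1) (2^-1 n)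
toℚᵘ-2⁻ zero    = ℚᵘ.≃-refl
toℚᵘ-2⁻ (suc n) = begin
  ℚ.toℚᵘ (½ ℚ.* 2⁻ n)                   ≈⟨ ℚ.toℚᵘ-homo-* ½ (2⁻ n) ⟩
  ℚᵘ.½ ℚᵘ.* ℚ.toℚᵘ (2⁻ n)               ≈⟨ ℚᵘ.*-congˡ {ℚᵘ.½} (toℚᵘ-2⁻ n) ⟩
  ℚᵘ.½ ℚᵘ.* ℚᵘ.mkℚᵘ (+ 1) (2^-1 n)      ≈⟨ ℚᵘ.*≡* (cong +_ eq) ⟩
  ℚᵘ.mkℚᵘ (+ 1) (2^-1 (suc n))          ∎
  where
  open ≈-Reasoning ℚᵘ.≃-setoid
  eq : 1 ℕ.* suc (2^-1 (suc n)) ≡ 1 ℕ.* (2 ℕ.* suc (2^-1 n))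
  eq = cong (λ z → 1 ℕ.* suc z) (trans (sym (ℕ.+-suc (2^-1 n) _))
    (cong (λ z → 2^-1 n + suc z) (sym (ℕ.+-identityʳ _))))

-- With A = 2^j and B = 2^k, this is (A - B) / (A B) = 1 / B - 1 / A.
2⁻-difference : ℕ → ℕ → ℕ
2⁻-difference k j = ⟪ suc (2^-1 j) , ⟪ suc (2^-1 k) , 2^-1 (j + k) ⟫ ⟫

νℚ-2⁻-difference : ∀ k j → νℚ (2⁻-difference k j) ℚ.+ 2⁻ j ≡ 2⁻ k
νℚ-2⁻-difference k j = ℚ.toℚᵘ-injective (begin
  ℚ.toℚᵘ (νℚ (2⁻-difference k j) ℚ.+ 2⁻ j)
    ≈⟨ ℚ.toℚᵘ-homo-+ (νℚ (2⁻-difference k j)) (2⁻ j) ⟩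
  ℚ.toℚᵘ (νℚ (2⁻-difference k j)) ℚᵘ.+ ℚ.toℚᵘ (2⁻ j)
    ≈⟨ ℚᵘ.+-cong (toℚᵘ-νℚ _ _ (2^-1 (j + k))) (toℚᵘ-2⁻ j) ⟩
  ℚᵘ.mkℚᵘ (suc (2^-1 j) ℤ.⊖ suc (2^-1 k)) (2^-1 (j + k)) ℚᵘ.+ ℚᵘ.mkℚᵘ (+ 1) (2^-1 j)
    ≈⟨ ℚᵘ.*≡* eq ⟩
  ℚᵘ.mkℚᵘ (+ 1) (2^-1 k)
    ≈⟨ toℚᵘ-2⁻ k ⟨
  ℚ.toℚᵘ (2⁻ k)
    ∎)
  where
  open ≈-Reasoning ℚᵘ.≃-setoid
  A = + suc (2^-1 j)
  B = + suc (2^-1 k)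
  C = + suc (2^-1 (j + k))
  C≡AB : C ≡ A ℤ.* B
  C≡AB = trans (cong +_ (2^-1-+ j k)) (ℤ.pos-* (suc (2^-1 j)) (suc (2^-1 k)))
  open +-*-Solver
  eq : ((suc (2^-1 j) ℤ.⊖ suc (2^-1 k)) ℤ.* A ℤ.+ + 1 ℤ.* C) ℤ.* B ≡
       + 1 ℤ.* + (suc (2^-1 (j + k)) ℕ.* suc (2^-1 j))
  eq = trans (cong₂ (λ d c → (d ℤ.* A ℤ.+ + 1 ℤ.* c) ℤ.* B) 
           (sym (ℤ.m-n≡m⊖n (suc (2^-1 j)) (suc (2^-1 k)))) C≡AB)
    (trans (solve 2 (λ a b → ((a :+ :- b) :* a :+ con (+ 1) :* (a :* b)) :* b := con (+ 1) :* ((a :* b) :* a))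
                    refl A B)
      (cong (+ 1 ℤ.*_) (trans (cong (ℤ._* A) (sym C≡AB)) (sym (ℤ.pos-* (suc (2^-1 (j + k))) (suc (2^-1 j)))))))

2^-1ᵉ : Expr n → Expr n
2^-1ᵉ e = recᵉ e (lit 0) (sucᵉ (addᵉ v₀ v₀))

2⁻-differenceᵉ : Expr n → Expr n → Expr n
2⁻-differenceᵉ k j = pairᵉ (sucᵉ (2^-1ᵉ j)) (pairᵉ (sucᵉ (2^-1ᵉ k)) (2^-1ᵉ (addᵉ j k)))

2⁻-differenceᵉ-correct : ∀ {o} k j → ⟦ 2⁻-differenceᵉ v₀ v₁ ⟧ o (k ∷ j ∷ []) ≡ 2⁻-difference k j
2⁻-differenceᵉ-correct {o} k j = cong₂ (λ x y → ⟪ suc x , y ⟫) (pow j)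
  (cong₂ (λ x y → ⟪ suc x , y ⟫) (pow k) (trans (pow _) (cong 2^-1 (add-correct j k))))
  where
  pow : ∀ n → ⟦ 2^-1ᵉ v₀ ⟧ o (n ∷ []) ≡ 2^-1 n
  pow zero    = refl
  pow (suc n) = cong suc (trans (add-correct (⟦ 2^-1ᵉ v₀ ⟧ o (n ∷ [])) _) (cong₂ _+_ (pow n) (pow n)))

-- Truncated subtraction of the two parts of the numerator.
positive : ℕ → ℕ
positive w = recℕ (π₁ (π₂ w)) (π₁ w) (λ v _ → caseℕ v 0 (λ n → n))

positiveᵉ : Expr n → Expr n
positiveᵉ w = recᵉ (fstᵉ (sndᵉ w)) (fstᵉ w) (predᵉ v₀)

private
  monus-correct : ∀ m n → recℕ n m (λ v _ → caseℕ v 0 (λ n → n)) ≡ m ∸ n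
  monus-correct m zero    = refl
  monus-correct m (suc n) = trans (case-pred (recℕ n m _))
    (trans (cong pred (monus-correct m n)) (ℕ.pred[m∸n]≡m∸[1+n] m n))
    where
    case-pred : ∀ v → caseℕ v 0 (λ n → n) ≡ pred v
    case-pred zero    = refl
    case-pred (suc v) = refl

  νℚ-unfold : ∀ w → ℚ.toℚᵘ (νℚ w) ℚᵘ.≃ ℚᵘ.mkℚᵘ (π₁ w ℤ.⊖ π₁ (π₂ w)) (π₂ (π₂ w))
  νℚ-unfold w = ℚ.toℚᵘ-fromℚᵘ (ℚᵘ.mkℚᵘ (π₁ w ℤ.⊖ π₁ (π₂ w)) (π₂ (π₂ w)))

positive-sound : ∀ w → positive w ≢ 0 → 0ℚ ℚ.< νℚ w
positive-sound w ≢0 = ℚ.toℚᵘ-cancel-< (ℚᵘ.<-respʳ-≃ (ℚᵘ.≃-sym (νℚ-unfold w)) (ℚᵘ.*<* lt))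
  where
  b<a : π₁ (π₂ w) < π₁ w
  b<a = ℕ.≰⇒> λ a≤b → ≢0 (trans (monus-correct (π₁ w) (π₁ (π₂ w))) (ℕ.m≤n⇒m∸n≡0 a≤b))
  lt : + 0 ℤ.* + suc (π₂ (π₂ w)) ℤ.< (π₁ w ℤ.⊖ π₁ (π₂ w)) ℤ.* + 1
  lt = subst (+ 0 ℤ.<_) (sym (ℤ.*-identityʳ _))
    (subst (ℤ._< (π₁ w ℤ.⊖ π₁ (π₂ w))) (ℤ.n⊖n≡0 (π₁ (π₂ w))) (ℤ.⊖-monoˡ-< (π₁ (π₂ w)) b<a))

positive-complete : ∀ w → 0ℚ ℚ.< νℚ w → positive w ≢ 0
positive-complete w 0<w ≡0 with ℚᵘ.<-respʳ-≃ (νℚ-unfold w) (ℚ.toℚᵘ-mono-< 0<w)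
... | ℚᵘ.*<* lt = ℤ.<⇒≱ (subst (+ 0 ℤ.<_) (ℤ.*-identityʳ _) lt)
  (subst ((π₁ w ℤ.⊖ π₁ (π₂ w)) ℤ.≤_) (ℤ.n⊖n≡0 (π₁ (π₂ w))) (ℤ.⊖-monoˡ-≤ (π₁ (π₂ w)) a≤b))
  where
  a≤b : π₁ w ≤ π₁ (π₂ w)
  a≤b = ℕ.m∸n≡0⇒m≤n (trans (sym (monus-correct (π₁ w) (π₁ (π₂ w)))) ≡0)

-- Sequences from programs, and names in Sierpiński space

unaryᶜ : Expr 1 → Code
unaryᶜ e = compᶜ (compile e) (pairᶜ idᶜ zeroᶜ)

unary⇓ : ∀ {o} e → Total o (unaryᶜ e) (λ n → ⟦ e ⟧ o (n ∷ []))
unary⇓ e n = compᶜ (pairᶜ (idᵗ n) zeroᶜ) (compile⇓ e (n ∷ []))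

does-sound : {P : Set ℓ} (D : Dec P) → does D ≡ true → P
does-sound (yes p) _ = p

⊩𝕊-intro : ∀ {φ} b → (b ≡ true → ∃[ n ] φ n ≢ 0) → (∀ n → φ n ≢ 0 → b ≡ true) → φ ⊩𝕊 b
⊩𝕊-intro {φ} true  h _ = let n , ≢0 = h refl in ⊩⊤ λ e → ≢0 (e n)
⊩𝕊-intro {φ} false _ h = ⊩⊥ λ n → zeros n
  where
  zeros : φ ≗ const 0
  zeros n with φ n ℕ.≟ 0
  ... | yes eq = eq
  ... | no ≢0 with () ← h n ≢0

⊩𝕊-nonzero : ExcludedMiddle _ → ∀ {φ} → φ ⊩𝕊 true → ∃[ n ] φ n ≢ 0
⊩𝕊-nonzero lem {φ} (⊩⊤ ≢0) = decidable-stable lem λ none →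
  ≢0 λ n → decidable-stable (φ n ℕ.≟ 0) λ φn≢0 → none (n , φn≢0)

-- Open balls and neighbourhoods in a computable metric space

module _ (M : ComputableMetricSpace c ℓ) where
  open ComputableMetricSpace M

  near-sym : ∀ {x y q} → d x y <ℝ fromℚ q → d y x <ℝ fromℚ q
  near-sym {x} {y} {q} h = <ℝ-≤ℝ-resp {d y x} {d x y} {fromℚ q} {fromℚ q} (proj₁ (d-sym y x)) h id

  near-trans : ∀ {x y z a b} → d x y <ℝ fromℚ a → d y z <ℝ fromℚ b → d x z <ℝ fromℚ (a ℚ.+ b)
  near-trans {x} {y} {z} = +ℝ-<-fromℚ {d x y} {d y z} {d x z} (d-triangle x y z)

  near-trans-2⁻ : ∀ k {x y z} → d x y <ℝ fromℚ (2⁻ suc k) → d y z <ℝ fromℚ (2⁻ suc k) →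
                  d x z <ℝ fromℚ (2⁻ k)
  near-trans-2⁻ k {x} {y} {z} h h′ = subst (λ q → d x z <ℝ fromℚ q) (2⁻-halves k) (near-trans h h′)

  dense : ∀ x k → ∃[ n ] d x (a n) <ℝ fromℚ (2⁻ k)
  dense x k = a-dense x (2⁻ k) (0<2⁻ k)

  near-mono : ∀ {k l x y} → k ≤ l → d x y <ℝ fromℚ (2⁻ l) → d x y <ℝ fromℚ (2⁻ k)
  near-mono {x = x} {y} k≤l h = <ℝ-fromℚ-mono {d x y} h (2⁻-antimono k≤l)

  -- The bound between members of the sequence survives in the limit: if the cut reached 2⁻ i,
  -- roundedness would put some r > 2⁻ i into it, and r - 2⁻ i leaves room for the distance from a
  -- late member to y.
  CauchyName-near : ∀ {p y} → CauchyName p y → ∀ i → d (a (p i)) y ≤ℝ fromℚ (2⁻ i)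
  CauchyName-near {p} {y} (fast , lim) i {q} q∈ = ℚ.≰⇒> λ 2⁻i≤q →
    let r , q<r , r∈ = ℝ.rounded (d (a (p i)) y) q∈
        2⁻i<r = ℚ.≤-<-trans 2⁻i≤q q<r
        N , near = lim (r ℚ.- 2⁻ i) (0<-difference 2⁻i<r)
        k = suc i ℕ.⊔ N
    in  <ℝ-fromℚ⇒∉ (d (a (p i)) y)
          (subst (λ s → d (a (p i)) y <ℝ fromℚ s) (+-difference (2⁻ i) r)
            (+ℝ-≤-<-fromℚ {d (a (p i)) (a (p k))} {d (a (p k)) y} {d (a (p i)) y}
              (d-triangle _ _ _) (fast i k (ℕ.m≤m⊔n (suc i) N)) (near k (ℕ.m≤n⊔m (suc i) N))))
          r∈

  CauchyName-near-< : ∀ {p y i k} → CauchyName p y → k < i → d (a (p i)) y <ℝ fromℚ (2⁻ k)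
  CauchyName-near-< {p} {y} {i} {k} h k<i = ≤ℝ-fromℚ-< {d (a (p i)) y} (CauchyName-near h i)
    (ℚ.≤-<-trans (2⁻-antimono k<i) (2⁻-suc< k))

  near-⟶ : ∀ {s x} → (∀ i → d (s i) x ≤ℝ fromℚ (2⁻ i)) → s ⟶ x
  near-⟶ {s} {x} h ε 0<ε with 2⁻-archimedean ε 0<ε
  ... | N , 2⁻N<ε = N , λ i N≤i → ≤ℝ-fromℚ-< {d (s i) x} (h i) (ℚ.≤-<-trans (2⁻-antimono N≤i) 2⁻N<ε)

  near-CauchyName : ∀ {p y} → (∀ i → d (a (p i)) y <ℝ fromℚ (2⁻ suc i)) → CauchyName p y
  near-CauchyName {p} {y} h =
    (λ i k i<k → <ℝ-fromℚ⇒≤ℝ {d (a (p i)) (a (p k))}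
      (near-trans-2⁻ i (h i) (near-sym (near-mono (s≤s (ℕ.<⇒≤ i<k)) (h k))))) ,
    near-⟶ λ i → <ℝ-fromℚ⇒≤ℝ {d (a (p i)) y} (near-mono (ℕ.n≤1+n i) (h i))

  -- Arguments: s, u, v, k and j.  Non-zero iff s steps suffice to confirm d(a u, a v) < 2⁻ k - 2⁻ j; the lower
  -- bound -1, named by ⟪ 0 , ⟪ 1 , 0 ⟫ ⟫, imposes no condition.
  closeᵉ : Expr 5
  closeᵉ = callᵉ (runᵉ (lit 0))
    ( v₀
    ∷ lit ⌜ proj₁ d-enumerable ⌝
    ∷ pairᵉ (lit ⟪ 0 , ⟪ 1 , 0 ⟫ ⟫) (pairᵉ v₁ (pairᵉ v₂ (callᵉ (2⁻-differenceᵉ v₀ v₁) (v₃ ∷ v₄ ∷ []))))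
    ∷ lit 0
    ∷ [])

  private
    νℚ-minus-one : νℚ ⟪ 0 , ⟪ 1 , 0 ⟫ ⟫ ℚ.< 0ℚ
    νℚ-minus-one rewrite unpair-pair 0 ⟪ 1 , 0 ⟫ | unpair-pair 1 0 = ℚ.negative⁻¹ (ℚ.- 1ℚ)

    close-input : ∀ o t u v k j → ⟪ t , ⟪ u , ⟪ v , ⟦ 2⁻-differenceᵉ v₀ v₁ ⟧ o (k ∷ j ∷ []) ⟫ ⟫ ⟫ ≡
                    ⟪ t , ⟪ u , ⟪ v , 2⁻-difference k j ⟫ ⟫ ⟫
    close-input o t u v k j = cong (λ w → ⟪ t , ⟪ u , ⟪ v , w ⟫ ⟫ ⟫) (2⁻-differenceᵉ-correct {o} k j)

  closeᵉ-sound : ∀ {o} s u v k j → ⟦ closeᵉ ⟧ o (s ∷ u ∷ v ∷ k ∷ j ∷ []) ≢ 0 →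
                 d (a u) (a v) <ℝ fromℚ (νℚ (2⁻-difference k j))
  closeᵉ-sound {o} s u v k j ≢0 = proj₂ (Equivalence.from (spec _ _ _ _) (pred out ,
    subst₂ (λ c n → const 0 ⊢ c [ n ]⇓ pred out) (machine-⌜⌝ c₀) (close-input o ⟪ 0 , ⟪ 1 , 0 ⟫ ⟫ u v k j)
      (runᵉ-sound o (lit 0) 0 ⌜ c₀ ⌝ _ s (halts _ refl ≢0))))
    where
    c₀ = proj₁ d-enumerable
    spec = proj₂ d-enumerable
    out = ⟦ closeᵉ ⟧ o (s ∷ u ∷ v ∷ k ∷ j ∷ [])
    halts : ∀ w → out ≡ w → w ≢ 0 → out ≡ suc (pred out)
    halts zero    eq ≢0 = ⊥-elim (≢0 refl)
    halts (suc w) eq _  = trans eq (cong suc (cong pred (sym eq)))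

  closeᵉ-complete : ∀ {o} u v k j → d (a u) (a v) <ℝ fromℚ (νℚ (2⁻-difference k j)) →
                    ∃[ s ] ⟦ closeᵉ ⟧ o (s ∷ u ∷ v ∷ k ∷ j ∷ []) ≢ 0
  closeᵉ-complete {o} u v k j h =
    let y , t = Equivalence.to (spec ⟪ 0 , ⟪ 1 , 0 ⟫ ⟫ u v (2⁻-difference k j)) (bounded-below , h)
        s , eq = runᵉ-complete o (lit 0) 0 ⌜ c₀ ⌝ _ (subst₂ (λ c n → const 0 ⊢ c [ n ]⇓ y)
                   (sym (machine-⌜⌝ c₀)) (sym (close-input o ⟪ 0 , ⟪ 1 , 0 ⟫ ⟫ u v k j)) t)
    in  s , λ eq₀ → ℕ.1+n≢0 (trans (sym eq) eq₀)
    where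
    c₀ = proj₁ d-enumerable
    spec = proj₂ d-enumerable
    bounded-below : fromℚ (νℚ ⟪ 0 , ⟪ 1 , 0 ⟫ ⟫) <ℝ d (a u) (a v)
    bounded-below = νℚ ⟪ 0 , ⟪ 1 , 0 ⟫ ⟫ , d-nonneg (a u) (a v) νℚ-minus-one , ℚ.<-irrefl refl

  -- Run with oracle ⟨ const ⟪ k , u ⟫ , p ⟩, where p names y: since d(a (p j), y) ≤ 2⁻ j, the ball of
  -- radius 2⁻ k around a u contains y iff d(a (p j), a u) < 2⁻ k - 2⁻ j for some j.
  ballᵉ : Expr 1
  ballᵉ = callᵉ closeᵉ
    (sndᵉ v₀ ∷ oddᵉ (fstᵉ v₀) ∷ sndᵉ (oracleᵉ (lit 0)) ∷ fstᵉ (oracleᵉ (lit 0)) ∷ fstᵉ v₀ ∷ [])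

  -- The code is the same for all balls; radius and centre sit in the oracle. So names of balls are
  -- produced uniformly from k and u.
  ballFunction : ℕ → ℕ → PartialFunction
  ballFunction k u = programWithOracle (unaryᶜ ballᵉ) (const ⟪ k , u ⟫)

  private
    ball-output : ∀ k u p n → let o = ⟨ const ⟪ k , u ⟫ , p ⟩ in
      ⟦ ballᵉ ⟧ o (n ∷ []) ≡ ⟦ closeᵉ ⟧ o (π₂ n ∷ p (π₁ n) ∷ u ∷ k ∷ π₁ n ∷ [])
    ball-output k u p n = trans
      (cong (λ x → ⟦ closeᵉ ⟧ o (π₂ n ∷ x ∷ π₂ ⟪ k , u ⟫ ∷ π₁ ⟪ k , u ⟫ ∷ π₁ n ∷ []))
        (oddᵉ-correct (const ⟪ k , u ⟫) p (π₁ n)))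
      (cong₂ (λ x y → ⟦ closeᵉ ⟧ o (π₂ n ∷ p (π₁ n) ∷ x ∷ y ∷ π₁ n ∷ [])) (π₂-pair k u) (π₁-pair k u))
      where o = ⟨ const ⟪ k , u ⟫ , p ⟩

    ball-sound : ∀ {k u p y} n → CauchyName p y → ⟦ ballᵉ ⟧ ⟨ const ⟪ k , u ⟫ , p ⟩ (n ∷ []) ≢ 0 →
                 d y (a u) <ℝ fromℚ (2⁻ k)
    ball-sound {k} {u} {p} {y} n p⊩y ≢0 =
      subst (λ q → d y (a u) <ℝ fromℚ q)
        (trans (ℚ.+-comm (2⁻ π₁ n) _) (νℚ-2⁻-difference k (π₁ n)))
        (+ℝ-≤-<-fromℚ {d y (a (p (π₁ n)))} {d (a (p (π₁ n))) (a u)} {d y (a u)} (d-triangle _ _ _)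
          (CauchyName-near p⊩y (π₁ n) ∘ proj₁ (d-sym y _))
          (closeᵉ-sound (π₂ n) (p (π₁ n)) u k (π₁ n) (≢0 ∘ trans (ball-output k u p n))))

    ball-complete : ∀ {k u p y} → CauchyName p y → d y (a u) <ℝ fromℚ (2⁻ k) →
                    ∃[ n ] ⟦ ballᵉ ⟧ ⟨ const ⟪ k , u ⟫ , p ⟩ (n ∷ []) ≢ 0
    ball-complete {k} {u} {p} {y} p⊩y h@(q , q<2⁻k , q∉) =
      let N , 2⁻N<ε = 2⁻-archimedean (2⁻ k ℚ.- q) (0<-difference q<2⁻k)
          -- The error 2⁻ j is paid twice, in passing from y to a (p j) and in the reduced radius 2⁻
          -- k - 2⁻ j. With j = N + 1 the total is 2⁻ N, which is less than the slack 2⁻ k - q.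
          j = suc N
          s , ≢0 = closeᵉ-complete (p j) u k j (close N 2⁻N<ε)
      in  ⟪ j , s ⟫ , ≢0 ∘ trans (sym (trans (ball-output k u p ⟪ j , s ⟫)
            (cong₂ (λ j s → ⟦ closeᵉ ⟧ ⟨ const ⟪ k , u ⟫ , p ⟩ (s ∷ p j ∷ u ∷ k ∷ j ∷ []))
              (π₁-pair j s) (π₂-pair j s))))
      where
      close : ∀ N → 2⁻ N ℚ.< 2⁻ k ℚ.- q →
              d (a (p (suc N))) (a u) <ℝ fromℚ (νℚ (2⁻-difference k (suc N)))
      close N 2⁻N<ε = subst (λ t → d (a (p j)) (a u) <ℝ fromℚ t) (+-difference (2⁻ j) r)
        (+ℝ-≤-<-fromℚ {d (a (p j)) y} {d y (a u)} {d (a (p j)) (a u)} (d-triangle _ _ _)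
          (CauchyName-near p⊩y j) (q , q<w , q∉))
        where
        j = suc N
        r = νℚ (2⁻-difference k j)
        w = r ℚ.- 2⁻ j

        2⁻N+w : 2⁻ N ℚ.+ w ≡ 2⁻ k
        2⁻N+w = begin
          2⁻ N ℚ.+ w               ≡⟨ cong (ℚ._+ w) (2⁻-halves N) ⟨
          2⁻ j ℚ.+ 2⁻ j ℚ.+ w      ≡⟨ ℚ.+-assoc (2⁻ j) (2⁻ j) w ⟩
          2⁻ j ℚ.+ (2⁻ j ℚ.+ w)    ≡⟨ cong (2⁻ j ℚ.+_) (+-difference (2⁻ j) r) ⟩
          2⁻ j ℚ.+ r               ≡⟨ ℚ.+-comm (2⁻ j) r ⟩
          r ℚ.+ 2⁻ j               ≡⟨ νℚ-2⁻-difference k j ⟩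
          2⁻ k                     ∎
          where open ≡-Reasoning

        q<w : q ℚ.< w
        q<w = ℚ.≰⇒> λ w≤q → ℚ.<-irrefl refl (ℚ.<-≤-trans
          (subst (2⁻ N ℚ.+ q ℚ.<_) (trans (ℚ.+-comm _ q) (trans (+-difference q (2⁻ k)) (sym 2⁻N+w)))
            (ℚ.+-monoˡ-< q 2⁻N<ε))
          (ℚ.+-monoʳ-≤ (2⁻ N) w≤q))

  module _ (lem : ∀ {ℓ} → ExcludedMiddle ℓ) where
    open Classical lem

    private
      X = metricSpace M

    opaque
      -- A name of x that converges faster than required leaves room to continue each of its prefixes as a
      -- name of any sufficiently close y.
      open-neighbourhood : ∀ (U : Open X) {x} → x ∈ ⟦_⟧ᵒ X U →
                           ∃[ k ] (∀ y → d x y <ℝ fromℚ (2⁻ k) → y ∈ ⟦_⟧ᵒ X U)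
      open-neighbourhood U {x} x∈U = go (real p x p⊩x (_ , refl))
        where
        F : PartialFunction
        F = proj₁ (ContinuousMap.continuous U)

        cont : ContinuousPartial F
        cont = proj₁ (proj₂ (ContinuousMap.continuous U))

        real : F Realizes ⌊_⌋ {X = X} {Y = 𝕊} (ContinuousMap.map U)
        real = proj₂ (proj₂ (ContinuousMap.continuous U))

        p : Baire
        p i = proj₁ (dense x (suc (suc i)))

        near : ∀ i → d (a (p i)) x <ℝ fromℚ (2⁻ suc (suc i))
        near i = near-sym (proj₂ (dense x (suc (suc i))))

        p⊩x : CauchyName p x
        p⊩x = near-CauchyName λ i → near-mono (ℕ.n≤1+n (suc i)) (near i)

        go : Σ[ e ∈ p ∈ PartialFunction.dom F ] ∃[ b ]
               PartialFunction.apply F p e ⊩𝕊 b × ContinuousMap.to U x ≡ b →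
             ∃[ k ] (∀ y → d x y <ℝ fromℚ (2⁻ k) → y ∈ ⟦_⟧ᵒ X U)
        -- For i < m, both a (p i) and y are then within 2⁻ (i + 2) of x, hence within 2⁻ (i + 1) of
        -- each other, as `near-CauchyName` requires.
        go (e , b , ⊩b , eq) = suc m , inside
          where
          accepted : ∃[ n ] PartialFunction.apply F p e n ≢ 0
          accepted = ⊩𝕊-nonzero lem (subst (PartialFunction.apply F p e ⊩𝕊_) (trans (sym eq) x∈U) ⊩b)

          k m : ℕ
          k = proj₁ accepted
          m = proj₁ (cont p e (suc k))

          inside : ∀ y → d x y <ℝ fromℚ (2⁻ suc m) → y ∈ ⟦_⟧ᵒ X U
          inside y xy = conclude (real q y q⊩y (_ , refl))
            where
            choose : ∀ i → Dec (i < m) → ℕ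
            choose i (yes _) = p i
            choose i (no _)  = proj₁ (dense y (suc i))

            q : Baire
            q i = choose i (i ℕ.<? m)

            q⊩y : CauchyName q y
            q⊩y = near-CauchyName λ i → close i (i ℕ.<? m)
              where
              close : ∀ i D → d (a (choose i D)) y <ℝ fromℚ (2⁻ suc i)
              close i (yes i<m) = near-trans-2⁻ (suc i) (near i) (near-mono (s≤s i<m) xy)
              close i (no _)    = near-sym (proj₂ (dense y (suc i)))

            agree : Agree m p q
            agree i i<m = same (i ℕ.<? m)
              where
              same : ∀ D → p i ≡ choose i D
              same (yes _)  = refl
              same (no i≮m) = ⊥-elim (i≮m i<m)

            conclude : Σ[ e ∈ q ∈ PartialFunction.dom F ] ∃[ b ]
                         PartialFunction.apply F q e ⊩𝕊 b × ContinuousMap.to U y ≡ b →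
                       y ∈ ⟦_⟧ᵒ X U
            conclude (e′ , true  , _    , eq) = eq
            conclude (e′ , false , ⊩⊥ z , _)  = ⊥-elim (proj₂ accepted
              (trans (proj₂ (cont p e (suc k)) q e′ agree k ℕ.≤-refl) (z k)))

    ballMembership : ℕ → ℕ → Func (RepresentedSpace.setoid X) (RepresentedSpace.setoid 𝕊)
    ballMembership k u = record
      { to   = λ y → does (lem {P = d y (a u) <ℝ fromℚ (2⁻ k)})
      ; cong = λ y≈y′ → does-⇔ (mk⇔ (move y≈y′) (move (≈-sym y≈y′))) lem lem
      }
      where
      open Setoid setoid using () renaming (refl to ≈-refl; sym to ≈-sym)
      move : ∀ {y y′} → y ≈ y′ → d y (a u) <ℝ fromℚ (2⁻ k) → d y′ (a u) <ℝ fromℚ (2⁻ k)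
      move {y} {y′} y≈y′ h = <ℝ-≤ℝ-resp {d y′ (a u)} {d y (a u)} {fromℚ (2⁻ k)} {fromℚ (2⁻ k)}
        (proj₂ (d-cong y≈y′ ≈-refl)) h id

    ballFunction-realizes : ∀ k u → ballFunction k u Realizes ⌊_⌋ {X = X} {Y = 𝕊} (ballMembership k u)
    ballFunction-realizes k u p y p⊩y _ =
      (_ , unary⇓ ballᵉ) , _ ,
      ⊩𝕊-intro _ (λ eq → ball-complete p⊩y (does-sound lem eq))
                 (λ n ≢0 → dec-true lem (ball-sound n p⊩y ≢0)) ,
      refl

    openBall : ℕ → ℕ → Open X
    openBall k u = record
      { map        = ballMembership k u
      ; continuous = ballFunction k u , programWithOracle-continuous _ _ , ballFunction-realizes k u
      }

    openBall-name : ∀ k u → RepresentedSpace._⊩_ (𝒪 X) (0^ ⌜ unaryᶜ ballᵉ ⌝ ▹1 const ⟪ k , u ⟫) (openBall k u)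
    openBall-name k u = ⌜ unaryᶜ ballᵉ ⌝ , const ⟪ k , u ⟫ , (λ _ → refl) , ballFunction k u ,
      programWithOracle-computes _ _ , ballFunction-realizes k u

-- The Dirac measure and its names

bit : Bool → ℝ
bit true  = fromℚ 1ℚ
bit false = 0ℝ

bit-cong : ∀ {b b′} → b ≡ b′ → bit b ≈ℝ bit b′
bit-cong refl = id , id

0≤bit : ∀ b → 0ℝ ≤ℝ bit b
0≤bit true  q<0 = ℚ.<-trans q<0 (ℚ.positive⁻¹ 1ℚ)
0≤bit false = id

-- Countable additivity at a point: at most one of the disjoint sets contains it, so the partial
-- sums jump from 0 to 1 at most once.
SumsTo-bit : (b : ℕ → Bool) (s : Bool) → (∀ i → b i ≡ true → s ≡ true) →
             (s ≡ true → ∃[ i ] b i ≡ true) → (∀ {i j} → b i ≡ true → b j ≡ true → i ≡ j) →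
             SumsTo (bit ∘ b) (bit s)
SumsTo-bit b s upper attained unique = sums≤ s upper , least s attained
  where
  0≤sum : ∀ n → 0ℝ ≤ℝ partialSum (bit ∘ b) n
  0≤sum zero    = id
  0≤sum (suc n) = fromℚ-≤-+ℝ {0ℚ} {0ℚ} {partialSum (bit ∘ b) n} {bit (b n)} (0≤sum n) (0≤bit (b n))

  sum≤0 : ∀ n → (∀ i → i < n → b i ≡ false) → partialSum (bit ∘ b) n ≤ℝ 0ℝ
  sum≤0 zero    _ = id
  sum≤0 (suc n) h = +ℝ-≤-fromℚ {partialSum (bit ∘ b) n} {bit (b n)} {0ℚ} {0ℚ}
    (sum≤0 n (λ i i<n → h i (ℕ.m<n⇒m<1+n i<n))) (proj₁ (bit-cong (h n ℕ.≤-refl)))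

  sum≤1 : ∀ n → partialSum (bit ∘ b) n ≤ℝ fromℚ 1ℚ
  sum≤1 zero q<0 = ℚ.<-trans q<0 (ℚ.positive⁻¹ 1ℚ)
  sum≤1 (suc n) with b n in eq
  ... | true  = +ℝ-≤-fromℚ {partialSum (bit ∘ b) n} {fromℚ 1ℚ} {0ℚ} {1ℚ} (sum≤0 n others) id
    where
    others : ∀ i → i < n → b i ≡ false
    others i i<n with b i in eq′
    ... | true  = ⊥-elim (ℕ.<⇒≢ i<n (unique eq′ eq))
    ... | false = refl
  ... | false = +ℝ-≤-fromℚ {partialSum (bit ∘ b) n} {0ℝ} {1ℚ} {0ℚ} (sum≤1 n) id

  sums≤ : ∀ s → (∀ i → b i ≡ true → s ≡ true) → ∀ n → partialSum (bit ∘ b) n ≤ℝ bit s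
  sums≤ true  _ n = sum≤1 n
  sums≤ false h n = sum≤0 n λ i _ → none i
    where
    none : ∀ i → b i ≡ false
    none i with b i in eq
    ... | false = refl
    ... | true with () ← h i eq

  least : ∀ s → (s ≡ true → ∃[ i ] b i ≡ true) → ∀ y → (∀ n → partialSum (bit ∘ b) n ≤ℝ y) → bit s ≤ℝ y
  least false _ y h = h 0
  least true  f y h = let i , eq = f refl in
    h (suc i) ∘ fromℚ-≤-+ℝ {0ℚ} {1ℚ} {partialSum (bit ∘ b) i} {bit (b i)}
      (0≤sum i) (proj₂ (bit-cong eq))

-- An acceptance once observed is remembered, because names in `ℝ<` must be non-decreasing.
seen : (ℕ → ℕ) → ℕ → ℕ
seen τ k = recℕ k 0 (λ v j → caseℕ v (τ j) (λ _ → 1))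

module _ (τ : ℕ → ℕ) where
  seen-suc : ∀ k → seen τ k ≢ 0 → seen τ (suc k) ≢ 0
  seen-suc k ≢0 with seen τ k
  ... | zero  = λ _ → ≢0 refl
  ... | suc _ = λ ()

  seen-mono : ∀ {j k} → j ≤ k → seen τ j ≢ 0 → seen τ k ≢ 0
  seen-mono j≤k ≢0 = go (ℕ.≤⇒≤′ j≤k)
    where
    go : ∀ {k} → _ ℕ.≤′ k → seen τ k ≢ 0
    go ℕ.≤′-refl     = ≢0
    go (ℕ.≤′-step {k} h) = seen-suc k (go h)

  seen-complete : ∀ k → τ k ≢ 0 → seen τ (suc k) ≢ 0
  seen-complete k ≢0 with seen τ k
  ... | zero  = ≢0
  ... | suc _ = λ ()

  seen-sound : ∀ k → seen τ k ≢ 0 → ∃[ j ] τ j ≢ 0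
  seen-sound zero    ≢0 = ⊥-elim (≢0 refl)
  seen-sound (suc k) ≢0 with seen τ k in eq
  ... | zero  = k , ≢0
  ... | suc _ = seen-sound k (λ eq₀ → ℕ.1+n≢0 (trans (sym eq) eq₀))

oneℚ : ℕ
oneℚ = ⟪ 1 , ⟪ 0 , 0 ⟫ ⟫

νℚ-oneℚ : νℚ oneℚ ≡ 1ℚ
νℚ-oneℚ rewrite unpair-pair 1 ⟪ 0 , 0 ⟫ | unpair-pair 0 0 = refl

-- The parameter is n for an oracle ⟨ q , 0^ n ▹1 r ⟩; the result is the oracle ⟨ r , q ⟩.
swapᵉ : Expr 2
swapᵉ = interleaveᵉ tailᵉ (evenᵉ v₀)

swap-correct : ∀ {q p n r} → p ≗ 0^ n ▹1 r → (λ i → ⟦ swapᵉ ⟧ ⟨ q , p ⟩ (i ∷ n ∷ [])) ≗ ⟨ r , q ⟩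
swap-correct {q} {p} {n} e i = trans (interleaveᵉ-correct ⟨ q , p ⟩ tailᵉ (evenᵉ v₀) n i)
  (⟨⟩-cong (tail-correct {q} {n = n} e) (evenᵉ-correct q p) i)

-- For j = ⟪ i , s ⟫, whether the machine with number n has halted after s steps on input i with a
-- non-zero output.
acceptsᵉ : Expr 2
acceptsᵉ = predᵉ (callᵉ (runᵉ swapᵉ) (sndᵉ v₀ ∷ v₁ ∷ fstᵉ v₀ ∷ v₁ ∷ []))

diracᵉ : Expr 2
diracᵉ = ifzeroᵉ (recᵉ v₀ (lit 0) (ifzeroᵉ v₀ (callᵉ acceptsᵉ (v₁ ∷ v₃ ∷ [])) (lit 1))) (lit 0) (lit oneℚ)

diracᶜ : Code
diracᶜ = compᶜ (compile diracᵉ) (pairᶜ idᶜ (pairᶜ tagᶜ zeroᶜ))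

dirac⇓ : ∀ {q p n r} → p ≗ 0^ n ▹1 r → Total ⟨ q , p ⟩ diracᶜ (λ k → ⟦ diracᵉ ⟧ ⟨ q , p ⟩ (k ∷ n ∷ []))
dirac⇓ {n = n} e k = compᶜ (pairᶜ (idᵗ k) (pairᶜ (tag⇓ e) zeroᶜ)) (compile⇓ diracᵉ (k ∷ n ∷ []))

module _ (lem : ∀ {ℓ} → ExcludedMiddle ℓ) where
  open Classical lem

  bit-name : ∀ τ b → (b ≡ true → ∃[ j ] τ j ≢ 0) → (∀ j → τ j ≢ 0 → b ≡ true) →
             RepresentedSpace._⊩_ ℝ< (λ k → caseℕ (seen τ k) 0 (λ _ → oneℚ)) (bit b)
  bit-name τ b complete sound = mono , upper b sound , least b complete
    where
    φ : Baire
    φ k = caseℕ (seen τ k) 0 (λ _ → oneℚ)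

    value : ∀ v → 0ℚ ℚ.≤ νℚ (caseℕ v 0 (λ _ → oneℚ)) × νℚ (caseℕ v 0 (λ _ → oneℚ)) ℚ.≤ 1ℚ
    value zero    = ℚ.≤-refl , ℚ.nonNegative⁻¹ 1ℚ
    value (suc _) = subst (0ℚ ℚ.≤_) (sym νℚ-oneℚ) (ℚ.nonNegative⁻¹ 1ℚ) , ℚ.≤-reflexive νℚ-oneℚ

    value-1 : ∀ {v} → v ≢ 0 → νℚ (caseℕ v 0 (λ _ → oneℚ)) ≡ 1ℚ
    value-1 {zero}  ≢0 = ⊥-elim (≢0 refl)
    value-1 {suc _} _  = νℚ-oneℚ

    mono : ∀ {i j} → i ≤ j → νℚ (φ i) ℚ.≤ νℚ (φ j)
    mono {i} {j} i≤j with seen τ i ℕ.≟ 0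
    ... | yes eq = subst (λ v → νℚ (caseℕ v 0 (λ _ → oneℚ)) ℚ.≤ νℚ (φ j)) (sym eq) (proj₁ (value (seen τ j)))
    ... | no ≢0  = subst (νℚ (φ i) ℚ.≤_) (sym (value-1 (seen-mono τ i≤j ≢0))) (proj₂ (value (seen τ i)))

    upper : ∀ b → (∀ j → τ j ≢ 0 → b ≡ true) → ∀ k → fromℚ (νℚ (φ k)) ≤ℝ bit b
    upper true  _ k = fromℚ-mono (proj₂ (value (seen τ k)))
    upper false h k with seen τ k in eq
    ... | zero  = id
    ... | suc _ with () ← (let j , ≢0 = seen-sound τ k (λ eq₀ → ℕ.1+n≢0 (trans (sym eq) eq₀)) in h j ≢0)

    least : ∀ b → (b ≡ true → ∃[ j ] τ j ≢ 0) → ∀ y → (∀ k → fromℚ (νℚ (φ k)) ≤ℝ y) → bit b ≤ℝ y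
    least false _ y h = h 0
    least true  f y h = let j , ≢0 = f refl in
      subst (λ q → fromℚ q ≤ℝ y) (value-1 (seen-complete τ j ≢0)) (h (suc j))

  module _ (X : RepresentedSpace c ℓ ℓ′) where
    private
      module X = RepresentedSpace X

    module _ (x : X.Carrier) where

      diracMeasure : FiniteBorelMeasure X
      diracMeasure = record
        { measure  = λ {B} _ → bit (does (lem {P = x ∈ B}))
        ; m-cong   = λ _ _ (B⊆B′ , B′⊆B) → bit-cong (does-⇔ (mk⇔ B⊆B′ B′⊆B) lem lem)
        ; nonneg   = λ {B} _ → 0≤bit (does (lem {P = x ∈ B}))
        ; empty    = λ _ B-empty → bit-cong (dec-false lem (B-empty x))
        ; additive = λ {B} _ disjoint → SumsTo-bit (λ i → does (lem {P = x ∈ B i})) _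
            (λ i eq → dec-true lem (i , does-sound lem eq))
            (λ eq → let i , x∈ = does-sound lem eq in i , dec-true lem x∈)
            (λ {i} {j} eq eq′ → same B disjoint i j (does-sound lem eq) (does-sound lem eq′))
        }
        where
        same : (B : ℕ → Pred X.Carrier _) → (∀ {i j} → i ≢ j → Empty (B i ∩ B j)) →
               ∀ i j → x ∈ B i → x ∈ B j → i ≡ j
        same B disjoint i j x∈ x∈′ with i ℕ.≟ j
        ... | yes eq = eq
        ... | no i≢j = ⊥-elim (disjoint i≢j x (x∈ , x∈′))

      diracMap : Func (RepresentedSpace.setoid (𝒪 X)) (RepresentedSpace.setoid ℝ<)
      diracMap = record
        { to   = λ U → bit (ContinuousMap.to U x)
        ; cong = λ U≈V → bit-cong (U≈V x)
        }

      -- If U has machine m and oracle r, that machine with oracle ⟨ r , g ⟩ semidecides x ∈ U. The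
      -- lower bounds of the measure are 0 until acceptance is seen and 1 afterwards.
      diracFunction-realizes : ∀ {g} → g X.⊩ x →
        programWithOracle diracᶜ g Realizes ⌊_⌋ {X = 𝒪 X} {Y = ℝ<} diracMap
      diracFunction-realizes {g} g⊩x u U (m , r , e , F , comp , real) _
        with real g x g⊩x (_ , refl)
      ... | d , b , Fg⊩b , eq =
        (_ , dirac⇓ {n = m} e) , bit (ContinuousMap.to U x) ,
        bit-name τ _ (λ Ux → halts Fg⊩b (trans (sym eq) Ux)) (λ j ≢0 → trans eq (accepted Fg⊩b j ≢0)) ,
        id , id
        where
        o = ⟨ g , u ⟩
        out = PartialFunction.apply F g d

        τ : ℕ → ℕ
        τ j = ⟦ acceptsᵉ ⟧ o (j ∷ m ∷ [])

        halts : ∀ {b} → out ⊩𝕊 b → b ≡ true → ∃[ j ] τ j ≢ 0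
        halts ⊩b refl with ⊩𝕊-nonzero lem ⊩b
        ... | i , ≢0 with runᵉ-complete o swapᵉ m m i
                            (⇓-cong (λ k → sym (swap-correct {n = m} e k)) (comp g d i))
        ...   | s , halted = ⟪ i , s ⟫ , λ eq₀ → ≢0 (trans (sym (cong (λ v → caseℕ v 0 id) halted))
                (trans (cong₂ (λ i s → caseℕ (⟦ runᵉ swapᵉ ⟧ o (s ∷ m ∷ i ∷ m ∷ [])) 0 id)
                  (sym (π₁-pair i s)) (sym (π₂-pair i s))) eq₀))

        accepted : ∀ {b} → out ⊩𝕊 b → ∀ j → τ j ≢ 0 → b ≡ true
        accepted (⊩⊤ _) j _ = refl
        accepted (⊩⊥ z) j ≢0 with ⟦ runᵉ swapᵉ ⟧ o (π₂ j ∷ m ∷ π₁ j ∷ m ∷ []) in eq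
        ... | zero        = ⊥-elim (≢0 refl)
        ... | suc zero    = ⊥-elim (≢0 refl)
        ... | suc (suc v) with () ← trans (sym (z (π₁ j))) (⇓-functional (comp g d (π₁ j))
              (⇓-cong (swap-correct {n = m} e) (runᵉ-sound o swapᵉ m m (π₁ j) (π₂ j) eq)))

      dirac : RepresentedSpace.Carrier (ℳ X)
      dirac = record
        { map        = diracMap
        ; continuous = let g , g⊩x = X.surjective x in
            programWithOracle diracᶜ g , programWithOracle-continuous _ _ , diracFunction-realizes g⊩x
        } , diracMeasure , λ U → bit-cong (agree (ContinuousMap.to U x) refl)
        where
        agree : ∀ b {b′} → b′ ≡ b → b′ ≡ does (lem {P = b′ ≡ true})
        agree true  eq = trans eq (sym (dec-true lem eq))
        agree false eq = trans eq (sym (dec-false lem λ eq′ → case trans (sym eq) eq′ of λ ()))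

      -- Only the oracle part depends on the point, so turning a name of x into a name of the
      -- measure amounts to prepending a constant.
      dirac-name : ∀ {g} → g X.⊩ x → RepresentedSpace._⊩_ (ℳ X) (0^ ⌜ diracᶜ ⌝ ▹1 g) dirac
      dirac-name {g} g⊩x = ⌜ diracᶜ ⌝ , g , (λ _ → refl) , programWithOracle diracᶜ g ,
        programWithOracle-computes _ _ , diracFunction-realizes g⊩x

-- Constructing a measure from a chosen point

identity : PartialFunction
identity = record
  { dom        = λ _ → ⊤
  ; dom-resp   = λ _ _ → tt
  ; apply      = λ p _ → p
  ; apply-cong = λ _ _ e → e
  }

identity-computable : Computable identity
identity-computable = oracleᶜ , λ _ _ _ → oracleᶜ

module _ (lem : ∀ {ℓ} → ExcludedMiddle ℓ) where
  open Classical lem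

  module _ (M : ComputableMetricSpace c ℓ) where
    open ComputableMetricSpace M
    open Setoid setoid using () renaming (refl to ≈-refl; sym to ≈-sym; trans to ≈-trans)
    private
      X = metricSpace M

    module _ (x : Carrier) where
      private
        -- The support has to be exhibited as a closed set, so {x} needs a realizer for its
        -- complement. Open sets are only required to be continuous, which permits deciding the
        -- distance to x by excluded middle: a name p of y differs from names of x iff some a (p i)
        -- is farther than 2⁻ i from x.
        far : ℕ → ℕ → ℕ
        far i u with does (lem {P = d (a u) x ≤ℝ fromℚ (2⁻ i)})
        ... | true  = 0
        ... | false = 1

        far-sound : ∀ i u → far i u ≢ 0 → ¬ d (a u) x ≤ℝ fromℚ (2⁻ i)
        far-sound i u ≢0 h with lem {P = d (a u) x ≤ℝ fromℚ (2⁻ i)}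
        ... | yes _ = ≢0 refl
        ... | no ¬h = ¬h h

        far-complete : ∀ i u → ¬ d (a u) x ≤ℝ fromℚ (2⁻ i) → far i u ≢ 0
        far-complete i u h with lem {P = d (a u) x ≤ℝ fromℚ (2⁻ i)}
        ... | yes h′ = ⊥-elim (h h′)
        ... | no _   = λ ()

        apart : Func (RepresentedSpace.setoid X) (RepresentedSpace.setoid 𝕊)
        apart = record
          { to   = λ y → does (lem {P = ¬ y ≈ x})
          ; cong = λ y≈z → does-⇔ (mk⇔ (λ y≉x z≈x → y≉x (≈-trans y≈z z≈x))
                                            (λ z≉x y≈x → z≉x (≈-trans (≈-sym y≈z) y≈x))) lem lem
          }

        apartFunction : PartialFunction
        apartFunction = record
          { dom        = λ _ → ⊤
          ; dom-resp   = λ _ _ → tt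
          ; apply      = λ p _ i → far i (p i)
          ; apply-cong = λ _ _ e i → cong (far i) (e i)
          }

        apart-realizes : apartFunction Realizes ⌊_⌋ {X = X} {Y = 𝕊} apart
        apart-realizes p y p⊩y _ = tt , does (lem {P = ¬ y ≈ x}) , ⊩𝕊-intro _ complete sound , refl
          where
          complete : does (lem {P = ¬ y ≈ x}) ≡ true → ∃[ i ] far i (p i) ≢ 0
          -- If no a (p i) is far from x, then p converges to x as well, and names are
          -- single-valued.
          complete eq = decidable-stable lem λ none → does-sound lem eq
            (RepresentedSpace.single-valued X p⊩y
              (proj₁ p⊩y , near-⟶ M λ i → decidable-stable lem λ h → none (i , far-complete i (p i) h)))

          sound : ∀ i → far i (p i) ≢ 0 → does (lem {P = ¬ y ≈ x}) ≡ true
          sound i ≢0 = dec-true lem λ y≈x → far-sound i (p i) ≢0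
            (CauchyName-near M (RepresentedSpace.⊩-resp X (λ _ → refl) y≈x p⊩y) i)

      singleton : Closed X
      singleton = record { complement = record
        { map        = apart
        ; continuous = apartFunction , (λ p _ n → n , λ q _ agree i i<n → cong (far i) (agree i i<n)) ,
                       apart-realizes
        } }

      singleton-≈ : ∀ {y} → y ∈ ⟦_⟧ᶜ X singleton → y ≈ x
      singleton-≈ h = decidable-stable lem λ y≉x → h (dec-true lem y≉x)

      dirac-support : IsSupport X (dirac lem X x) singleton
      dirac-support U = mk⇔
        (λ (y , y∈U , y∈S) → positive-bit
          (trans (sym (Func.cong (ContinuousMap.map U) (singleton-≈ y∈S))) y∈U))
        (λ h → x , bit-positive _ h , λ eq → does-sound lem eq ≈-refl)
        where
        positive-bit : ∀ {b} → b ≡ true → 0ℝ <ℝ bit b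
        positive-bit refl = 0ℚ , ℚ.positive⁻¹ 1ℚ , ℚ.<-irrefl refl

        bit-positive : ∀ b → 0ℝ <ℝ bit b → b ≡ true
        bit-positive true  _             = refl
        bit-positive false (q , q<0 , h) = ⊥-elim (h q<0)

      dirac-nonzero : NonZero X (dirac lem X x)
      dirac-nonzero zero-measure =
        let u , near = dense M x 0
            q , q∈ , q≮0 = Equivalence.to (dirac-support (openBall M lem 0 u))
                             (x , dec-true lem near , λ eq → does-sound lem eq ≈-refl)
        in  q≮0 (proj₁ (zero-measure (openBall M lem 0 u)) q∈)

      dirac-constructs : ∀ A → x ∈ ⟦_⟧ᶜ X A → Multifunction.graph (ConstructMeasure X) A (dirac lem X x)
      dirac-constructs A x∈A = (x , x∈A) , dirac-nonzero , singleton , dirac-support ,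
        λ y∈S y∈U → x∈A
          (trans (sym (Func.cong (ContinuousMap.map (Closed.complement A)) (singleton-≈ y∈S))) y∈U)

    -- The point x only shows that A is in the domain of choice; the measure sits at the point y
    -- that the realizer of choice returns.
    ConstructMeasure≤W-ClosedChoice : ConstructMeasure X ≤W ClosedChoice X
    ConstructMeasure≤W-ClosedChoice =
      program (unaryᶜ e) , identity , program-computable _ , identity-computable ,
      λ G G-realizes p A p⊩A (_ , (x , x∈A) , _) →
        let d , y , Gp⊩y , y∈A = G-realizes p A p⊩A (x , x∈A)
            o = ⟨ p , PartialFunction.apply G p d ⟩
            odd⊩y = RepresentedSpace.⊩-resp X (λ i → sym (oddᵉ-correct p _ i)) ≈-refl Gp⊩y
        in  ((tt , d) , _ , unary⇓ e) , dirac lem X y ,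
            RepresentedSpace.⊩-resp (ℳ X) {x = dirac lem X y} {dirac lem X y}
              (λ i → sym (nameᵉ-correct {o} ⌜ diracᶜ ⌝ (oddᵉ v₀) 0 i))
              (λ U → id , id) (dirac-name lem X y odd⊩y) ,
            dirac-constructs y A y∈A
      where
      e : Expr 1
      e = callᵉ (nameᵉ ⌜ diracᶜ ⌝ (oddᵉ v₀)) (v₀ ∷ lit 0 ∷ [])

-- Finding a point from a measure

module _ (M : ComputableMetricSpace c ℓ) where
  open ComputableMetricSpace M

  ballName : ℕ → ℕ → Baire
  ballName k u = 0^ ⌜ unaryᶜ (ballᵉ M) ⌝ ▹1 const ⟪ k , u ⟫

  -- With oracle ⟨ p , 0^ n ▹1 q ⟩ and parameter ⟪ n , ⟪ k , u ⟫ ⟫, the oracle ⟨ q , ballName k u ⟩.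
  applyᵉ : Expr 2
  applyᵉ = interleaveᵉ (callᵉ tailᵉ (v₀ ∷ fstᵉ v₁ ∷ []))
                       (callᵉ (nameᵉ ⌜ unaryᶜ (ballᵉ M) ⌝ v₁) (v₀ ∷ sndᵉ v₁ ∷ []))

  applyᵉ-correct : ∀ {p g n q} → g ≗ 0^ n ▹1 q → ∀ k u →
    (λ i → ⟦ applyᵉ ⟧ ⟨ p , g ⟩ (i ∷ ⟪ n , ⟪ k , u ⟫ ⟫ ∷ [])) ≗ ⟨ q , ballName k u ⟩
  applyᵉ-correct {p} {g} {n} {q} e k u i = trans
    (interleaveᵉ-correct ⟨ p , g ⟩ (callᵉ tailᵉ (v₀ ∷ fstᵉ v₁ ∷ []))
      (callᵉ (nameᵉ ⌜ unaryᶜ (ballᵉ M) ⌝ v₁) (v₀ ∷ sndᵉ v₁ ∷ [])) ⟪ n , ⟪ k , u ⟫ ⟫ i)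
    (⟨⟩-cong
      (λ j → trans (cong (λ m → ⟦ tailᵉ ⟧ ⟨ p , g ⟩ (j ∷ m ∷ [])) (π₁-pair n _))
                   (tail-correct {p} {n = n} e j))
      (λ j → trans (cong (λ x → ⟦ nameᵉ ⌜ unaryᶜ (ballᵉ M) ⌝ v₁ ⟧ ⟨ p , g ⟩ (j ∷ x ∷ [])) (π₂-pair n _))
                   (nameᵉ-correct {⟨ p , g ⟩} ⌜ unaryᶜ (ballᵉ M) ⌝ v₁ ⟪ k , u ⟫ j))
      i)

  -- Arguments: n, k, v, i and s.  Non-zero iff within s steps machine n, applied to the ball of radius
  -- 2⁻ k around a v, outputs a positive rational as the i-th lower bound of its measure.
  chargedᵉ : Expr 5
  chargedᵉ = caseᵉ (callᵉ (runᵉ applyᵉ) (v₄ ∷ v₀ ∷ v₃ ∷ pairᵉ v₀ (pairᵉ v₁ v₂) ∷ [])) (lit 0) (positiveᵉ v₀)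

  -- Arguments: n, k, u, v, i and two numbers of steps.  The result is 0 iff v can follow u as the k-th centre.
  candidateᵉ : Expr 7
  candidateᵉ = ifzeroᵉ (callᵉ chargedᵉ (v₀ ∷ sucᵉ (sucᵉ v₁) ∷ v₃ ∷ v₄ ∷ v₅ ∷ [])) (lit 1)
    (caseᵉ v₁ (lit 0) (ifzeroᵉ (callᵉ (closeᵉ M) (v₇ ∷ v₃ ∷ v₄ ∷ v₀ ∷ sucᵉ v₀ ∷ [])) (lit 1) (lit 0)))

  opaque
    -- Centre, index of the lower bound and both numbers of steps are packed into one number, so
    -- that a single minimisation dovetails over all of them.
    testᵉ : Expr 2
    testᵉ = callᵉ candidateᵉ
      ( fstᵉ v₀
      ∷ fstᵉ (sndᵉ v₀)
      ∷ sndᵉ (sndᵉ v₀)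
      ∷ fstᵉ v₁
      ∷ fstᵉ (sndᵉ v₁)
      ∷ fstᵉ (sndᵉ (sndᵉ v₁))
      ∷ sndᵉ (sndᵉ (sndᵉ v₁))
      ∷ [])

  searchᶜ : Code
  searchᶜ = minᶜ (compᶜ (compile testᵉ) (pairᶜ fstᶜ (pairᶜ sndᶜ zeroᶜ)))

  -- The recursion starts from a dummy centre 0, which `succᶜ` skips in the output. With the tag n
  -- as its parameter, each step receives ⟪ n , ⟪ k , u ⟫ ⟫, the first argument of `testᵉ`.
  chooseᶜ : Code
  chooseᶜ = compᶜ (precᶜ zeroᶜ (compᶜ fstᶜ searchᶜ)) (pairᶜ tagᶜ succᶜ)

  module _ {o : Baire} where

    opaque
      unfolding testᵉ

      test-pair : ∀ n k u v i s t →
        ⟦ testᵉ ⟧ o (⟪ n , ⟪ k , u ⟫ ⟫ ∷ ⟪ v , ⟪ i , ⟪ s , t ⟫ ⟫ ⟫ ∷ []) ≡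
        ⟦ candidateᵉ ⟧ o (n ∷ k ∷ u ∷ v ∷ i ∷ s ∷ t ∷ [])
      test-pair n k u v i s t
        rewrite unpair-pair n ⟪ k , u ⟫ | unpair-pair k u
              | unpair-pair v ⟪ i , ⟪ s , t ⟫ ⟫ | unpair-pair i ⟪ s , t ⟫ | unpair-pair s t = refl

      test-unpair : ∀ n k u m → let v = π₁ m ; i = π₁ (π₂ m) ; s = π₁ (π₂ (π₂ m)) ; t = π₂ (π₂ (π₂ m)) in
        ⟦ testᵉ ⟧ o (⟪ n , ⟪ k , u ⟫ ⟫ ∷ m ∷ []) ≡ ⟦ candidateᵉ ⟧ o (n ∷ k ∷ u ∷ v ∷ i ∷ s ∷ t ∷ [])
      test-unpair n k u m
        rewrite unpair-pair n ⟪ k , u ⟫ | unpair-pair k u = refl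

    opaque
      search⇓ : ∀ N {m} → ⟦ testᵉ ⟧ o (N ∷ m ∷ []) ≡ 0 →
                ∃[ m ] o ⊢ searchᶜ [ N ]⇓ m × ⟦ testᵉ ⟧ o (N ∷ m ∷ []) ≡ 0
      search⇓ N = min⇓ (λ m → ⟦ testᵉ ⟧ o (N ∷ m ∷ [])) λ m → compᶜ
        (pairᶜ (subst (o ⊢ fstᶜ [ ⟪ N , m ⟫ ]⇓_) (π₁-pair N m) fstᶜ)
               (pairᶜ (subst (o ⊢ sndᶜ [ ⟪ N , m ⟫ ]⇓_) (π₂-pair N m) sndᶜ) zeroᶜ))
        (compile⇓ testᵉ (N ∷ m ∷ []))

  -- For k = 0 there is no preceding centre.
  Adjacent : ℕ → ℕ → ℕ → Set
  Adjacent zero    u v = ⊤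
  Adjacent (suc k) u v = d (a u) (a v) <ℝ fromℚ (2⁻ suc k)

  private
    -- `closeᵉ` compares with differences of powers of two; this choice of exponents makes the
    -- difference a power itself.
    half-step : ∀ k → νℚ (2⁻-difference k (suc k)) ≡ 2⁻ suc k
    half-step k = ∙-cancelʳ (2⁻ suc k) _ _ (trans (νℚ-2⁻-difference k (suc k)) (sym (2⁻-halves k)))

  module _ {o : Baire} where

    candidate-sound : ∀ n k u v i s t → ⟦ candidateᵉ ⟧ o (n ∷ k ∷ u ∷ v ∷ i ∷ s ∷ t ∷ []) ≡ 0 →
      ⟦ chargedᵉ ⟧ o (n ∷ suc (suc k) ∷ v ∷ i ∷ s ∷ []) ≢ 0 × Adjacent k u v
    candidate-sound n k u v i s t eq with ⟦ chargedᵉ ⟧ o (n ∷ suc (suc k) ∷ v ∷ i ∷ s ∷ [])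
    candidate-sound n zero    u v i s t eq | suc _ = (λ ()) , tt
    candidate-sound n (suc k) u v i s t eq | suc _
      with ⟦ closeᵉ M ⟧ o (t ∷ u ∷ v ∷ k ∷ suc k ∷ []) in close
    ... | suc _ = (λ ()) , subst (λ q → d (a u) (a v) <ℝ fromℚ q) (half-step k)
            (closeᵉ-sound M t u v k (suc k) λ eq₀ → ℕ.1+n≢0 (trans (sym close) eq₀))

    candidate-complete : ∀ n k u v i s → ⟦ chargedᵉ ⟧ o (n ∷ suc (suc k) ∷ v ∷ i ∷ s ∷ []) ≢ 0 →
      Adjacent k u v → ∃[ t ] ⟦ candidateᵉ ⟧ o (n ∷ k ∷ u ∷ v ∷ i ∷ s ∷ t ∷ []) ≡ 0
    candidate-complete n k u v i s ≢0 adj with ⟦ chargedᵉ ⟧ o (n ∷ suc (suc k) ∷ v ∷ i ∷ s ∷ [])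
    candidate-complete n k u v i s ≢0 adj | zero = ⊥-elim (≢0 refl)
    candidate-complete n zero    u v i s ≢0 adj | suc _ = 0 , refl
    candidate-complete n (suc k) u v i s ≢0 adj | suc _ =
      let t , close = closeᵉ-complete M {o} u v k (suc k)
            (subst (λ q → d (a u) (a v) <ℝ fromℚ q) (sym (half-step k)) adj)
      in  t , nonzero close
      where
      nonzero : ∀ {x} → x ≢ 0 → caseℕ x 1 (λ _ → 0) ≡ 0
      nonzero {zero}  ≢0 = ⊥-elim (≢0 refl)
      nonzero {suc _} _  = refl

    charged-sound : ∀ n k v i s → ⟦ chargedᵉ ⟧ o (n ∷ k ∷ v ∷ i ∷ s ∷ []) ≢ 0 →
      ∃[ w ] (λ i → ⟦ applyᵉ ⟧ o (i ∷ ⟪ n , ⟪ k , v ⟫ ⟫ ∷ [])) ⊢ machine n [ i ]⇓ w × 0ℚ ℚ.< νℚ w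
    charged-sound n k v i s ≢0 with ⟦ runᵉ applyᵉ ⟧ o (s ∷ n ∷ i ∷ ⟪ n , ⟪ k , v ⟫ ⟫ ∷ []) in eq
    ... | zero  = ⊥-elim (≢0 refl)
    ... | suc w = w , runᵉ-sound o applyᵉ ⟪ n , ⟪ k , v ⟫ ⟫ n i s eq , positive-sound w ≢0

    charged-complete : ∀ n k v i w →
      (λ i → ⟦ applyᵉ ⟧ o (i ∷ ⟪ n , ⟪ k , v ⟫ ⟫ ∷ [])) ⊢ machine n [ i ]⇓ w → 0ℚ ℚ.< νℚ w →
      ∃[ s ] ⟦ chargedᵉ ⟧ o (n ∷ k ∷ v ∷ i ∷ s ∷ []) ≢ 0
    charged-complete n k v i w w⇓ 0<w =
      let s , eq = runᵉ-complete o applyᵉ ⟪ n , ⟪ k , v ⟫ ⟫ n i w⇓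
      in  s , λ eq₀ → positive-complete w 0<w (trans (cong (λ x → caseℕ x 0 positive) (sym eq)) eq₀)

  module _ (lem : ∀ {ℓ} → ExcludedMiddle ℓ) where
    open Classical lem

    private
      X = metricSpace M

    module _ (μ : RepresentedSpace.Carrier (ℳ X)) where

      -- If the support were empty, no open set would meet it, so none would have positive measure;
      -- by non-negativity μ would vanish.
      support-nonempty : NonZero X μ → ∀ {S} → IsSupport X μ S → Satisfiable (⟦_⟧ᶜ X S)
      support-nonempty μ≢0 {S} supp = decidable-stable lem λ empty → μ≢0 λ U →
        (λ {q} q∈ → ℚ.≰⇒> λ 0≤q →
          let y , _ , y∈S = Equivalence.from (supp U) (q , q∈ , λ q<0 → ℚ.<-irrefl refl (ℚ.<-≤-trans q<0 0≤q))
          in  empty (y , y∈S)) ,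
        proj₂ (proj₂ (proj₂ μ) U) ∘ FiniteBorelMeasure.nonneg (proj₁ (proj₂ μ)) (openᵇ U)

    Meets : Closed X → ℕ → ℕ → Set _
    Meets S k v = Satisfiable (⟦_⟧ᵒ X (openBall M lem k v) ∩ ⟦_⟧ᶜ X S)

    Charged : Baire → ℕ → ℕ → ℕ → Set
    Charged o n k v = ∃₂ λ i s → ⟦ chargedᵉ ⟧ o (n ∷ k ∷ v ∷ i ∷ s ∷ []) ≢ 0

    module _
      (μ : RepresentedSpace.Carrier (ℳ X)) {S : Closed X} (supp : IsSupport X μ S)
      {p g q : Baire} {n : ℕ} (g-eq : g ≗ 0^ n ▹1 q)
      (F : PartialFunction) (computes : ComputesWithOracle n q F)
      (realizes : F Realizes ⌊_⌋ {X = 𝒪 X} {Y = ℝ<} (ContinuousMap.map (proj₁ μ)))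
      where

      private
        o = ⟨ p , g ⟩

        measured : ∀ k v → Σ[ e ∈ ballName k v ∈ PartialFunction.dom F ] ∃[ x ]
          RepresentedSpace._⊩_ ℝ< (PartialFunction.apply F (ballName k v) e) x ×
          ⟦_⟧ᵐ X μ (openBall M lem k v) ≈ℝ x
        measured k v = realizes (ballName k v) (openBall M lem k v) (openBall-name M lem k v)
          (⟦_⟧ᵐ X μ (openBall M lem k v) , id , id)

      charged⇒meets : ∀ k v → Charged o n k v → Meets S k v
      charged⇒meets k v (i , s , ≢0) = go (measured k v) (charged-sound n k v i s ≢0)
        where
        go : Σ[ e ∈ ballName k v ∈ PartialFunction.dom F ] ∃[ x ]
               RepresentedSpace._⊩_ ℝ< (PartialFunction.apply F (ballName k v) e) x ×
               ⟦_⟧ᵐ X μ (openBall M lem k v) ≈ℝ x →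
             ∃[ w ] (λ i → ⟦ applyᵉ ⟧ o (i ∷ ⟪ n , ⟪ k , v ⟫ ⟫ ∷ [])) ⊢ machine n [ i ]⇓ w × 0ℚ ℚ.< νℚ w →
             Meets S k v
        go (e , x , (_ , upper , _) , _ , x≤μ) (w , w⇓ , 0<w) = Equivalence.from (supp (openBall M lem k v))
          (0ℚ , x≤μ (upper i (subst (λ w → 0ℚ ℚ.< νℚ w)
            (⇓-functional (⇓-cong (applyᵉ-correct g-eq k v) w⇓) (computes (ballName k v) e i)) 0<w)) ,
           ℚ.<-irrefl refl)

      -- The measure of the ball is the least upper bound of the values output; were none of them
      -- positive, 0 would be an upper bound of a positive measure.
      meets⇒charged : ∀ k v → Meets S k v → Charged o n k v
      meets⇒charged k v meets = go (measured k v) (Equivalence.to (supp (openBall M lem k v)) meets)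
        where
        go : Σ[ e ∈ ballName k v ∈ PartialFunction.dom F ] ∃[ x ]
               RepresentedSpace._⊩_ ℝ< (PartialFunction.apply F (ballName k v) e) x ×
               ⟦_⟧ᵐ X μ (openBall M lem k v) ≈ℝ x →
             0ℝ <ℝ ⟦_⟧ᵐ X μ (openBall M lem k v) → Charged o n k v
        go (e , x , (_ , _ , least) , μ≤x , _) (r , r∈μ , r≮0) =
          let i , 0<w = decidable-stable lem λ none → r≮0
                (least 0ℝ (λ i → fromℚ-mono (ℚ.≮⇒≥ λ 0<w → none (i , 0<w))) (μ≤x r∈μ))
          in  i , charged-complete n k v i _
                (⇓-cong (λ j → sym (applyᵉ-correct g-eq k v j)) (computes (ballName k v) e i)) 0<w

    module Search
      {p g q : Baire} {tag : ℕ} (g-eq : g ≗ 0^ tag ▹1 q)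
      (S : Closed X) (nonempty : Satisfiable (⟦_⟧ᶜ X S))
      (charged⇒meets : ∀ k v → Charged ⟨ p , g ⟩ tag k v → Meets S k v)
      (meets⇒charged : ∀ k v → Meets S k v → Charged ⟨ p , g ⟩ tag k v)
      where

      private
        o = ⟨ p , g ⟩

        Near : ℕ → ℕ → Carrier → Set
        Near zero    u y = ⊤
        Near (suc k) u y = d y (a u) <ℝ fromℚ (2⁻ suc (suc k))

        -- The invariant that keeps the search from getting stuck: a support point y near u makes
        -- any centre close enough to y a valid successor. The search may return another centre,
        -- whose ball then contains a possibly different support point.
        Good : ℕ → ℕ → Set _
        Good k u = ∃[ y ] y ∈ ⟦_⟧ᶜ X S × Near k u y

        Found : ℕ → ℕ → ℕ → Set
        Found k u m = ⟦ testᵉ ⟧ o (⟪ tag , ⟪ k , u ⟫ ⟫ ∷ m ∷ []) ≡ 0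

        adjacent : ∀ k u v y → Near k u y → d y (a v) <ℝ fromℚ (2⁻ suc (suc k)) → Adjacent k u v
        adjacent zero    u v y _    _    = tt
        adjacent (suc k) u v y near near′ =
          near-trans-2⁻ M (suc k) (near-sym M near) (near-mono M (ℕ.n≤1+n (suc (suc k))) near′)

        opaque
          good⇒found : ∀ k u → Good k u → ∃ (Found k u)
          good⇒found k u (y , y∈S , near) with dense M y (suc (suc k))
          ... | v , near′ with meets⇒charged (suc (suc k)) v (y , dec-true lem near′ , y∈S)
          ...   | i , s , ≢0 with candidate-complete tag k u v i s ≢0 (adjacent k u v y near near′)
          ...     | t , eq = ⟪ v , ⟪ i , ⟪ s , t ⟫ ⟫ ⟫ , trans (test-pair tag k u v i s t) eq

          found⇒good : ∀ k u m → Found k u m → Adjacent k u (π₁ m) × Good (suc k) (π₁ m)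
          found⇒good k u m found
            with candidate-sound tag k u (π₁ m) (π₁ (π₂ m)) (π₁ (π₂ (π₂ m))) (π₂ (π₂ (π₂ m)))
                   (trans (sym (test-unpair tag k u m)) found)
          ... | ≢0 , adj with charged⇒meets (suc (suc k)) (π₁ m) (_ , _ , ≢0)
          ...   | z , z∈ball , z∈S = adj , z , z∈S , does-sound lem z∈ball

        -- The result of a minimisation is known only through its derivation, so the centres, the
        -- derivation computing them and the invariant are built together.
        record Stage (k : ℕ) : Set (c Level.⊔ ℓ) where
          field
            choice : ℕ
            rec    : Rec o zeroᶜ (compᶜ fstᶜ searchᶜ) tag k choice
            good   : Good k choice

        open Stage

        opaque
          advance : ∀ {k} (σ : Stage k) → Σ[ τ ∈ Stage (suc k) ] Adjacent k (choice σ) (choice τ)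
          advance {k} σ =
            let _ , found       = good⇒found k (choice σ) (good σ)
                m , m⇓ , found′ = search⇓ ⟪ tag , ⟪ k , choice σ ⟫ ⟫ found
                adj , good′     = found⇒good k (choice σ) m found′
            in  record { choice = π₁ m ; rec = step (rec σ) (compᶜ m⇓ fstᶜ) ; good = good′ } , adj

        stage : ∀ k → Stage k
        stage zero    = record { choice = 0 ; rec = base zeroᶜ ; good = proj₁ nonempty , proj₂ nonempty , tt }
        stage (suc k) = proj₁ (advance (stage k))

      chosen : Baire
      chosen k = choice (stage (suc k))

      choose⇓ : Total o chooseᶜ chosen
      choose⇓ k = compᶜ (pairᶜ (tag⇓ g-eq) succᶜ) (prec⇓ (rec (stage (suc k))))

      chosen-near : ∀ k → ∃[ y ] y ∈ ⟦_⟧ᶜ X S × d y (a (chosen k)) <ℝ fromℚ (2⁻ suc (suc k))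
      chosen-near k = good (stage (suc k))

      chosen-adjacent : ∀ k → d (a (chosen k)) (a (chosen (suc k))) <ℝ fromℚ (2⁻ suc k)
      chosen-adjacent k = proj₂ (advance (stage (suc k)))

    module _ {w : Baire} (adj : ∀ k → d (a (w k)) (a (w (suc k))) <ℝ fromℚ (2⁻ suc k)) where

      -- Induction on the number of steps with moving start: the first step and all later ones
      -- together each cost less than 2⁻ (i + 1).
      adjacent⇒fast : ∀ i k → i < k → d (a (w i)) (a (w k)) <ℝ fromℚ (2⁻ i)
      adjacent⇒fast i k i<k =
        subst (λ k → d (a (w i)) (a (w k)) <ℝ fromℚ (2⁻ i)) (ℕ.m∸n+n≡m i<k) (go (k ∸ suc i) i)
        where
        go : ∀ l i → d (a (w i)) (a (w (l + suc i))) <ℝ fromℚ (2⁻ i)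
        go zero    i = near-mono M (ℕ.n≤1+n i) (adj i)
        go (suc l) i = near-trans-2⁻ M i (adj i)
          (subst (λ k → d (a (w (suc i))) (a (w k)) <ℝ fromℚ (2⁻ suc i)) (ℕ.+-suc l (suc i)) (go l (suc i)))

      adjacent⇒Cauchy : Cauchy (a ∘ w)
      adjacent⇒Cauchy ε 0<ε with 2⁻-archimedean ε 0<ε
      ... | N , 2⁻N<ε = suc (suc N) , λ m n m> n> →
        <ℝ-fromℚ-mono {d (a (w m)) (a (w n))}
          (near-trans-2⁻ M N (near-sym M (adjacent⇒fast (suc N) m m>)) (adjacent⇒fast (suc N) n n>))
          (ℚ.<⇒≤ 2⁻N<ε)

    -- If y were in the open complement of A, so would be every point within some 2⁻ k of y. The
    -- centre with index k + 2 is within 2⁻ (k + 1) of y and of a support point z, which puts z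
    -- outside A.
    limit∈ : ∀ {w y} (A S : Closed X) → ⟦_⟧ᶜ X S ⊆ ⟦_⟧ᶜ X A → CauchyName w y →
             (∀ k → ∃[ z ] z ∈ ⟦_⟧ᶜ X S × d z (a (w k)) <ℝ fromℚ (2⁻ suc (suc k))) → y ∈ ⟦_⟧ᶜ X A
    limit∈ A S S⊆A name near y∈U =
      let k , inside = open-neighbourhood M lem (Closed.complement A) y∈U
          z , z∈S , zw = near (suc (suc k))
      in  S⊆A z∈S (inside z (near-trans-2⁻ M k
            (near-sym M (CauchyName-near-< M name (ℕ.n<1+n (suc k))))
            (near-sym M (near-mono M (s≤s (ℕ.m≤n+m k 3)) zw))))

    module _ (complete : Complete) where

      opaque
        choose : ∀ p g A {μ} → RepresentedSpace._⊩_ (ℳ X) g μ → Multifunction.graph (ConstructMeasure X) A μ →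
          Σ[ t ∈ ∃ (Total ⟨ p , g ⟩ chooseᶜ) ] ∃[ y ] CauchyName (proj₁ t) y × y ∈ ⟦_⟧ᶜ X A
        choose p g A {μ} (n , q , g-eq , F , computes , realizes) (_ , μ≢0 , S , supp , S⊆A) =
          (chosen , choose⇓) , proj₁ limit , name , limit∈ A S S⊆A name chosen-near
          where
          open Search {p} {g} {tag = n} g-eq S (support-nonempty μ μ≢0 {S} supp)
            (charged⇒meets μ {S} supp {p} {n = n} g-eq F computes realizes)
            (meets⇒charged μ {S} supp {p} {n = n} g-eq F computes realizes)

          limit : ∃[ y ] (a ∘ chosen) ⟶ y
          limit = complete (a ∘ chosen) (adjacent⇒Cauchy {chosen} chosen-adjacent)

          name : CauchyName chosen (proj₁ limit)
          name = (λ i k i<k → <ℝ-fromℚ⇒≤ℝ {d (a (chosen i)) (a (chosen k))}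
                   (adjacent⇒fast {chosen} chosen-adjacent i k i<k)) , proj₂ limit

      ClosedChoice≤W-ConstructMeasure : ClosedChoice X ≤W ConstructMeasure X
      ClosedChoice≤W-ConstructMeasure =
        program chooseᶜ , identity , program-computable _ , identity-computable ,
        λ G G-realizes p A p⊩A (x , x∈A) →
          -- A realizer is constrained only on the domain; the Dirac measure at x witnesses that A
          -- belongs to it.
          let e , μ , Gp⊩μ , constructs = G-realizes p A p⊩A (dirac lem X x , dirac-constructs lem M x A x∈A)
              t , y , name , y∈A = choose p (PartialFunction.apply G p e) A {μ} Gp⊩μ constructs
          in  ((tt , e) , t) , y , name , y∈A

theorem27 : (lem : ∀ {ℓ} → ExcludedMiddle ℓ) →
    let open Classical lem in
    ∀ {c ℓ} (X : ComputablePolishSpace c ℓ) →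
    let open ComputablePolishSpace X in
    ConstructMeasure space ≡W ClosedChoice space
theorem27 lem X =
  ConstructMeasure≤W-ClosedChoice lem metric , ClosedChoice≤W-ConstructMeasure metric lem complete
  where open ComputablePolishSpace X
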